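{- Let $n\in\mathbb{N}$. Then \begin{align*} N(1,1,5,5;n) =& \tfrac{4}{3}\sigma(n) - \tfrac{16}{3} \sigma (n/4) + \tfrac{20}{3} \sigma (n/5) -\tfrac{80}{3}\sigma(n/20) + \tfrac{8}{3}a_1(n),\\ N(1,1,10,10;n) =& \tfrac{2}{3}\sigma(n) - \tfrac{2}{3} \sigma (n/2) + \tfrac{4}{3} \sigma (n/4) + \tfrac{10}{3} \sigma (n/5) - \tfrac{16}{3}\sigma(n/8) - \tfrac{10}{3}\sigma(n/10) + \tfrac{20}{3}\sigma(n/20) - \tfrac{80}{3}\sigma(n/40)\\ &+ \tfrac{10}{3}a_1(n) + \tfrac{8}{3}a_2(n) +4a_3(n),\\ N(1,2,5,10;n) =& \sigma(n) - \sigma (n/2) -2 \sigma (n/4) - 5 \sigma (n/5) + 8 \sigma(n/8) + 5\sigma(n/10) + 10\sigma(n/20) - 40\sigma(n/40) + a_1(n) + 2a_3(n),\\ N(2,2,5,5;n) =& \tfrac{2}{3}\sigma(n) - \tfrac{2}{3} \sigma (n/2) + \tfrac{4}{3} \sigma (n/4) + \tfrac{10}{3} \sigma (n/5) - \tfrac{16}{3}\sigma(n/8) - \tfrac{10}{3}\sigma(n/10) +\tfrac{20}{3}\sigma(n/20) - \tfrac{80}{3}\sigma(n/40)\\ &- \tfrac{2}{3}a_1(n) + \tfrac{8}{3}a_2(n) -4a_3(n). \end{align*}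
   Context: For $a_1,a_2,a_3,a_4\in\mathbb{N}$ and $n\in\mathbb{N}_0$, $N(a_1,a_2,a_3,a_4;n)$ denotes the number of $(x_1,x_2,x_3,x_4)\in\mathbb{Z}^4$ with $n=a_1x_1^2+a_2x_2^2+a_3x_3^2+a_4x_4^2$. For $x\in\mathbb{N}$, $\sigma(x)=\sum_{d\mid x} d$ (sum over positive divisors); if $x\notin\mathbb{N}$ (e.g. a non-integer rational), $\sigma(x)=0$. Let $q=e^{2\pi i z}$ with $\mathrm{Im}(z)>0$ and $\eta(z)=q^{1/24}\prod_{m\ge1}(1-q^m)$ the Dedekind eta function. The integers $a_k(n)$ are defined by the $q$-expansions $\sum_{n\ge1}a_1(n)q^n=\eta^2(2z)\eta^2(10z)$, $\sum_{n\ge1}a_2(n)q^n=\eta^2(4z)\eta^2(20z)$, $\sum_{n\ge1}a_3(n)q^n=\dfrac{\eta^5(4z)\eta(10z)\eta^2(40z)}{\eta(2z)\eta^2(8z)\eta(20z)}$. -}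

module Defs where

open import Data.Nat as ℕ using (ℕ; zero; suc)
open import Data.Nat.Divisibility using (_∣?_)
open import Data.Integer as ℤ using (ℤ; +_; -_)
open import Data.List using (List; []; _∷_; map; concatMap; filter; length; upTo; applyUpTo)
open import Data.Product using (_×_; _,_)
open import Relation.Nullary.Decidable using (does)
open import Data.Bool using (if_then_else_)
import Data.Nat.Properties as ℕP
open import Data.Nat.ListAction using (sum)

intsUpTo : ℕ → List ℤ
intsUpTo n = + 0 ∷ concatMap (λ k → + suc k ∷ - (+ suc k) ∷ []) (upTo n)

-- N(a₁,a₂,a₃,a₄;n) = #{ (x₁,x₂,x₃,x₄) ∈ ℤ⁴ : n = a₁x₁² + a₂x₂² + a₃x₃² + a₄x₄² }.
-- For aᵢ ≥ 1 every solution satisfies |xᵢ| ≤ n, so the count over the box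
-- [-n,n]⁴ is the full count over ℤ⁴.
N : ℕ → ℕ → ℕ → ℕ → ℕ → ℕ
N a₁ a₂ a₃ a₄ n = length (filter (λ v → form v ℤ.≟ + n) box)
  where
  box : List (ℤ × ℤ × ℤ × ℤ)
  box = concatMap (λ x₁ → concatMap (λ x₂ → concatMap (λ x₃ → map (λ x₄ → (x₁ , x₂ , x₃ , x₄))
          (intsUpTo n)) (intsUpTo n)) (intsUpTo n)) (intsUpTo n)
  form : ℤ × ℤ × ℤ × ℤ → ℤ
  form (x₁ , x₂ , x₃ , x₄) =
    + a₁ ℤ.* (x₁ ℤ.* x₁) ℤ.+ + a₂ ℤ.* (x₂ ℤ.* x₂) ℤ.+ + a₃ ℤ.* (x₃ ℤ.* x₃) ℤ.+ + a₄ ℤ.* (x₄ ℤ.* x₄)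

-- σ(x) = sum of positive divisors of x (σ(0) = 0, never used for x = 0 below)
σ : ℕ → ℕ
σ x = sum (filter (λ d → d ∣? x) (applyUpTo suc x))

σ/ : ℕ → (d : ℕ) → .{{_ : ℕ.NonZero d}} → ℕ
σ/ n d = if does (d ∣? n) then σ (n ℕ./ d) else 0

PS : Set
PS = ℕ → ℤ

one : PS
one zero    = + 1
one (suc _) = + 0

_⊛_ : PS → PS → PS
(f ⊛ g) n = sumℤ (map (λ i → f i ℤ.* g (n ℕ.∸ i)) (upTo (suc n)))
  where
  sumℤ : List ℤ → ℤ
  sumℤ []       = + 0
  sumℤ (x ∷ xs) = x ℤ.+ sumℤ xs

infixl 7 _⊛_

_^ˢ_ : PS → ℕ → PS
f ^ˢ zero  = one
f ^ˢ suc e = f ⊛ (f ^ˢ e)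

oneMinus : ℕ → PS
oneMinus k j = if does (j ℕ.≟ 0) then + 1 else (if does (j ℕ.≟ k) then - (+ 1) else + 0)

-- 1/(1 - q^k) = Σ_{j ≥ 0} q^{kj}   (k ≥ 1)
geom : (k : ℕ) → .{{_ : ℕ.NonZero k}} → PS
geom k j = if does (k ∣? j) then + 1 else + 0

Eprod : ℕ → ℕ → PS
Eprod k zero    = one
Eprod k (suc M) = oneMinus (k ℕ.* suc M) ⊛ Eprod k M

Einv : (k : ℕ) → .{{_ : ℕ.NonZero k}} → ℕ → PS
Einv k zero    = one
Einv k (suc M) = geom (k ℕ.* suc M) {{ℕP.m*n≢0 k (suc M)}} ⊛ Einv k M

shift : ℕ → PS → PS
shift zero    f n       = f n
shift (suc s) f zero    = + 0
shift (suc s) f (suc n) = shift s f n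

-- The coefficient of q^n in an infinite product ∏_{m≥1}(…) only depends on the
-- factors with km ≤ n, so truncating every product at M = n gives the exact
-- coefficient of q^n.

-- η²(2z)η²(10z) = q ∏ (1-q^{2m})²(1-q^{10m})²
a₁ : ℕ → ℤ
a₁ n = shift 1 ((Eprod 2 n ^ˢ 2) ⊛ (Eprod 10 n ^ˢ 2)) n

-- η²(4z)η²(20z) = q² ∏ (1-q^{4m})²(1-q^{20m})²
a₂ : ℕ → ℤ
a₂ n = shift 2 ((Eprod 4 n ^ˢ 2) ⊛ (Eprod 20 n ^ˢ 2)) n

-- η⁵(4z)η(10z)η²(40z) / (η(2z)η²(8z)η(20z))
--   = q³ ∏ (1-q^{4m})⁵(1-q^{10m})(1-q^{40m})² / ((1-q^{2m})(1-q^{8m})²(1-q^{20m}))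
a₃ : ℕ → ℤ
a₃ n = shift 3 ((Eprod 4 n ^ˢ 5) ⊛ Eprod 10 n ⊛ (Eprod 40 n ^ˢ 2)
                 ⊛ Einv 2 n ⊛ (Einv 8 n ^ˢ 2) ⊛ Einv 20 n) n

-- Put φ(q) = ∑ q ^ n². Splitting ℤ² into cosets of the lattices generated by 1 + i, 2 + i and 1 + √-5 gives bilinear
-- relations between theta series, and the triple product turns the alternating ones into eta products. In particular
--   (φ(q)² - φ(q⁵)²) (5 φ(q⁵)² - φ(q)²) = 16 η²(2z) η²(10z),
-- which together with the values of φ(q)⁴ and φ(q)² φ(q²)² (Jacobi's four square theorem) yields the first, second and
-- fourth formula: their Eisenstein parts are combinations of these values at q and q⁵. The Eisenstein part of the third
-- formula is a combination of logarithmic derivatives of theta series instead. Differentiating the even part of the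
-- displayed relation, a polynomial relation between φ(q)², φ(q²)², φ(q⁵)² and φ(q¹⁰)², expresses these derivatives
-- rationally in the theta series, and what remains is an identity in the coordinate ring of a curve, which determines
-- the square of φ(q) φ(q²) φ(q⁵) φ(q¹⁰); the constant term fixes the sign.

module Submission where

open import Defs
open import Data.Nat using (ℕ; NonZero)
open import Data.Integer using (+_)
open import Data.Rational using (ℚ; _/_; _+_; _-_; _*_)
open import Relation.Binary.PropositionalEquality using (_≡_)
open import Data.Product using (_×_)

open import Algebra.Bundles using (CommutativeRing)
open import Algebra.Solver.Ring.AlmostCommutativeRing using (_-Raw-AlmostCommutative⟶_; fromCommutativeRing)
open import Algebra.Structures using (IsCommutativeRing)
open import Data.Bool using (Bool; true; false; if_then_else_; not; _xor_; _∧_)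
import Data.Bool.Properties as BoolP
open import Data.Fin as Fin using (Fin; zero; suc; toℕ)
import Data.Fin.Properties as FinP
open import Data.Integer as ℤ using (ℤ; -[1+_])
import Data.Integer.DivMod as ℤDM
import Data.Integer.Properties as ℤP
import Data.Integer.Solver as ℤS
open import Data.Integer.Tactic.RingSolver using (solve-∀)
open import Data.List using (List; []; _∷_; _++_; map; foldr; upTo; applyUpTo; filter; length; concatMap; cartesianProduct; mapMaybe)
open import Data.List.Membership.Propositional using (_∈_)
import Data.List.Membership.Propositional.Properties as MemP
open import Data.List.Membership.Propositional.Properties.WithK using (unique∧set⇒bag)
import Data.List.Properties as ListP
open import Data.List.Relation.Binary.BagAndSetEquality using (∼bag⇒↭)
open import Data.List.Relation.Binary.Permutation.Propositional as Perm using (_↭_)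
open import Data.List.Relation.Unary.All as All using (All; []; _∷_)
open import Data.List.Relation.Unary.AllPairs using ([]; _∷_)
open import Data.List.Relation.Unary.Any using (here; there)
open import Data.List.Relation.Unary.Unique.Propositional using (Unique)
import Data.List.Relation.Unary.Unique.Propositional.Properties as UniqueP
open import Data.Maybe.Base using (Maybe; just; nothing)
open import Data.Nat as ℕ using (zero; suc; _≤_; _<_; z≤n; s≤s)
open import Data.Nat.Divisibility using (_∣_; _∣?_; divides; m∣m*n; ∣m+n∣m⇒∣n; ∣-refl; ∣⇒≤; ∣-trans; *-cancelˡ-∣)
import Data.Nat.DivMod as ℕDM
open import Data.Nat.Induction using (<-wellFounded)
import Data.Nat.ListAction as ListAction
import Data.Nat.ListAction.Properties as ListActionP
import Data.Nat.Properties as ℕP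
import Data.Nat.Tactic.RingSolver as ℕSolver
open import Data.Product using (_,_; proj₁; proj₂; ∃)
import Data.Rational.Properties as ℚP
import Data.Rational.Solver as ℚS
import Data.Rational.Unnormalised as ℚᵘ
import Data.Rational.Unnormalised.Properties as ℚᵘP
open import Data.Sum using (_⊎_; inj₁; inj₂)
open import Data.Vec using ([]; _∷_)
open import Function using (_∘_; id; mk⇔)
open import Induction.WellFounded using (Acc; acc)
open import Level using (0ℓ)
open import Relation.Binary.PropositionalEquality using (_≢_; refl; sym; trans; cong; cong₂; subst; subst₂)
open import Relation.Nullary using (¬_; Dec; yes; no; does; contradiction; ¬?)
open import Relation.Nullary.Decidable using (dec-true; dec-false)

-- The ring of formal power series

-- No spaces of modular forms and no dimension counts occur: everything happens in ℤ[[q]]. Each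
-- algebraic step is an explicit combination of known relations, and a factor is cancelled by means
-- of a known nonzero leading coefficient. The obstacle is the third formula. A combination of Σ
-- σ(n/d) qⁿ with coefficients c_d comes from a modular form only if Σ c_d / d = 0. In the other
-- three formulas this holds for the divisors d of 8 and for 5 times these separately. In the third
-- the two sums are 1 and -1, so neither half is a combination of products of theta squares at q or
-- at q⁵, and four squares alone cannot produce it. Logarithmic derivatives have the same anomaly.
-- The even relation is homogeneous, so on the curve its derivative involves only the difference of
-- one such derivative at q and one at q⁵, and determines it. Moreover φ(q) φ(q²) φ(q⁵) φ(q¹⁰)
-- contains odd powers of theta series; only its square is a polynomial in the squares of theta
-- series. That is why a sign remains to be fixed.

tail : PS → PS
tail f n = f (suc n)

-- The Cauchy product by recursion along f = f 0 + q · `tail f`, so that the ring laws follow by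
-- induction on the degree.
conv : PS → PS → PS
conv f g zero    = f 0 ℤ.* g 0
conv f g (suc n) = f 0 ℤ.* g (suc n) ℤ.+ conv (tail f) g n

conv-cong : ∀ {f f′ g g′} → (∀ n → f n ≡ f′ n) → (∀ n → g n ≡ g′ n) → ∀ n → conv f g n ≡ conv f′ g′ n
conv-cong p q zero    = cong₂ ℤ._*_ (p 0) (q 0)
conv-cong p q (suc n) = cong₂ ℤ._+_ (cong₂ ℤ._*_ (p 0) (q (suc n))) (conv-cong (p ∘ suc) q n)

conv-+ : ∀ f f′ g n → conv (λ i → f i ℤ.+ f′ i) g n ≡ conv f g n ℤ.+ conv f′ g n
conv-+ f f′ g zero    = ℤP.*-distribʳ-+ (g 0) (f 0) (f′ 0)
conv-+ f f′ g (suc n) rewrite conv-+ (tail f) (tail f′) g n =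
  lemma (f 0) (f′ 0) (g (suc n)) (conv (tail f) g n) (conv (tail f′) g n)
  where
  lemma : ∀ x y z u v → (x ℤ.+ y) ℤ.* z ℤ.+ (u ℤ.+ v) ≡ (x ℤ.* z ℤ.+ u) ℤ.+ (y ℤ.* z ℤ.+ v)
  lemma = solve-∀

conv-scale : ∀ c f g n → conv (λ i → c ℤ.* f i) g n ≡ c ℤ.* conv f g n
conv-scale c f g zero    = ℤP.*-assoc c (f 0) (g 0)
conv-scale c f g (suc n) rewrite conv-scale c (tail f) g n = lemma c (f 0) (g (suc n)) (conv (tail f) g n)
  where
  lemma : ∀ c x z u → (c ℤ.* x) ℤ.* z ℤ.+ c ℤ.* u ≡ c ℤ.* (x ℤ.* z ℤ.+ u)
  lemma = solve-∀

conv-zero : ∀ g n → conv (λ _ → + 0) g n ≡ + 0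
conv-zero g zero    = refl
conv-zero g (suc n) = trans (ℤP.+-identityˡ _) (conv-zero g n)

conv-const : ∀ c f g n → f 0 ≡ c → (∀ i → f (suc i) ≡ + 0) → conv f g n ≡ c ℤ.* g n
conv-const c f g zero    p q = cong (ℤ._* g 0) p
conv-const c f g (suc n) p q = trans
  (cong₂ ℤ._+_ (cong (ℤ._* g (suc n)) p) (trans (conv-cong q (λ _ → refl) n) (conv-zero g n)))
  (ℤP.+-identityʳ _)

conv-sucʳ : ∀ f g n → conv f g (suc n) ≡ f (suc n) ℤ.* g 0 ℤ.+ conv f (tail g) n
conv-sucʳ f g zero    = ℤP.+-comm (f 0 ℤ.* g 1) (f 1 ℤ.* g 0)
conv-sucʳ f g (suc n) rewrite conv-sucʳ (tail f) g n =
  lemma (f 0 ℤ.* g (suc (suc n))) (f (suc (suc n)) ℤ.* g 0) (conv (tail f) (tail g) n)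
  where
  lemma : ∀ x y z → x ℤ.+ (y ℤ.+ z) ≡ y ℤ.+ (x ℤ.+ z)
  lemma = solve-∀

conv-comm : ∀ f g n → conv f g n ≡ conv g f n
conv-comm f g zero    = ℤP.*-comm (f 0) (g 0)
conv-comm f g (suc n) = trans (cong₂ ℤ._+_ (ℤP.*-comm (f 0) (g (suc n))) (conv-comm (tail f) g n))
                              (sym (conv-sucʳ g f n))

conv-assoc : ∀ f g h n → conv (conv f g) h n ≡ conv f (conv g h) n
conv-assoc f g h zero    = ℤP.*-assoc (f 0) (g 0) (h 0)
conv-assoc f g h (suc n)
  rewrite conv-+ (λ i → f 0 ℤ.* g (suc i)) (conv (tail f) g) h n
        | conv-scale (f 0) (tail g) h n
        | conv-assoc (tail f) g h n =
  lemma (f 0) (g 0) (h (suc n)) (conv (tail g) h n) (conv (tail f) (conv g h) n)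
  where
  lemma : ∀ x y z u v → (x ℤ.* y) ℤ.* z ℤ.+ (x ℤ.* u ℤ.+ v) ≡ x ℤ.* (y ℤ.* z ℤ.+ u) ℤ.+ v
  lemma = solve-∀

⊛≡conv : ∀ f g n → (f ⊛ g) n ≡ conv f g n
⊛≡conv f g n = trans (trans ⊛-sum (cong (foldr ℤ._+_ (+ 0)) (ListP.map-applyUpTo id (λ i → f i ℤ.* g (n ℕ.∸ i)) (suc n)))) (sums f g n)
  where
  -- The list summation inside the definition of _⊛_ has no name of its own; it is recovered by unification.
  listSum : List ℤ → ℤ
  listSum = _
  listSum-foldr : (S : List ℤ → ℤ) → S [] ≡ + 0 → (∀ x xs → S (x ∷ xs) ≡ x ℤ.+ S xs) →
                  ∀ xs → S xs ≡ foldr ℤ._+_ (+ 0) xs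
  listSum-foldr S p q []       = p
  listSum-foldr S p q (x ∷ xs) = trans (q x xs) (cong (ℤ._+_ x) (listSum-foldr S p q xs))
  ⊛-sum : (f ⊛ g) n ≡ foldr ℤ._+_ (+ 0) (map (λ i → f i ℤ.* g (n ℕ.∸ i)) (upTo (suc n)))
  ⊛-sum with map (λ i → f i ℤ.* g (n ℕ.∸ i)) (applyUpTo suc n)
  ... | xs = cong (ℤ._+_ (f 0 ℤ.* g n)) (listSum-foldr listSum refl (λ _ _ → refl) xs)
  sums : ∀ f g n → foldr ℤ._+_ (+ 0) (applyUpTo (λ i → f i ℤ.* g (n ℕ.∸ i)) (suc n)) ≡ conv f g n
  sums f g zero    = ℤP.+-identityʳ _
  sums f g (suc n) = cong (ℤ._+_ (f 0 ℤ.* g (suc n))) (sums (tail f) g n)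

infix 4 _≈_
-- A record instead of the bare pointwise equality, so that both series stay visible to unification.
record _≈_ (f g : PS) : Set where
  constructor coeffs
  field coeff : ∀ n → f n ≡ g n
open _≈_

infixl 6 _+ˢ_
infixl 7 _*ˢ_
infix  8 -ˢ_

opaque
  _+ˢ_ : PS → PS → PS
  (f +ˢ g) n = f n ℤ.+ g n

  -ˢ_ : PS → PS
  (-ˢ f) n = ℤ.- f n

  _*ˢ_ : PS → PS → PS
  _*ˢ_ = conv

  const : ℤ → PS
  const c zero    = c
  const c (suc _) = + 0

  +ˢ-coeff : ∀ f g n → (f +ˢ g) n ≡ f n ℤ.+ g n
  +ˢ-coeff f g n = refl

  -ˢ-coeff : ∀ f n → (-ˢ f) n ≡ ℤ.- f n
  -ˢ-coeff f n = refl

  *ˢ-coeff : ∀ f g n → (f *ˢ g) n ≡ conv f g n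
  *ˢ-coeff f g n = refl

  const-zero : ∀ c → const c 0 ≡ c
  const-zero c = refl

  const-suc : ∀ c n → const c (suc n) ≡ + 0
  const-suc c n = refl

  const-*ˢ : ∀ c f n → (const c *ˢ f) n ≡ c ℤ.* f n
  const-*ˢ c f n = conv-const c (const c) f n refl (λ _ → refl)

  ps-isCommutativeRing : IsCommutativeRing _≈_ _+ˢ_ _*ˢ_ -ˢ_ (const (+ 0)) (const (+ 1))
  ps-isCommutativeRing = record
    { isRing = record
      { +-isAbelianGroup = record
        { isGroup = record
          { isMonoid = record
            { isSemigroup = record
              { isMagma = record
                { isEquivalence = record
                  { refl  = coeffs λ _ → refl
                  ; sym   = λ p → coeffs λ n → sym (coeff p n)
                  ; trans = λ p q → coeffs λ n → trans (coeff p n) (coeff q n) }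
                ; ∙-cong = λ p q → coeffs λ n → cong₂ ℤ._+_ (coeff p n) (coeff q n) }
              ; assoc = λ f g h → coeffs λ n → ℤP.+-assoc (f n) (g n) (h n) }
            ; identity = (λ f → coeffs λ { zero → ℤP.+-identityˡ _ ; (suc n) → ℤP.+-identityˡ _ })
                       , (λ f → coeffs λ { zero → ℤP.+-identityʳ _ ; (suc n) → ℤP.+-identityʳ _ }) }
          ; inverse = (λ f → coeffs λ { zero → ℤP.+-inverseˡ (f 0) ; (suc n) → ℤP.+-inverseˡ (f (suc n)) })
                    , (λ f → coeffs λ { zero → ℤP.+-inverseʳ (f 0) ; (suc n) → ℤP.+-inverseʳ (f (suc n)) })
          ; ⁻¹-cong = λ p → coeffs λ n → cong ℤ.-_ (coeff p n) }
        ; comm = λ f g → coeffs λ n → ℤP.+-comm (f n) (g n) }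
      ; *-cong = λ p q → coeffs (conv-cong (coeff p) (coeff q))
      ; *-assoc = λ f g h → coeffs (conv-assoc f g h)
      ; *-identity = (λ f → coeffs (one-left f))
                   , (λ f → coeffs λ n → trans (conv-comm f (const (+ 1)) n) (one-left f n))
      ; distrib = (λ f g h → coeffs λ n → trans (conv-comm f (g +ˢ h) n) (trans (conv-+ g h f n)
                              (cong₂ ℤ._+_ (conv-comm g f n) (conv-comm h f n))))
                , (λ f g h → coeffs (conv-+ g h f)) }
    ; *-comm = λ f g → coeffs (conv-comm f g) }
    where
    one-left : ∀ f n → conv (const (+ 1)) f n ≡ f n
    one-left f n = trans (conv-const (+ 1) (const (+ 1)) f n refl (λ _ → refl)) (ℤP.*-identityˡ _)

  const-homo-+ : ∀ x y → const (x ℤ.+ y) ≈ const x +ˢ const y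
  const-homo-+ x y = coeffs λ { zero → refl ; (suc n) → refl }

  const-homo-* : ∀ x y → const (x ℤ.* y) ≈ const x *ˢ const y
  const-homo-* x y = coeffs λ
    { zero    → refl
    ; (suc n) → sym (trans (conv-const x (const x) (const y) (suc n) refl (λ _ → refl)) (ℤP.*-zeroʳ x)) }

  const-homo-neg : ∀ x → const (ℤ.- x) ≈ -ˢ const x
  const-homo-neg x = coeffs λ { zero → refl ; (suc n) → refl }

ps-ring : CommutativeRing 0ℓ 0ℓ
ps-ring = record { isCommutativeRing = ps-isCommutativeRing }

open CommutativeRing ps-ring
  using (+-cong; *-cong; -‿cong; +-assoc; *-assoc; *-comm; +-identityˡ; +-identityʳ;
         *-identityˡ; *-identityʳ; distribˡ; distribʳ; zeroˡ; zeroʳ; -‿inverseʳ)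
  renaming (refl to ≈-refl; sym to ≈-sym; trans to ≈-trans; _-_ to _-ˢ_)

const-morphism : CommutativeRing.rawRing ℤP.+-*-commutativeRing -Raw-AlmostCommutative⟶ fromCommutativeRing ps-ring
const-morphism = record
  { ⟦_⟧ = const ; +-homo = const-homo-+ ; *-homo = const-homo-* ; -‿homo = const-homo-neg
  ; 0-homo = ≈-refl ; 1-homo = ≈-refl }

const-≟ : ∀ x y → Maybe (const x ≈ const y)
const-≟ x y with x ℤ.≟ y
... | yes refl = just ≈-refl
... | no _     = nothing

open import Algebra.Solver.Ring (CommutativeRing.rawRing ℤP.+-*-commutativeRing) (fromCommutativeRing ps-ring) const-morphism const-≟
  using (Polynomial; solve; con; _:+_; _:*_; _:-_; :-_; _:=_)

-- Congruences modulo powers of q, and cancellation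

infix 4 _≈[_]_
-- Congruence modulo q^(n+1). Infinite products and sums are handled through it, and `≈[]⇒≈` passes
-- to the limit.
record _≈[_]_ (f : PS) (n : ℕ) (g : PS) : Set where
  constructor coeffs≤
  field coeff≤ : ∀ i → i ≤ n → f i ≡ g i
open _≈[_]_

conv-cong≤ : ∀ {f f′ g g′} n → (∀ i → i ≤ n → f i ≡ f′ i) → (∀ i → i ≤ n → g i ≡ g′ i) → conv f g n ≡ conv f′ g′ n
conv-cong≤ zero    p q = cong₂ ℤ._*_ (p 0 z≤n) (q 0 z≤n)
conv-cong≤ (suc n) p q = cong₂ ℤ._+_ (cong₂ ℤ._*_ (p 0 z≤n) (q (suc n) ℕP.≤-refl))
  (conv-cong≤ n (λ i i≤n → p (suc i) (s≤s i≤n)) (λ i i≤n → q i (ℕP.m≤n⇒m≤1+n i≤n)))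

≈⇒≈[] : ∀ {f g n} → f ≈ g → f ≈[ n ] g
≈⇒≈[] p = coeffs≤ λ i _ → coeff p i

≈[]-sym : ∀ {f g n} → f ≈[ n ] g → g ≈[ n ] f
≈[]-sym p = coeffs≤ λ i h → sym (coeff≤ p i h)

≈[]-trans : ∀ {f g h n} → f ≈[ n ] g → g ≈[ n ] h → f ≈[ n ] h
≈[]-trans p q = coeffs≤ λ i h → trans (coeff≤ p i h) (coeff≤ q i h)

≈[]⇒≈ : ∀ {f g} → (∀ n → f ≈[ n ] g) → f ≈ g
≈[]⇒≈ p = coeffs λ n → coeff≤ (p n) n ℕP.≤-refl

+-cong[] : ∀ {f f′ g g′ n} → f ≈[ n ] f′ → g ≈[ n ] g′ → f +ˢ g ≈[ n ] f′ +ˢ g′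
+-cong[] {f} {f′} {g} {g′} p q = coeffs≤ λ i h →
  trans (+ˢ-coeff f g i) (trans (cong₂ ℤ._+_ (coeff≤ p i h) (coeff≤ q i h)) (sym (+ˢ-coeff f′ g′ i)))

*-cong[] : ∀ {f f′ g g′ n} → f ≈[ n ] f′ → g ≈[ n ] g′ → f *ˢ g ≈[ n ] f′ *ˢ g′
*-cong[] {f} {f′} {g} {g′} p q = coeffs≤ λ i h → trans (*ˢ-coeff f g i) (trans
  (conv-cong≤ i (λ j j≤i → coeff≤ p j (ℕP.≤-trans j≤i h)) (λ j j≤i → coeff≤ q j (ℕP.≤-trans j≤i h)))
  (sym (*ˢ-coeff f′ g′ i)))

conv-vanish : ∀ f g n → (∀ i → i ≤ n → g i ≡ + 0) → conv f g n ≡ + 0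
conv-vanish f g n p = trans (conv-cong≤ n (λ _ _ → refl) p)
  (trans (conv-comm f (λ _ → + 0) n) (conv-zero f n))

conv-leading : ∀ a b f g → (∀ i → i < a → f i ≡ + 0) → (∀ i → i < b → g i ≡ + 0) →
               conv f g (a ℕ.+ b) ≡ f a ℤ.* g b
conv-leading zero    zero    f g p q = refl
conv-leading zero    (suc b) f g p q = trans
  (cong (ℤ._+_ (f 0 ℤ.* g (suc b))) (conv-vanish (tail f) g b λ i i≤b → q i (s≤s i≤b))) (ℤP.+-identityʳ _)
conv-leading (suc a) b f g p q = trans
  (cong₂ ℤ._+_ (cong (ℤ._* g (suc (a ℕ.+ b))) (p 0 (s≤s z≤n))) (conv-leading a b (tail f) g (λ i i<a → p (suc i) (s≤s i<a)) q))
  (ℤP.+-identityˡ _)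

*ˢ-leading : ∀ a b f g → (∀ i → i < a → f i ≡ + 0) → (∀ i → i < b → g i ≡ + 0) →
             (f *ˢ g) (a ℕ.+ b) ≡ f a ℤ.* g b
*ˢ-leading a b f g p q = trans (*ˢ-coeff f g (a ℕ.+ b)) (conv-leading a b f g p q)

0ˢ : PS
0ˢ = const (+ 0)

0ˢ-coeff : ∀ n → 0ˢ n ≡ + 0
0ˢ-coeff zero    = const-zero (+ 0)
0ˢ-coeff (suc n) = const-suc (+ 0) n

-- Once g is known to vanish below n, the coefficient of q^(a+n) in the product is f a times g n.
-- Naming the leading coefficient of f avoids having to search for it.
*ˢ-cancel-0 : ∀ a f g → (∀ i → i < a → f i ≡ + 0) → f a ≢ + 0 → f *ˢ g ≈ 0ˢ → g ≈ 0ˢ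
*ˢ-cancel-0 a f g p fa≢0 eq = coeffs λ n → trans (go n (<-wellFounded n)) (sym (0ˢ-coeff n))
  where
  go : ∀ n → Acc _<_ n → g n ≡ + 0
  go n (acc rec) with ℤP.i*j≡0⇒i≡0∨j≡0 (f a) (trans (sym (*ˢ-leading a n f g p (λ i i<n → go i (rec i<n))))
                                                    (trans (coeff eq (a ℕ.+ n)) (0ˢ-coeff (a ℕ.+ n))))
  ... | inj₁ fa≡0 = contradiction fa≡0 fa≢0
  ... | inj₂ gn≡0 = gn≡0

-ˢ≈0⇒≈ : ∀ {f g} → f -ˢ g ≈ 0ˢ → f ≈ g
-ˢ≈0⇒≈ {f} {g} p = ≈-trans (solve 2 (λ f g → f := (f :- g) :+ g) ≈-refl f g)
  (≈-trans (+-cong p ≈-refl) (+-identityˡ g))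

≈⇒-ˢ≈0 : ∀ {f g} → f ≈ g → f -ˢ g ≈ 0ˢ
≈⇒-ˢ≈0 {f} {g} p = ≈-trans (+-cong p ≈-refl) (-‿inverseʳ g)

*ˢ-cancelˡ : ∀ a f {g h} → (∀ i → i < a → f i ≡ + 0) → f a ≢ + 0 → f *ˢ g ≈ f *ˢ h → g ≈ h
*ˢ-cancelˡ a f {g} {h} p fa≢0 eq = -ˢ≈0⇒≈ (*ˢ-cancel-0 a f (g -ˢ h) p fa≢0
  (≈-trans (solve 3 (λ f g h → f :* (g :- h) := f :* g :- f :* h) ≈-refl f g h) (≈⇒-ˢ≈0 eq)))

const-cancel : ∀ c {g h} → c ≢ + 0 → const c *ˢ g ≈ const c *ˢ h → g ≈ h
const-cancel c c≢0 = *ˢ-cancelˡ 0 (const c) (λ _ ()) (λ e → c≢0 (trans (sym (const-zero c)) e))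

unit-cancel : ∀ f {g h} → f 0 ≡ + 1 → f *ˢ g ≈ f *ˢ h → g ≈ h
unit-cancel f f0 = *ˢ-cancelˡ 0 f (λ _ ()) (λ e → contradiction (trans (sym f0) e) λ ())

-- An ideal membership certificate: X - Y is a combination of differences l - r that are known to
-- vanish. The first argument is a pure polynomial identity, left to the ring solver; the cofactors
-- in it carry the content of each use.
comb₁ : ∀ {X Y c l r} → X ≈ Y +ˢ c *ˢ (l -ˢ r) → l ≈ r → X ≈ Y
comb₁ {X} {Y} {c} p e = ≈-trans p (≈-trans (+-cong ≈-refl (≈-trans (*-cong ≈-refl (≈⇒-ˢ≈0 e)) (zeroʳ c))) (+-identityʳ Y))

comb₂ : ∀ {X Y c l r c′ l′ r′} → X ≈ Y +ˢ c *ˢ (l -ˢ r) +ˢ c′ *ˢ (l′ -ˢ r′) → l ≈ r → l′ ≈ r′ → X ≈ Y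
comb₂ p e e′ = comb₁ (comb₁ p e′) e

comb₃ : ∀ {X Y c l r c′ l′ r′ c″ l″ r″} →
        X ≈ Y +ˢ c *ˢ (l -ˢ r) +ˢ c′ *ˢ (l′ -ˢ r′) +ˢ c″ *ˢ (l″ -ˢ r″) → l ≈ r → l′ ≈ r′ → l″ ≈ r″ → X ≈ Y
comb₃ p e e′ e″ = comb₂ (comb₁ p e″) e e′

-- Monomials w q^e

tm : ℤ → ℕ → PS
tm w zero    zero    = w
tm w zero    (suc n) = + 0
tm w (suc e) zero    = + 0
tm w (suc e) (suc n) = tm w e n

q^ : ℕ → PS
q^ = tm (+ 1)

conv-tm-< : ∀ w e f n → n < e → conv (tm w e) f n ≡ + 0
conv-tm-< w (suc e) f zero    (s≤s h) = refl
conv-tm-< w (suc e) f (suc n) (s≤s h) = trans (ℤP.+-identityˡ _) (conv-tm-< w e f n h)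

conv-tm-+ : ∀ w e f n → conv (tm w e) f (e ℕ.+ n) ≡ w ℤ.* f n
conv-tm-+ w zero    f n = conv-const w (tm w 0) f n refl (λ _ → refl)
conv-tm-+ w (suc e) f n = trans (ℤP.+-identityˡ _) (conv-tm-+ w e f n)

tm-*-< : ∀ w e f n → n < e → (tm w e *ˢ f) n ≡ + 0
tm-*-< w e f n h = trans (*ˢ-coeff (tm w e) f n) (conv-tm-< w e f n h)

tm-*-+ : ∀ w e f n → (tm w e *ˢ f) (e ℕ.+ n) ≡ w ℤ.* f n
tm-*-+ w e f n = trans (*ˢ-coeff (tm w e) f (e ℕ.+ n)) (conv-tm-+ w e f n)

tm-zero : ∀ w → tm w 0 ≈ const w
tm-zero w = coeffs λ { zero → sym (const-zero w) ; (suc n) → sym (const-suc w n) }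

tm-* : ∀ w e w′ e′ → tm w e *ˢ tm w′ e′ ≈ tm (w ℤ.* w′) (e ℕ.+ e′)
tm-* w e w′ e′ = coeffs λ n → trans (*ˢ-coeff (tm w e) (tm w′ e′) n) (go e n)
  where
  go : ∀ e n → conv (tm w e) (tm w′ e′) n ≡ tm (w ℤ.* w′) (e ℕ.+ e′) n
  go zero    n = trans (conv-tm-+ w 0 (tm w′ e′) n) (scale e′ n)
    where
    scale : ∀ e n → w ℤ.* tm w′ e n ≡ tm (w ℤ.* w′) e n
    scale zero    zero    = refl
    scale zero    (suc n) = ℤP.*-zeroʳ w
    scale (suc e) zero    = ℤP.*-zeroʳ w
    scale (suc e) (suc n) = scale e n
  go (suc e) zero    = refl
  go (suc e) (suc n) = trans (ℤP.+-identityˡ _) (go e n)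

tm-const : ∀ c w e → const c *ˢ tm w e ≈ tm (c ℤ.* w) e
tm-const c w e = ≈-trans (*-cong (≈-sym (tm-zero c)) ≈-refl) (tm-* c 0 w e)

q^-+ : ∀ m n → q^ m *ˢ q^ n ≈ q^ (m ℕ.+ n)
q^-+ m n = tm-* (+ 1) m (+ 1) n

tm-diag : ∀ w e → tm w e e ≡ w
tm-diag w zero    = refl
tm-diag w (suc e) = tm-diag w e

tm-off : ∀ w e n → n ≢ e → tm w e n ≡ + 0
tm-off w zero    zero    h = contradiction refl h
tm-off w zero    (suc n) h = refl
tm-off w (suc e) zero    h = refl
tm-off w (suc e) (suc n) h = tm-off w e n (h ∘ cong suc)

shift≡q^* : ∀ k f n → shift k f n ≡ (q^ k *ˢ f) n
shift≡q^* k f n = trans (go k n) (sym (*ˢ-coeff (q^ k) f n))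
  where
  go : ∀ k n → shift k f n ≡ conv (q^ k) f n
  go zero    n       = sym (trans (conv-tm-+ (+ 1) 0 f n) (ℤP.*-identityˡ _))
  go (suc k) zero    = refl
  go (suc k) (suc n) = trans (go k n) (sym (ℤP.+-identityˡ _))

tm-*-cong[] : ∀ w e {f g} n → (∀ i → e ℕ.+ i ≤ n → f i ≡ g i) → tm w e *ˢ f ≈[ n ] tm w e *ˢ g
tm-*-cong[] w e {f} {g} n p = coeffs≤ go
  where
  go : ∀ i → i ≤ n → (tm w e *ˢ f) i ≡ (tm w e *ˢ g) i
  go i h with i ℕP.<? e
  ... | yes i<e = trans (tm-*-< w e f i i<e) (sym (tm-*-< w e g i i<e))
  ... | no  i≮e with ℕP.m≤n⇒∃[o]m+o≡n (ℕP.≮⇒≥ i≮e)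
  ...   | j , refl = trans (tm-*-+ w e f j) (trans (cong (ℤ._*_ w) (p j h)) (sym (tm-*-+ w e g j)))

-- The substitution q ↦ q ^ k

opaque
  dil : (k : ℕ) → .{{_ : NonZero k}} → PS → PS
  dil k f n = if does (k ∣? n) then f (n ℕ./ k) else + 0

  dil-view : ∀ k .{{_ : NonZero k}} n → (∃ λ m → n ≡ k ℕ.* m × (∀ f → dil k f n ≡ f m))
                                     ⊎ (¬ k ∣ n × (∀ f → dil k f n ≡ + 0))
  dil-view k n with k ∣? n
  ... | yes (divides m refl) = inj₁ (m , ℕP.*-comm m k , λ f → cong f (ℕDM.m*n/n≡m m k))
  ... | no  k∤n              = inj₂ (k∤n , λ _ → refl)

  dil-coeff : ∀ k .{{_ : NonZero k}} f n → dil k f n ≡ (if does (k ∣? n) then f (n ℕ./ k) else + 0)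
  dil-coeff k f n = refl

dil-* : ∀ k .{{_ : NonZero k}} f m → dil k f (k ℕ.* m) ≡ f m
dil-* k f m with dil-view k (k ℕ.* m)
... | inj₁ (m′ , eq , h) = trans (h f) (cong f (ℕP.*-cancelˡ-≡ m′ m k (sym eq)))
... | inj₂ (k∤n , _)     = contradiction (m∣m*n m) k∤n

dil-∤ : ∀ k .{{_ : NonZero k}} f n → ¬ k ∣ n → dil k f n ≡ + 0
dil-∤ k f n k∤n with dil-view k n
... | inj₁ (m , eq , _) = contradiction (divides m (trans eq (ℕP.*-comm k m))) k∤n
... | inj₂ (_ , h)      = h f

dil-0 : ∀ k .{{_ : NonZero k}} f → dil k f 0 ≡ f 0
dil-0 k f = trans (cong (dil k f) (sym (ℕP.*-zeroʳ k))) (dil-* k f 0)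

dil-cong : ∀ k .{{_ : NonZero k}} {f g} → f ≈ g → dil k f ≈ dil k g
dil-cong k {f} {g} p = coeffs go
  where
  go : ∀ n → dil k f n ≡ dil k g n
  go n with dil-view k n
  ... | inj₁ (m , _ , h) = trans (h f) (trans (coeff p m) (sym (h g)))
  ... | inj₂ (_ , h)     = trans (h f) (sym (h g))

dil-cong[] : ∀ k .{{_ : NonZero k}} {f g n} → f ≈[ n ] g → dil k f ≈[ n ] dil k g
dil-cong[] k {f} {g} p = coeffs≤ go
  where
  go : ∀ i → i ≤ _ → dil k f i ≡ dil k g i
  go i i≤n with dil-view k i
  ... | inj₁ (m , refl , h) = trans (h f) (trans (coeff≤ p m (ℕP.≤-trans (ℕP.m≤n*m m k) i≤n)) (sym (h g)))
  ... | inj₂ (_ , h)        = trans (h f) (sym (h g))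

dil-+ˢ : ∀ k .{{_ : NonZero k}} f g → dil k (f +ˢ g) ≈ dil k f +ˢ dil k g
dil-+ˢ k f g = coeffs λ n → trans (go n) (sym (+ˢ-coeff (dil k f) (dil k g) n))
  where
  go : ∀ n → dil k (f +ˢ g) n ≡ dil k f n ℤ.+ dil k g n
  go n with dil-view k n
  ... | inj₁ (m , _ , h) = trans (h (f +ˢ g)) (trans (+ˢ-coeff f g m) (sym (cong₂ ℤ._+_ (h f) (h g))))
  ... | inj₂ (_ , h)     = trans (h (f +ˢ g)) (sym (cong₂ ℤ._+_ (h f) (h g)))

dil-neg : ∀ k .{{_ : NonZero k}} f → dil k (-ˢ f) ≈ -ˢ dil k f
dil-neg k f = coeffs λ n → trans (go n) (sym (-ˢ-coeff (dil k f) n))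
  where
  go : ∀ n → dil k (-ˢ f) n ≡ ℤ.- dil k f n
  go n with dil-view k n
  ... | inj₁ (m , _ , h) = trans (h (-ˢ f)) (trans (-ˢ-coeff f m) (cong ℤ.-_ (sym (h f))))
  ... | inj₂ (_ , h)     = trans (h (-ˢ f)) (cong ℤ.-_ (sym (h f)))

dil-tm : ∀ k .{{_ : NonZero k}} w e → dil k (tm w e) ≈ tm w (k ℕ.* e)
dil-tm k w e = coeffs go
  where
  go : ∀ n → dil k (tm w e) n ≡ tm w (k ℕ.* e) n
  go n with n ℕ.≟ k ℕ.* e
  ... | yes refl = trans (dil-* k (tm w e) e) (trans (tm-diag w e) (sym (tm-diag w (k ℕ.* e))))
  ... | no  n≢ke with dil-view k n
  ...   | inj₁ (m , refl , h) = trans (h (tm w e)) (trans (tm-off w e m (n≢ke ∘ cong (k ℕ.*_))) (sym (tm-off w (k ℕ.* e) (k ℕ.* m) n≢ke)))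
  ...   | inj₂ (_ , h)        = trans (h (tm w e)) (sym (tm-off w (k ℕ.* e) n n≢ke))

dil-const : ∀ k .{{_ : NonZero k}} c → dil k (const c) ≈ const c
dil-const k c = ≈-trans (dil-cong k (≈-sym (tm-zero c))) (≈-trans (dil-tm k c 0)
  (subst (λ e → tm c e ≈ const c) (sym (ℕP.*-zeroʳ k)) (tm-zero c)))

q*tail : ∀ f → f ≈ const (f 0) +ˢ q^ 1 *ˢ tail f
q*tail f = coeffs λ n → sym (trans (+ˢ-coeff (const (f 0)) (q^ 1 *ˢ tail f) n) (go n))
  where
  go : ∀ n → const (f 0) n ℤ.+ (q^ 1 *ˢ tail f) n ≡ f n
  go zero    = trans (cong₂ ℤ._+_ (const-zero (f 0)) (tm-*-< (+ 1) 1 (tail f) 0 (s≤s z≤n))) (ℤP.+-identityʳ _)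
  go (suc n) = trans (cong₂ ℤ._+_ (const-suc (f 0) n) (trans (tm-*-+ (+ 1) 1 (tail f) n) (ℤP.*-identityˡ _))) (ℤP.+-identityˡ _)

dil-tail : ∀ k .{{_ : NonZero k}} f → dil k f ≈ const (f 0) +ˢ q^ k *ˢ dil k (tail f)
dil-tail k f = coeffs λ n → trans (go n) (sym (+ˢ-coeff (const (f 0)) (q^ k *ˢ dil k (tail f)) n))
  where
  const-≢0 : ∀ c n → n ≢ 0 → const c n ≡ + 0
  const-≢0 c zero    h = contradiction refl h
  const-≢0 c (suc n) h = const-suc c n
  step : ∀ m → dil k f (k ℕ.+ m) ≡ dil k (tail f) m
  step m with dil-view k m
  ... | inj₁ (j , refl , h) = trans (cong (dil k f) (sym (ℕP.*-suc k j))) (trans (dil-* k f (suc j)) (sym (h (tail f))))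
  ... | inj₂ (k∤m , h)      = trans (dil-∤ k f (k ℕ.+ m) (λ d → k∤m (∣m+n∣m⇒∣n d ∣-refl))) (sym (h (tail f)))
  go : ∀ n → dil k f n ≡ const (f 0) n ℤ.+ (q^ k *ˢ dil k (tail f)) n
  go n with n ℕP.<? k
  go zero | yes n<k = trans (dil-0 k f) (sym (trans (cong₂ ℤ._+_ (const-zero (f 0)) (tm-*-< (+ 1) k _ 0 n<k)) (ℤP.+-identityʳ _)))
  go n@(suc n′) | yes n<k = trans (dil-∤ k f n (λ d → contradiction (∣⇒≤ d) (ℕP.<⇒≱ n<k)))
    (sym (cong₂ ℤ._+_ (const-suc (f 0) n′) (tm-*-< (+ 1) k _ n n<k)))
  go n | no n≮k with ℕP.m≤n⇒∃[o]m+o≡n (ℕP.≮⇒≥ n≮k)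
  ... | m , refl = trans (step m) (sym (trans (cong₂ ℤ._+_ (const-≢0 (f 0) (k ℕ.+ m) (λ e → ℕ.≢-nonZero⁻¹ k (ℕP.m+n≡0⇒m≡0 k e))) (tm-*-+ (+ 1) k (dil k (tail f)) m))
                     (trans (ℤP.+-identityˡ _) (ℤP.*-identityˡ _))))

-- Both sides satisfy X(f, g) = f 0 · `dil k g` + q^k · X(`tail f`, g). Since k > 0, this recursion
-- determines every coefficient.
dil-*ˢ : ∀ k .{{_ : NonZero k}} f g → dil k (f *ˢ g) ≈ dil k f *ˢ dil k g
dil-*ˢ k f g = coeffs λ n → go n (<-wellFounded n) f g
  where
  left : ∀ f g → dil k (f *ˢ g) ≈ const (f 0) *ˢ dil k g +ˢ q^ k *ˢ dil k (tail f *ˢ g)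
  left f g = ≈-trans (dil-cong k (≈-trans (*-cong (q*tail f) ≈-refl)
      (solve 4 (λ a q t g → (a :+ q :* t) :* g := a :* g :+ q :* (t :* g)) ≈-refl (const (f 0)) (q^ 1) (tail f) g)))
    (≈-trans (dil-+ˢ k _ _) (+-cong (scale g) (shiftₖ (tail f *ˢ g))))
    where
    scale : ∀ g → dil k (const (f 0) *ˢ g) ≈ const (f 0) *ˢ dil k g
    scale g = coeffs λ n → trans (at n) (sym (const-*ˢ (f 0) (dil k g) n))
      where
      at : ∀ n → dil k (const (f 0) *ˢ g) n ≡ f 0 ℤ.* dil k g n
      at n with dil-view k n
      ... | inj₁ (m , _ , h) = trans (h _) (trans (const-*ˢ (f 0) g m) (cong (ℤ._*_ (f 0)) (sym (h g))))
      ... | inj₂ (_ , h)     = trans (h _) (sym (trans (cong (ℤ._*_ (f 0)) (h g)) (ℤP.*-zeroʳ (f 0))))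
    shiftₖ : ∀ h → dil k (q^ 1 *ˢ h) ≈ q^ k *ˢ dil k h
    shiftₖ h = ≈-trans (dil-tail k (q^ 1 *ˢ h)) (≈-trans (+-cong (subst (λ c → const c ≈ 0ˢ) (sym (tm-*-< (+ 1) 1 h 0 (s≤s z≤n))) ≈-refl)
      (*-cong ≈-refl (dil-cong k (coeffs λ n → trans (tm-*-+ (+ 1) 1 h n) (ℤP.*-identityˡ _))))) (+-identityˡ _))
  right : ∀ f g → dil k f *ˢ dil k g ≈ const (f 0) *ˢ dil k g +ˢ q^ k *ˢ (dil k (tail f) *ˢ dil k g)
  right f g = ≈-trans (*-cong (dil-tail k f) ≈-refl)
    (solve 4 (λ a q t g → (a :+ q :* t) :* g := a :* g :+ q :* (t :* g)) ≈-refl (const (f 0)) (q^ k) (dil k (tail f)) (dil k g))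
  go : ∀ n → Acc _<_ n → ∀ f g → dil k (f *ˢ g) n ≡ (dil k f *ˢ dil k g) n
  go n (acc rec) f g = trans (coeff (left f g) n) (trans (trans (+ˢ-coeff _ _ n)
      (trans (cong (ℤ._+_ ((const (f 0) *ˢ dil k g) n)) shifted) (sym (+ˢ-coeff _ _ n)))) (sym (coeff (right f g) n)))
    where
    shifted : (q^ k *ˢ dil k (tail f *ˢ g)) n ≡ (q^ k *ˢ (dil k (tail f) *ˢ dil k g)) n
    shifted with n ℕP.<? k
    ... | yes n<k = trans (tm-*-< (+ 1) k _ n n<k) (sym (tm-*-< (+ 1) k _ n n<k))
    ... | no  n≮k with ℕP.m≤n⇒∃[o]m+o≡n (ℕP.≮⇒≥ n≮k)
    ...   | m , refl = trans (tm-*-+ (+ 1) k _ m) (trans (cong (ℤ._*_ (+ 1)) (go m (rec (ℕP.m<n+m m (ℕ.>-nonZero⁻¹ k))) (tail f) g))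
                         (sym (tm-*-+ (+ 1) k _ m)))

dil-dil : ∀ j k l .{{_ : NonZero j}} .{{_ : NonZero k}} .{{_ : NonZero l}} → j ℕ.* k ≡ l → ∀ f → dil j (dil k f) ≈ dil l f
dil-dil j k l refl f = coeffs go
  where
  go : ∀ n → dil j (dil k f) n ≡ dil (j ℕ.* k) f n
  go n with dil-view j n
  ... | inj₂ (j∤n , h) = trans (h (dil k f)) (sym (dil-∤ (j ℕ.* k) f n (j∤n ∘ ∣-trans (m∣m*n k))))
  ... | inj₁ (m , refl , h) with dil-view k m
  ...   | inj₁ (i , refl , h′) = trans (h (dil k f)) (trans (h′ f) (sym (trans (cong (dil (j ℕ.* k) f) (sym (ℕP.*-assoc j k i))) (dil-* (j ℕ.* k) f i))))
  ...   | inj₂ (k∤m , h′) = trans (h (dil k f)) (trans (h′ f) (sym (dil-∤ (j ℕ.* k) f (j ℕ.* m) (k∤m ∘ *-cancelˡ-∣ j))))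

dil-q^* : ∀ k .{{_ : NonZero k}} e f → dil k (q^ e *ˢ f) ≈ q^ (k ℕ.* e) *ˢ dil k f
dil-q^* k e f = ≈-trans (dil-*ˢ k (q^ e) f) (*-cong (dil-tm k (+ 1) e) ≈-refl)

dil-const* : ∀ k .{{_ : NonZero k}} c f → dil k (const c *ˢ f) ≈ const c *ˢ dil k f
dil-const* k c f = ≈-trans (dil-*ˢ k (const c) f) (*-cong (dil-const k c) ≈-refl)

-- The substitution q ↦ - q

opaque
  neg : PS → PS
  neg f zero    = f 0
  neg f (suc n) = ℤ.- neg (tail f) n

  neg-cong : ∀ {f g} → f ≈ g → neg f ≈ neg g
  neg-cong p = coeffs (go (coeff p))
    where
    go : ∀ {f g} → (∀ n → f n ≡ g n) → ∀ n → neg f n ≡ neg g n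
    go p zero    = p 0
    go p (suc n) = cong ℤ.-_ (go (p ∘ suc) n)

  neg-+-coeff : ∀ f g n → neg (λ i → f i ℤ.+ g i) n ≡ neg f n ℤ.+ neg g n
  neg-+-coeff f g zero    = refl
  neg-+-coeff f g (suc n) = trans (cong ℤ.-_ (neg-+-coeff (tail f) (tail g) n)) (ℤP.neg-distrib-+ (neg (tail f) n) (neg (tail g) n))

  neg-scale-coeff : ∀ c f n → neg (λ i → c ℤ.* f i) n ≡ c ℤ.* neg f n
  neg-scale-coeff c f zero    = refl
  neg-scale-coeff c f (suc n) = trans (cong ℤ.-_ (neg-scale-coeff c (tail f) n)) (ℤP.neg-distribʳ-* c (neg (tail f) n))

  neg-conv : ∀ f g n → neg (conv f g) n ≡ conv (neg f) (neg g) n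
  neg-conv f g zero    = refl
  neg-conv f g (suc n)
    rewrite neg-+-coeff (λ i → f 0 ℤ.* g (suc i)) (conv (tail f) g) n
          | neg-scale-coeff (f 0) (tail g) n
          | neg-conv (tail f) g n
          | conv-cong {g = neg g} (λ i → sym (ℤP.-1*i≡-i (neg (tail f) i))) (λ _ → refl) n
          | conv-scale (ℤ.-1ℤ) (neg (tail f)) (neg g) n =
    lemma (f 0) (neg (tail g) n) (conv (neg (tail f)) (neg g) n)
    where
    lemma : ∀ x y z → ℤ.- (x ℤ.* y ℤ.+ z) ≡ x ℤ.* (ℤ.- y) ℤ.+ ℤ.-1ℤ ℤ.* z
    lemma = solve-∀

  -- The value `neg (λ _ → w) e` is (-1)^e w.
  neg-tm : ∀ w e → neg (tm w e) ≈ tm (neg (λ _ → w) e) e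
  neg-tm w e = coeffs (go w e)
    where
    zeros : ∀ f n → (∀ i → f i ≡ + 0) → neg f n ≡ + 0
    zeros f zero    p = p 0
    zeros f (suc n) p = cong ℤ.-_ (zeros (tail f) n (p ∘ suc))
    neg-out : ∀ w e n → ℤ.- tm w e n ≡ tm (ℤ.- w) e n
    neg-out w zero    zero    = refl
    neg-out w zero    (suc n) = refl
    neg-out w (suc e) zero    = refl
    neg-out w (suc e) (suc n) = neg-out w e n
    go : ∀ w e n → neg (tm w e) n ≡ tm (neg (λ _ → w) e) e n
    go w zero    zero    = refl
    go w zero    (suc n) = cong ℤ.-_ (zeros (tail (tm w 0)) n (λ _ → refl))
    go w (suc e) zero    = refl
    go w (suc e) (suc n) = trans (cong ℤ.-_ (go w e n)) (neg-out _ e n)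

  neg-q¹ : neg (q^ 1) ≈ -ˢ q^ 1
  neg-q¹ = ≈-trans (neg-tm (+ 1) 1) (coeffs λ { zero → sym (-ˢ-coeff (q^ 1) 0) ; (suc zero) → sym (-ˢ-coeff (q^ 1) 1) ; (suc (suc n)) → sym (-ˢ-coeff (q^ 1) (suc (suc n))) })

  neg-even : ∀ f m → neg f (2 ℕ.* m) ≡ f (2 ℕ.* m)
  neg-even f zero    = refl
  neg-even f (suc m) rewrite ℕP.+-suc m (m ℕ.+ 0) = trans (ℤP.neg-involutive _) (neg-even (tail (tail f)) m)

  neg-vanish : ∀ f n → f n ≡ + 0 → neg f n ≡ + 0
  neg-vanish f zero    p = p
  neg-vanish f (suc n) p = cong ℤ.-_ (neg-vanish (tail f) n p)

neg-dil₂ : ∀ f → neg (dil 2 f) ≈ dil 2 f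
neg-dil₂ f = coeffs go
  where
  go : ∀ n → neg (dil 2 f) n ≡ dil 2 f n
  go n with dil-view 2 n
  ... | inj₁ (m , refl , h) = neg-even (dil 2 f) m
  ... | inj₂ (_ , h)        = trans (neg-vanish (dil 2 f) n (h f)) (sym (h f))

opaque
  unfolding _+ˢ_ neg
  neg-+ˢ : ∀ f g → neg (f +ˢ g) ≈ neg f +ˢ neg g
  neg-+ˢ f g = coeffs (neg-+-coeff f g)

  neg-*ˢ : ∀ f g → neg (f *ˢ g) ≈ neg f *ˢ neg g
  neg-*ˢ f g = coeffs (neg-conv f g)

neg-const* : ∀ c f → neg (const c *ˢ f) ≈ const c *ˢ neg f
neg-const* c f = coeffs λ n → trans (coeff (neg-cong (coeffs (const-*ˢ c f))) n)
  (trans (neg-scale-coeff c f n) (sym (const-*ˢ c (neg f) n)))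

-- The derivation q d/dq

opaque
  D : PS → PS
  D f n = + n ℤ.* f n

  D-coeff : ∀ f n → D f n ≡ + n ℤ.* f n
  D-coeff f n = refl

  D-cong : ∀ {f g} → f ≈ g → D f ≈ D g
  D-cong p = coeffs λ n → cong (ℤ._*_ (+ n)) (coeff p n)

opaque
  unfolding _+ˢ_ D
  D-+ˢ : ∀ f g → D (f +ˢ g) ≈ D f +ˢ D g
  D-+ˢ f g = coeffs λ n → ℤP.*-distribˡ-+ (+ n) (f n) (g n)

  D-neg : ∀ f → D (-ˢ f) ≈ -ˢ D f
  D-neg f = coeffs λ n → sym (ℤP.neg-distribʳ-* (+ n) (f n))

  -- Since D (q g) = q (D g + g), the tail of D f is D (`tail f`) + `tail f`; this makes the
  -- induction along `conv` close.
  D-*ˢ : ∀ f g → D (f *ˢ g) ≈ D f *ˢ g +ˢ f *ˢ D g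
  D-*ˢ f g = coeffs (go f g)
    where
    tail-D : ∀ f n → D f (suc n) ≡ D (tail f) n ℤ.+ tail f n
    tail-D f n = trans (cong (ℤ._* f (suc n)) (ℤP.+-comm (+ 1) (+ n))) (lemma (+ n) (f (suc n)))
      where
      lemma : ∀ x y → (x ℤ.+ + 1) ℤ.* y ≡ x ℤ.* y ℤ.+ y
      lemma = solve-∀
    go : ∀ f g n → D (conv f g) n ≡ conv (D f) g n ℤ.+ conv f (D g) n
    go f g zero    = lemma (f 0) (g 0)
      where
      lemma : ∀ x y → + 0 ℤ.* (x ℤ.* y) ≡ + 0 ℤ.* x ℤ.* y ℤ.+ x ℤ.* (+ 0 ℤ.* y)
      lemma = solve-∀
    go f g (suc n)
      rewrite tail-D (conv f g) n
            | conv-cong {g = g} (tail-D f) (λ _ → refl) n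
            | conv-+ (D (tail f)) (tail f) g n
            | ℤP.*-distribˡ-+ (+ n) (f 0 ℤ.* g (suc n)) (conv (tail f) g n)
            | go (tail f) g n
            | tail-D g n =
      lemma (+ n) (f 0) (g (suc n)) (conv (D (tail f)) g n) (conv (tail f) (D g) n) (conv (tail f) g n)
      where
      lemma : ∀ n x y u v w → (n ℤ.* (x ℤ.* y) ℤ.+ (u ℤ.+ v)) ℤ.+ (x ℤ.* y ℤ.+ w) ≡
              + 0 ℤ.* x ℤ.* y ℤ.+ (u ℤ.+ w) ℤ.+ (x ℤ.* (n ℤ.* y ℤ.+ y) ℤ.+ v)
      lemma = solve-∀

  D-const* : ∀ c f → D (const c *ˢ f) ≈ const c *ˢ D f
  D-const* c f = coeffs λ n → trans (cong (ℤ._*_ (+ n)) (const-*ˢ c f n))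
    (trans (lemma (+ n) c (f n)) (sym (const-*ˢ c (D f) n)))
    where
    lemma : ∀ n c x → n ℤ.* (c ℤ.* x) ≡ c ℤ.* (n ℤ.* x)
    lemma = solve-∀

D-dil : ∀ k .{{_ : NonZero k}} f → D (dil k f) ≈ const (+ k) *ˢ dil k (D f)
D-dil k f = coeffs λ n → trans (trans (D-coeff (dil k f) n) (go n)) (sym (const-*ˢ (+ k) (dil k (D f)) n))
  where
  go : ∀ n → + n ℤ.* dil k f n ≡ + k ℤ.* dil k (D f) n
  go n with dil-view k n
  ... | inj₁ (m , refl , h) =
    trans (cong₂ ℤ._*_ (ℤP.pos-* k m) (h f)) (trans (ℤP.*-assoc (+ k) (+ m) (f m))
      (cong (ℤ._*_ (+ k)) (trans (sym (D-coeff f m)) (sym (h (D f))))))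
  ... | inj₂ (_ , h)        rewrite h f | h (D f) | ℤP.*-zeroʳ (+ n) | ℤP.*-zeroʳ (+ k) = refl

-- Sums of families of power series

sumOver : {X : Set} → (X → ℤ) → List X → ℤ
sumOver f []       = + 0
sumOver f (x ∷ xs) = f x ℤ.+ sumOver f xs

sumOver-↭ : {X : Set} (f : X → ℤ) {xs ys : List X} → xs ↭ ys → sumOver f xs ≡ sumOver f ys
sumOver-↭ f Perm.refl         = refl
sumOver-↭ f (Perm.prep x p)   = cong (ℤ._+_ (f x)) (sumOver-↭ f p)
sumOver-↭ f (Perm.swap x y p) = trans (cong (λ s → f x ℤ.+ (f y ℤ.+ s)) (sumOver-↭ f p)) (lemma (f x) (f y) _)
  where
  lemma : ∀ a b c → a ℤ.+ (b ℤ.+ c) ≡ b ℤ.+ (a ℤ.+ c)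
  lemma = solve-∀
sumOver-↭ f (Perm.trans p q)  = trans (sumOver-↭ f p) (sumOver-↭ f q)

-- Only the support matters: restricted to it, both lists are enumerations of the same set.
sumOver-unique : {X : Set} (f : X → ℤ) {xs ys : List X} → Unique xs → Unique ys →
                 (∀ x → f x ≢ + 0 → x ∈ xs) → (∀ x → f x ≢ + 0 → x ∈ ys) → sumOver f xs ≡ sumOver f ys
sumOver-unique {X} f {xs} {ys} ux uy cx cy = trans (restrict xs) (trans
  (sumOver-↭ f (∼bag⇒↭ (unique∧set⇒bag (UniqueP.filter⁺ P? ux) (UniqueP.filter⁺ P? uy) (mk⇔ (move xs cy) (move ys cx)))))
  (sym (restrict ys)))
  where
  P? : (x : X) → Dec (f x ≢ + 0)
  P? x = ¬? (f x ℤ.≟ + 0)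
  move : ∀ zs {zs′} → (∀ x → f x ≢ + 0 → x ∈ zs′) → ∀ {z} → z ∈ filter P? zs → z ∈ filter P? zs′
  move zs c z∈ = MemP.∈-filter⁺ P? (c _ (proj₂ (MemP.∈-filter⁻ P? {xs = zs} z∈))) (proj₂ (MemP.∈-filter⁻ P? {xs = zs} z∈))
  restrict : ∀ zs → sumOver f zs ≡ sumOver f (filter P? zs)
  restrict []       = refl
  restrict (z ∷ zs) with f z ℤ.≟ + 0
  ... | yes fz≡0 = trans (cong₂ ℤ._+_ fz≡0 (restrict zs)) (ℤP.+-identityˡ _)
  ... | no  _    = cong (ℤ._+_ (f z)) (restrict zs)

sumˢ : {X : Set} → (X → PS) → List X → PS
sumˢ F []       = 0ˢ
sumˢ F (x ∷ xs) = F x +ˢ sumˢ F xs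

sumˢ-coeff : {X : Set} (F : X → PS) (xs : List X) → ∀ n → sumˢ F xs n ≡ sumOver (λ x → F x n) xs
sumˢ-coeff F []       n = 0ˢ-coeff n
sumˢ-coeff F (x ∷ xs) n = trans (+ˢ-coeff (F x) (sumˢ F xs) n) (cong (ℤ._+_ (F x n)) (sumˢ-coeff F xs n))

sumˢ-cong : {X : Set} {F G : X → PS} (xs : List X) → (∀ x → F x ≈ G x) → sumˢ F xs ≈ sumˢ G xs
sumˢ-cong []       p = ≈-refl
sumˢ-cong (x ∷ xs) p = +-cong (p x) (sumˢ-cong xs p)

sumˢ-++ : {X : Set} (F : X → PS) (xs ys : List X) → sumˢ F (xs ++ ys) ≈ sumˢ F xs +ˢ sumˢ F ys
sumˢ-++ F []       ys = ≈-sym (+-identityˡ _)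
sumˢ-++ F (x ∷ xs) ys = ≈-trans (+-cong ≈-refl (sumˢ-++ F xs ys)) (≈-sym (+-assoc (F x) (sumˢ F xs) (sumˢ F ys)))

sumˢ-map : {X Y : Set} (F : X → PS) (π : Y → X) (ys : List Y) → sumˢ F (map π ys) ≈ sumˢ (F ∘ π) ys
sumˢ-map F π []       = ≈-refl
sumˢ-map F π (y ∷ ys) = +-cong ≈-refl (sumˢ-map F π ys)

sumˢ-scale : {X : Set} (c : PS) (F : X → PS) (xs : List X) → sumˢ (λ x → c *ˢ F x) xs ≈ c *ˢ sumˢ F xs
sumˢ-scale c F []       = ≈-sym (zeroʳ c)
sumˢ-scale c F (x ∷ xs) = ≈-trans (+-cong ≈-refl (sumˢ-scale c F xs)) (≈-sym (distribˡ c (F x) (sumˢ F xs)))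

sumˢ-× : {X Y : Set} (F : X → PS) (G : Y → PS) (xs : List X) (ys : List Y) →
         sumˢ (λ z → F (proj₁ z) *ˢ G (proj₂ z)) (cartesianProduct xs ys) ≈ sumˢ F xs *ˢ sumˢ G ys
sumˢ-× F G []       ys = ≈-sym (zeroˡ _)
sumˢ-× F G (x ∷ xs) ys = ≈-trans (sumˢ-++ _ (map (x ,_) ys) (cartesianProduct xs ys))
  (≈-trans (+-cong (≈-trans (sumˢ-map _ (x ,_) ys) (sumˢ-scale (F x) G ys)) (sumˢ-× F G xs ys))
           (≈-sym (distribʳ (sumˢ G ys) (F x) (sumˢ F xs))))

-- Unordered convergence in the q-adic topology: modulo q^(n+1) only members listed in `support n`
-- can be nonzero. As the lists have no repetitions, the sum does not depend on the enumeration, and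
-- index sets can be mapped, split and multiplied like finite ones.
record HasSum {X : Set} (F : X → PS) (s : PS) : Set where
  field
    support : ℕ → List X
    unique  : ∀ n → Unique (support n)
    covers  : ∀ n x i → i ≤ n → F x i ≢ + 0 → x ∈ support n
    sums    : ∀ n → s ≈[ n ] sumˢ F (support n)
open HasSum

HasSum-unique : {X : Set} {F : X → PS} {s t : PS} → HasSum F s → HasSum F t → s ≈ t
HasSum-unique {F = F} S T = coeffs λ n → trans (coeff≤ (sums S n) n ℕP.≤-refl) (trans (sumˢ-coeff F (support S n) n)
  (trans (sumOver-unique (λ x → F x n) (unique S n) (unique T n) (λ x → covers S n x n ℕP.≤-refl) (λ x → covers T n x n ℕP.≤-refl))
  (trans (sym (sumˢ-coeff F (support T n) n)) (sym (coeff≤ (sums T n) n ℕP.≤-refl)))))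

HasSum-cong : {X : Set} {F G : X → PS} {s t : PS} → (∀ x → F x ≈ G x) → s ≈ t → HasSum F s → HasSum G t
HasSum-cong p q S = record
  { support = support S
  ; unique  = unique S
  ; covers  = λ n x i h nz → covers S n x i h (nz ∘ trans (sym (coeff (p x) i)))
  ; sums    = λ n → ≈[]-trans (≈⇒≈[] (≈-sym q)) (≈[]-trans (sums S n) (≈⇒≈[] (sumˢ-cong (support S n) p))) }

HasSum-bij : {X Y : Set} {F : X → PS} {s : PS} (π : Y → X) → (∀ {y y′} → π y ≡ π y′ → y ≡ y′) →
             (∀ x → ∃ λ y → π y ≡ x) → HasSum (F ∘ π) s → HasSum F s
HasSum-bij {F = F} π inj surj S = record
  { support = λ n → map π (support S n)
  ; unique  = λ n → UniqueP.map⁺ inj (unique S n)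
  ; covers  = λ n x i h nz → cover n x i h nz (surj x)
  ; sums    = λ n → ≈[]-trans (sums S n) (≈⇒≈[] (≈-sym (sumˢ-map F π (support S n)))) }
  where
  cover : ∀ n x i → i ≤ n → F x i ≢ + 0 → (∃ λ y → π y ≡ x) → x ∈ map π (support S n)
  cover n .(π y) i h nz (y , refl) = MemP.∈-map⁺ π (covers S n y i h nz)

HasSum-iso : {X Y : Set} {F : X → PS} {G : Y → PS} {s : PS} (π : Y → X) (ρ : X → Y) →
             (∀ y → ρ (π y) ≡ y) → (∀ x → π (ρ x) ≡ x) → (∀ y → G y ≈ F (π y)) → HasSum G s → HasSum F s
HasSum-iso π ρ ρπ πρ p S = HasSum-bij π (λ e → trans (sym (ρπ _)) (trans (cong ρ e) (ρπ _))) (λ x → ρ x , πρ x)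
  (HasSum-cong p ≈-refl S)

HasSum-⊎ : {X Y : Set} {H : X ⊎ Y → PS} {s t : PS} → HasSum (H ∘ inj₁) s → HasSum (H ∘ inj₂) t → HasSum H (s +ˢ t)
HasSum-⊎ {H = H} S T = record
  { support = λ n → map inj₁ (support S n) ++ map inj₂ (support T n)
  ; unique  = λ n → UniqueP.++⁺ (UniqueP.map⁺ (λ { refl → refl }) (unique S n)) (UniqueP.map⁺ (λ { refl → refl }) (unique T n))
                      (λ { (p , q) → disjoint (MemP.∈-map⁻ inj₁ p) (MemP.∈-map⁻ inj₂ q) })
  ; covers  = λ { n (inj₁ x) i h nz → MemP.∈-++⁺ˡ (MemP.∈-map⁺ inj₁ (covers S n x i h nz))
                ; n (inj₂ y) i h nz → MemP.∈-++⁺ʳ _ (MemP.∈-map⁺ inj₂ (covers T n y i h nz)) }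
  ; sums    = λ n → ≈[]-trans (+-cong[] (sums S n) (sums T n)) (≈⇒≈[] (≈-sym (≈-trans (sumˢ-++ H (map inj₁ (support S n)) (map inj₂ (support T n)))
                      (+-cong (sumˢ-map H inj₁ (support S n)) (sumˢ-map H inj₂ (support T n)))))) }
  where
  disjoint : ∀ {X Y : Set} {xs : List X} {ys : List Y} {z : X ⊎ Y} → (∃ λ x → x ∈ xs × z ≡ inj₁ x) → (∃ λ y → y ∈ ys × z ≡ inj₂ y) → _
  disjoint (_ , _ , refl) (_ , _ , ())

-- Makes constructive the inference that a nonzero coefficient of a product needs a nonzero
-- coefficient, of no larger degree, in each factor. Scaled families and product families get their
-- supports from it.
search : ∀ (f : PS) n → (∃ λ j → j ≤ n × f j ≢ + 0) ⊎ (∀ j → j ≤ n → f j ≡ + 0)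
search f zero with f 0 ℤ.≟ + 0
... | yes p = inj₂ λ { .0 z≤n → p }
... | no  p = inj₁ (0 , z≤n , p)
search f (suc n) with f 0 ℤ.≟ + 0 | search (tail f) n
... | no p  | _                  = inj₁ (0 , z≤n , p)
... | yes p | inj₁ (j , h , nz)  = inj₁ (suc j , s≤s h , nz)
... | yes p | inj₂ all           = inj₂ λ { zero _ → p ; (suc j) (s≤s h) → all j h }

*ˢ-nonzeroʳ : ∀ f g n → (f *ˢ g) n ≢ + 0 → ∃ λ j → j ≤ n × g j ≢ + 0
*ˢ-nonzeroʳ f g n nz with search g n
... | inj₁ found = found
... | inj₂ all   = contradiction (trans (*ˢ-coeff f g n) (conv-vanish f g n all)) nz

*ˢ-nonzeroˡ : ∀ f g n → (f *ˢ g) n ≢ + 0 → ∃ λ j → j ≤ n × f j ≢ + 0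
*ˢ-nonzeroˡ f g n nz = *ˢ-nonzeroʳ g f n (nz ∘ trans (coeff (*-comm f g) n))

HasSum-scale : {X : Set} {F : X → PS} {s : PS} (c : PS) → HasSum F s → HasSum (λ x → c *ˢ F x) (c *ˢ s)
HasSum-scale {F = F} c S = record
  { support = support S
  ; unique  = unique S
  ; covers  = λ n x i h nz → let (j , j≤i , nz′) = *ˢ-nonzeroʳ c (F x) i nz in covers S n x j (ℕP.≤-trans j≤i h) nz′
  ; sums    = λ n → ≈[]-trans (*-cong[] (≈⇒≈[] ≈-refl) (sums S n)) (≈⇒≈[] (≈-sym (sumˢ-scale c F (support S n)))) }

HasSum-× : {X Y : Set} {F : X → PS} {G : Y → PS} {s t : PS} → HasSum F s → HasSum G t →
           HasSum (λ (z : X × Y) → F (proj₁ z) *ˢ G (proj₂ z)) (s *ˢ t)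
HasSum-× {F = F} {G} S T = record
  { support = λ n → cartesianProduct (support S n) (support T n)
  ; unique  = λ n → UniqueP.cartesianProduct⁺ (unique S n) (unique T n)
  ; covers  = λ { n (x , y) i h nz → let (j , j≤i , nzF) = *ˢ-nonzeroˡ (F x) (G y) i nz
                                         (k , k≤i , nzG) = *ˢ-nonzeroʳ (F x) (G y) i nz
      in MemP.∈-cartesianProduct⁺ (covers S n x j (ℕP.≤-trans j≤i h) nzF) (covers T n y k (ℕP.≤-trans k≤i h) nzG) }
  ; sums    = λ n → ≈[]-trans (*-cong[] (sums S n) (sums T n)) (≈⇒≈[] (≈-sym (sumˢ-× F G (support S n) (support T n)))) }

HasSum-dil : ∀ k .{{_ : NonZero k}} {X : Set} {F : X → PS} {s : PS} → HasSum F s → HasSum (dil k ∘ F) (dil k s)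
HasSum-dil k {F = F} S = record
  { support = support S
  ; unique  = unique S
  ; covers  = λ n x i h nz → cover n x i h nz
  ; sums    = λ n → ≈[]-trans (dil-cong[] k (sums S n)) (≈⇒≈[] (dil-sumˢ (support S n))) }
  where
  cover : ∀ n x i → i ≤ n → dil k (F x) i ≢ + 0 → x ∈ support S n
  cover n x i h nz with dil-view k i
  ... | inj₁ (m , refl , eq) = covers S n x m (ℕP.≤-trans (ℕP.m≤n*m m k) h) (nz ∘ trans (eq (F x)))
  ... | inj₂ (_ , eq)        = contradiction (eq (F x)) nz
  dil-sumˢ : ∀ xs → dil k (sumˢ F xs) ≈ sumˢ (dil k ∘ F) xs
  dil-sumˢ []       = dil-const k (+ 0)
  dil-sumˢ (x ∷ xs) = ≈-trans (dil-+ˢ k (F x) (sumˢ F xs)) (+-cong ≈-refl (dil-sumˢ xs))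

HasSum-empty : {X : Set} {F : X → PS} → ¬ X → HasSum F 0ˢ
HasSum-empty ¬x = record
  { support = λ _ → [] ; unique = λ _ → [] ; covers = λ _ x _ _ _ → contradiction x ¬x ; sums = λ _ → ≈⇒≈[] ≈-refl }

sumFin : ∀ k → (Fin k → PS) → PS
sumFin zero    s = 0ˢ
sumFin (suc k) s = s zero +ˢ sumFin k (s ∘ suc)

HasSum-Fin : ∀ k {X : Set} {F : Fin k × X → PS} {s : Fin k → PS} →
             (∀ r → HasSum (λ x → F (r , x)) (s r)) → HasSum F (sumFin k s)
HasSum-Fin zero    S = HasSum-empty λ { (() , _) }
HasSum-Fin (suc k) {X} {F} S = HasSum-iso π ρ ρπ πρ (λ _ → ≈-refl) (HasSum-⊎ {H = F ∘ π} (S zero) (HasSum-Fin k (S ∘ suc)))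
  where
  π : X ⊎ (Fin k × X) → Fin (suc k) × X
  π (inj₁ x)       = zero , x
  π (inj₂ (r , x)) = suc r , x
  ρ : Fin (suc k) × X → X ⊎ (Fin k × X)
  ρ (zero , x)  = inj₁ x
  ρ (suc r , x) = inj₂ (r , x)
  ρπ : ∀ y → ρ (π y) ≡ y
  ρπ (inj₁ x) = refl
  ρπ (inj₂ _) = refl
  πρ : ∀ x → π (ρ x) ≡ x
  πρ (zero , x)  = refl
  πρ (suc r , x) = refl

-- Residue classes in ℤ and ℤ²

ℤ-+-cancelˡ : ∀ x y z → x ℤ.+ y ≡ x ℤ.+ z → y ≡ z
ℤ-+-cancelˡ = ∙-cancelˡ
  where open import Algebra.Properties.AbelianGroup ℤP.+-0-abelianGroup using (∙-cancelˡ)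

residue : ∀ k → Fin k × ℤ → ℤ
residue k (r , t) = + k ℤ.* t ℤ.+ + toℕ r

-- The number k (t - t′) = r′ - r has absolute value below k, so t = t′.
residue-injective : ∀ k {x y} → residue k x ≡ residue k y → x ≡ y
residue-injective k {r , t} {r′ , t′} eq = cong₂ _,_ (FinP.toℕ-injective (ℤP.+-injective r≡r′)) t≡t′
  where
  diff : + k ℤ.* (t ℤ.- t′) ≡ + toℕ r′ ℤ.- + toℕ r
  diff = trans (lemma (+ k) t t′ (+ toℕ r)) (trans (cong (λ z → z ℤ.- + k ℤ.* t′ ℤ.- + toℕ r) eq) (lemma′ (+ k) t′ (+ toℕ r) (+ toℕ r′)))
    where
    lemma : ∀ k t t′ r → k ℤ.* (t ℤ.- t′) ≡ k ℤ.* t ℤ.+ r ℤ.- k ℤ.* t′ ℤ.- r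
    lemma = solve-∀
    lemma′ : ∀ k t′ r r′ → k ℤ.* t′ ℤ.+ r′ ℤ.- k ℤ.* t′ ℤ.- r ≡ r′ ℤ.- r
    lemma′ = solve-∀
  small : ℤ.∣ + toℕ r′ ℤ.- + toℕ r ∣ < k
  small = subst (λ z → ℤ.∣ z ∣ < k) (sym (ℤP.m-n≡m⊖n (toℕ r′) (toℕ r)))
            (ℕP.≤-<-trans (ℤP.∣m⊝n∣≤m⊔n (toℕ r′) (toℕ r)) (ℕP.⊔-pres-<m (FinP.toℕ<n r′) (FinP.toℕ<n r)))
  zero-abs : ∀ m → k ℕ.* m < k → m ≡ 0
  zero-abs zero    h = refl
  zero-abs (suc m) h = contradiction (ℕP.m≤m*n k (suc m)) (ℕP.<⇒≱ h)
  t≡t′ : t ≡ t′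
  t≡t′ = ℤP.i-j≡0⇒i≡j t t′ (ℤP.∣i∣≡0⇒i≡0 (zero-abs ℤ.∣ t ℤ.- t′ ∣ (subst (_< k) (trans (cong ℤ.∣_∣ (sym diff)) (ℤP.abs-* (+ k) (t ℤ.- t′))) small)))
  r≡r′ : + toℕ r ≡ + toℕ r′
  r≡r′ = ℤ-+-cancelˡ (+ k ℤ.* t) _ _ (trans eq (cong (λ z → + k ℤ.* z ℤ.+ + toℕ r′) (sym t≡t′)))

residue-surjective : ∀ k .{{_ : NonZero k}} x → ∃ λ y → residue k y ≡ x
residue-surjective k x = (Fin.fromℕ< (ℤDM.n%ℕd<d x k) , x ℤDM./ℕ k) ,
  trans (trans (cong (λ z → + k ℤ.* (x ℤDM./ℕ k) ℤ.+ + z) (FinP.toℕ-fromℕ< (ℤDM.n%ℕd<d x k))) (lemma (+ k) (x ℤDM./ℕ k) (+ (x ℤDM.%ℕ k))))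
    (sym (ℤDM.a≡a%ℕn+[a/ℕn]*n x k))
  where
  lemma : ∀ a b c → a ℤ.* b ℤ.+ c ≡ c ℤ.+ b ℤ.* a
  lemma = solve-∀

HasSum-residues : ∀ k .{{_ : NonZero k}} {F : ℤ → PS} {s : Fin k → PS} →
                  (∀ r → HasSum (λ t → F (+ k ℤ.* t ℤ.+ + toℕ r)) (s r)) → HasSum F (sumFin k s)
HasSum-residues k S = HasSum-bij (residue k) (residue-injective k) (residue-surjective k) (HasSum-Fin k S)

module _ (k : ℕ) .{{_ : NonZero k}} (a : ℤ) where
  -- The cosets of the lattice of all (m, n) with m ≡ a n modulo k. For k = 2, a = 1 this is the
  -- ideal of 1 + i, and for k = 5, a = 2 that of 2 + i, with (m, n) read as m + n i.
  class : Fin k × (ℤ × ℤ) → ℤ × ℤ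
  class (r , (j , n)) = + k ℤ.* j ℤ.+ a ℤ.* n ℤ.+ + toℕ r , n

  class-injective : ∀ {y y′} → class y ≡ class y′ → y ≡ y′
  class-injective {r , (j , n)} {r′ , (j′ , n′)} eq with cong proj₂ eq
  ... | refl with residue-injective k {r , j} {r′ , j′} (ℤ-+-cancelˡ (a ℤ.* n) _ _
                    (trans (lemma (a ℤ.* n) (+ k ℤ.* j) (+ toℕ r)) (trans (cong proj₁ eq) (sym (lemma (a ℤ.* n) (+ k ℤ.* j′) (+ toℕ r′))))))
    where
    lemma : ∀ x y z → x ℤ.+ (y ℤ.+ z) ≡ y ℤ.+ x ℤ.+ z
    lemma = solve-∀
  ...   | refl = refl

  class-surjective : ∀ x → ∃ λ y → class y ≡ x
  class-surjective (m , n) = let ((r , j) , eq) = residue-surjective k (m ℤ.- a ℤ.* n) in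
    (r , (j , n)) , cong (_, n) (trans (lemma (+ k ℤ.* j) (a ℤ.* n) (+ toℕ r)) (trans (cong (ℤ._+_ (a ℤ.* n)) eq) (lemma′ (a ℤ.* n) m)))
    where
    lemma : ∀ x y z → x ℤ.+ y ℤ.+ z ≡ y ℤ.+ (x ℤ.+ z)
    lemma = solve-∀
    lemma′ : ∀ x m → x ℤ.+ (m ℤ.- x) ≡ m
    lemma′ = solve-∀

  HasSum-classes : {F : ℤ × ℤ → PS} {s : Fin k → PS} →
                   (∀ r → HasSum (λ z → F (class (r , z))) (s r)) → HasSum F (sumFin k s)
  HasSum-classes S = HasSum-bij class class-injective class-surjective (HasSum-Fin k S)

sum-exists : {X : Set} {F : X → PS} (supp : ℕ → List X) → (∀ n → Unique (supp n)) →
             (∀ n x i → i ≤ n → F x i ≢ + 0 → x ∈ supp n) → HasSum F (λ n → sumOver (λ x → F x n) (supp n))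
sum-exists {F = F} supp u c = record
  { support = supp ; unique = u ; covers = c
  ; sums = λ n → coeffs≤ λ i i≤n → trans (sumOver-unique (λ x → F x i) (u i) (u n) (λ x → c i x i ℕP.≤-refl) (λ x → c n x i i≤n))
                                         (sym (sumˢ-coeff F (supp n) i)) }

HasSum-restrict : {X Y : Set} {F : X → PS} {s : PS} (π : Y → X) (ρ : X → Maybe Y) →
                  (∀ {x y} → ρ x ≡ just y → π y ≡ x) → (∀ y → ρ (π y) ≡ just y) →
                  HasSum F s → ∃ (HasSum (F ∘ π))
HasSum-restrict {X} {Y} {F} π ρ sound complete S = _ , sum-exists (λ n → mapMaybe ρ (support S n)) (λ n → uniq (unique S n))
    (λ n y i h nz → there-just (complete y) (covers S n (π y) i h nz))
  where
  there-just : ∀ {x y xs} → ρ x ≡ just y → x ∈ xs → y ∈ mapMaybe ρ xs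
  there-just {xs = x ∷ xs} eq (here refl) rewrite eq = here refl
  there-just {xs = x ∷ xs} eq (there x∈) with ρ x
  ... | just _  = there (there-just eq x∈)
  ... | nothing = there-just eq x∈
  fresh : ∀ {x y xs} → ρ x ≡ just y → All (x ≢_) xs → All (y ≢_) (mapMaybe ρ xs)
  fresh eq [] = []
  fresh {xs = x′ ∷ xs} eq (p ∷ ps) with ρ x′ in eq′
  ... | just _  = (λ { refl → p (trans (sym (sound eq)) (sound eq′)) }) ∷ fresh eq ps
  ... | nothing = fresh eq ps
  uniq : ∀ {xs} → Unique xs → Unique (mapMaybe ρ xs)
  uniq [] = []
  uniq {x ∷ xs} (p ∷ ps) with ρ x in eq
  ... | just _  = fresh eq p ∷ uniq ps
  ... | nothing = uniq ps

-- Gives the sum over one class a name without evaluating it, so that class sums can be matched and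
-- eliminated although they have no closed form here.
HasSum-class : ∀ k .{{_ : NonZero k}} a {F : ℤ × ℤ → PS} {s : PS} → HasSum F s →
               ∀ r → ∃ (HasSum (λ z → F (class k a (r , z))))
HasSum-class k a {F} S r = HasSum-restrict {F = F ∘ class k a} (r ,_) pick pick-sound pick-complete
  (HasSum-iso {F = F ∘ class k a} {G = F} (proj₁ ∘ class-surjective k a) (class k a)
    (λ x → proj₂ (class-surjective k a x)) (λ y → class-injective k a (proj₂ (class-surjective k a (class k a y))))
    (λ x → reflexive (cong F (sym (proj₂ (class-surjective k a x))))) S)
  where
  reflexive : ∀ {f g} → f ≡ g → f ≈ g
  reflexive refl = ≈-refl
  pick : Fin k × (ℤ × ℤ) → Maybe (ℤ × ℤ)
  pick (r′ , z) with r Fin.≟ r′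
  ... | yes _ = just z
  ... | no _  = nothing
  pick-sound : ∀ {x y} → pick x ≡ just y → (r , y) ≡ x
  pick-sound {r′ , z} eq with r Fin.≟ r′
  pick-sound {r′ , z} refl | yes refl = refl
  pick-sound {r′ , z} ()   | no _
  pick-complete : ∀ y → pick (r , y) ≡ just y
  pick-complete y with r Fin.≟ r
  ... | yes _   = refl
  ... | no  r≢r = contradiction refl r≢r

-- Theta series

signedPair : ℕ → List ℤ
signedPair k = + suc k ∷ ℤ.- (+ suc k) ∷ []

∈-signedPairs : ∀ ks {z} → z ∈ concatMap signedPair ks → ∃ λ k → k ∈ ks × ℤ.∣ z ∣ ≡ suc k
∈-signedPairs (k ∷ ks) (here refl)         = k , here refl , refl
∈-signedPairs (k ∷ ks) (there (here refl)) = k , here refl , refl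
∈-signedPairs (k ∷ ks) (there (there z∈))  = let (k′ , k′∈ , eq) = ∈-signedPairs ks z∈ in k′ , there k′∈ , eq

signedPairs-∈ : ∀ {ks k z} → k ∈ ks → z ∈ signedPair k → z ∈ concatMap signedPair ks
signedPairs-∈ (here refl)            (here refl)         = here refl
signedPairs-∈ (here refl)            (there (here refl)) = there (here refl)
signedPairs-∈ {ks = _ ∷ _} (there k∈) z∈                 = there (there (signedPairs-∈ k∈ z∈))

signedPairs-unique : ∀ {ks} → Unique ks → Unique (concatMap signedPair ks)
signedPairs-unique []                   = []
signedPairs-unique {k ∷ ks} (p ∷ ps) = UniqueP.++⁺ {xs = signedPair k} (((λ ()) ∷ []) ∷ ([] ∷ [])) (signedPairs-unique ps)
  λ { (z∈ , z∈′) → clash z∈ (∈-signedPairs ks z∈′) }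
  where
  abs-pair : ∀ {z} → z ∈ signedPair k → ℤ.∣ z ∣ ≡ suc k
  abs-pair (here refl)         = refl
  abs-pair (there (here refl)) = refl
  clash : ∀ {z} → z ∈ signedPair k → (∃ λ k′ → k′ ∈ ks × ℤ.∣ z ∣ ≡ suc k′) → _
  clash z∈ (k′ , k′∈ , eq) = All.lookup p k′∈ (ℕP.suc-injective (trans (sym (abs-pair z∈)) eq))

intsUpTo-unique : ∀ n → Unique (intsUpTo n)
intsUpTo-unique n = All.tabulate (λ z∈ e → zero∉ (∈-signedPairs (upTo n) z∈) e) ∷ signedPairs-unique (UniqueP.upTo⁺ n)
  where
  zero∉ : ∀ {z} → (∃ λ k → k ∈ upTo n × ℤ.∣ z ∣ ≡ suc k) → + 0 ≢ z
  zero∉ (k , _ , ()) refl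

∈-intsUpTo : ∀ n x → ℤ.∣ x ∣ ≤ n → x ∈ intsUpTo n
∈-intsUpTo n (+ zero)  h = here refl
∈-intsUpTo n (+ suc k) h = there (signedPairs-∈ (MemP.∈-upTo⁺ h) (here refl))
∈-intsUpTo n -[1+ k ]  h = there (signedPairs-∈ (MemP.∈-upTo⁺ h) (there (here refl)))

triangle : ℕ → ℕ
triangle zero    = 0
triangle (suc n) = suc n ℕ.+ triangle n

n≤triangle : ∀ n → n ≤ triangle n
n≤triangle zero    = z≤n
n≤triangle (suc n) = ℕP.m≤m+n (suc n) (triangle n)

tri : ℤ → ℕ
tri (+ n)    = triangle n
tri -[1+ n ] = triangle n

2*tri : ∀ x → + 2 ℤ.* + tri x ≡ x ℤ.* x ℤ.+ x
2*tri (+ n)    = 2*triangle n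
  where
  2*triangle : ∀ n → + 2 ℤ.* + triangle n ≡ + n ℤ.* + n ℤ.+ + n
  2*triangle zero    = refl
  2*triangle (suc n) = trans (lemma (+ n) (+ triangle n)) (trans (cong (ℤ._+_ (+ 2 ℤ.* (+ 1 ℤ.+ + n))) (2*triangle n)) (lemma′ (+ n)))
    where
    lemma : ∀ n t → + 2 ℤ.* (+ 1 ℤ.+ n ℤ.+ t) ≡ + 2 ℤ.* (+ 1 ℤ.+ n) ℤ.+ + 2 ℤ.* t
    lemma = solve-∀
    lemma′ : ∀ n → + 2 ℤ.* (+ 1 ℤ.+ n) ℤ.+ (n ℤ.* n ℤ.+ n) ≡ (+ 1 ℤ.+ n) ℤ.* (+ 1 ℤ.+ n) ℤ.+ (+ 1 ℤ.+ n)
    lemma′ = solve-∀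
2*tri -[1+ n ] = trans (2*tri (+ n)) (lemma (+ n))
  where
  lemma : ∀ n → n ℤ.* n ℤ.+ n ≡ (ℤ.- (+ 1 ℤ.+ n)) ℤ.* (ℤ.- (+ 1 ℤ.+ n)) ℤ.+ (ℤ.- (+ 1 ℤ.+ n))
  lemma = solve-∀

∣x∣≤1+tri : ∀ x → ℤ.∣ x ∣ ≤ suc (tri x)
∣x∣≤1+tri (+ n)    = ℕP.m≤n⇒m≤1+n (n≤triangle n)
∣x∣≤1+tri -[1+ n ] = s≤s (n≤triangle n)

-- The exponent of q in the term a^(x(x+1)/2) b^(x(x-1)/2) of Ramanujan's f(a, b) at a = q^r, b =
-- q^s. For r = s it is r x². Identities between exponents are checked on the doubled form `2ex`,
-- which is a polynomial over ℤ.
ex : ℕ → ℕ → ℤ → ℕ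
ex r s x = r ℕ.* tri x ℕ.+ s ℕ.* tri (ℤ.- x)

2ex : ℕ → ℕ → ℤ → ℤ
2ex r s x = + r ℤ.* (x ℤ.* x ℤ.+ x) ℤ.+ + s ℤ.* (x ℤ.* x ℤ.- x)

2*ex : ∀ r s x → + 2 ℤ.* + ex r s x ≡ 2ex r s x
2*ex r s x = trans (cong (ℤ._*_ (+ 2)) (trans (ℤP.pos-+ (r ℕ.* tri x) _) (cong₂ ℤ._+_ (ℤP.pos-* r _) (ℤP.pos-* s _))))
  (trans (lemma (+ r) (+ s) (+ tri x) (+ tri (ℤ.- x))) (cong₂ (λ a b → + r ℤ.* a ℤ.+ + s ℤ.* b) (2*tri x)
    (trans (2*tri (ℤ.- x)) (lemma′ x))))
  where
  lemma : ∀ r s a b → + 2 ℤ.* (r ℤ.* a ℤ.+ s ℤ.* b) ≡ r ℤ.* (+ 2 ℤ.* a) ℤ.+ s ℤ.* (+ 2 ℤ.* b)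
  lemma = solve-∀
  lemma′ : ∀ x → ℤ.- x ℤ.* ℤ.- x ℤ.+ ℤ.- x ≡ x ℤ.* x ℤ.- x
  lemma′ = solve-∀

-- The summand 1 cannot be dropped: for s = 0 the exponent at x = -1 is 0. Hence `θ` sums its n-th
-- coefficient over `intsUpTo (suc n)`.
∣x∣≤1+ex : ∀ r s .{{_ : NonZero (r ℕ.+ s)}} x → ℤ.∣ x ∣ ≤ suc (ex r s x)
∣x∣≤1+ex (suc r) s x = ℕP.≤-trans (∣x∣≤1+tri x) (s≤s (ℕP.≤-trans (ℕP.m≤m+n (tri x) (r ℕ.* tri x)) (ℕP.m≤m+n _ _)))
∣x∣≤1+ex zero (suc s) x = ℕP.≤-trans (ℕP.≤-reflexive (sym (ℤP.∣-i∣≡∣i∣ x)))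
  (ℕP.≤-trans (∣x∣≤1+tri (ℤ.- x)) (s≤s (ℕP.m≤m+n (tri (ℤ.- x)) (s ℕ.* tri (ℤ.- x)))))

odd : ℕ → Bool
odd zero    = false
odd (suc n) = not (odd n)

parity : ℤ → Bool
parity x = odd ℤ.∣ x ∣

odd-+ : ∀ m n → odd (m ℕ.+ n) ≡ odd m xor odd n
odd-+ zero    n = refl
odd-+ (suc m) n = trans (cong not (odd-+ m n)) (BoolP.not-distribˡ-xor (odd m) (odd n))

odd-* : ∀ m n → odd (m ℕ.* n) ≡ odd m ∧ odd n
odd-* zero    n = refl
odd-* (suc m) n = trans (odd-+ n (m ℕ.* n)) (trans (cong (odd n xor_) (odd-* m n)) (lemma (odd m) (odd n)))
  where
  lemma : ∀ a b → b xor (a ∧ b) ≡ not a ∧ b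
  lemma false false = refl
  lemma false true  = refl
  lemma true  false = refl
  lemma true  true  = refl

odd-⊖ : ∀ m n → odd ℤ.∣ m ℤ.⊖ n ∣ ≡ odd m xor odd n
odd-⊖ m       zero    = sym (BoolP.xor-identityʳ (odd m))
odd-⊖ zero    (suc n) = refl
odd-⊖ (suc m) (suc n) = trans (cong (odd ∘ ℤ.∣_∣) (ℤP.[1+m]⊖[1+n]≡m⊖n m n)) (trans (odd-⊖ m n) (lemma (odd m) (odd n)))
  where
  lemma : ∀ a b → a xor b ≡ not a xor not b
  lemma false false = refl
  lemma false true  = refl
  lemma true  false = refl
  lemma true  true  = refl

parity-+ : ∀ x y → parity (x ℤ.+ y) ≡ parity x xor parity y
parity-+ (+ m)    (+ n)    = odd-+ m n
parity-+ (+ m)    -[1+ n ] = odd-⊖ m (suc n)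
parity-+ -[1+ m ] (+ n)    = trans (odd-⊖ n (suc m)) (BoolP.xor-comm (odd n) _)
parity-+ -[1+ m ] -[1+ n ] = trans (cong (not ∘ not) (odd-+ m n)) (lemma (odd m) (odd n))
  where
  lemma : ∀ a b → not (not (a xor b)) ≡ not a xor not b
  lemma false false = refl
  lemma false true  = refl
  lemma true  false = refl
  lemma true  true  = refl

parity-* : ∀ x y → parity (x ℤ.* y) ≡ parity x ∧ parity y
parity-* x y = trans (cong odd (ℤP.abs-* x y)) (odd-* ℤ.∣ x ∣ ℤ.∣ y ∣)

Weight : Set
Weight = Bool → ℤ

plain alternating : Weight
plain       _ = + 1
alternating b = if b then ℤ.-1ℤ else + 1

θ-term : Weight → ℕ → ℕ → ℤ → PS
θ-term w r s x = tm (w (parity x)) (ex r s x)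

opaque
  θ : Weight → ℕ → ℕ → PS
  θ w r s n = sumOver (λ x → θ-term w r s x n) (intsUpTo (suc n))

  θ-sum : ∀ w r s .{{_ : NonZero (r ℕ.+ s)}} → HasSum (θ-term w r s) (θ w r s)
  θ-sum w r s = sum-exists (intsUpTo ∘ suc) (intsUpTo-unique ∘ suc) cover
    where
    cover : ∀ n x i → i ≤ n → θ-term w r s x i ≢ + 0 → x ∈ intsUpTo (suc n)
    cover n x i i≤n nz with i ℕ.≟ ex r s x
    ... | yes refl = ∈-intsUpTo (suc n) x (ℕP.≤-trans (∣x∣≤1+ex r s x) (s≤s i≤n))
    ... | no  i≢e  = contradiction (tm-off _ (ex r s x) i i≢e) nz

-- Ramanujan's general theta function f(q ^ r, q ^ s), and f(- q ^ r, - q ^ s).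
F F⁻ : ℕ → ℕ → PS
F  = θ plain
F⁻ = θ alternating

-- Affine changes of summation variables. All side conditions are identities between closed polynomials
-- or Booleans, so that they can be checked by normalisation.

open ℤS.+-*-Solver using () renaming (Polynomial to Poly; con to conᶻ; _:+_ to _⊹_; _:*_ to _⊠_; _:-_ to _⊟_; var to varᶻ; ⟦_⟧ to ⟦_⟧ᶻ; ⟦_⟧N to ⟦_⟧ᴺ; normalise to normaliseᶻ; correct to correctᶻ)

infix 4 _≡ᴾ_
record _≡ᴾ_ {n} (p p′ : Poly n) : Set where
  constructor same
  field normal-forms : normaliseᶻ p ≡ normaliseᶻ p′

identity : ∀ {n} {p p′ : Poly n} → p ≡ᴾ p′ → ∀ ρ → ⟦ p ⟧ᶻ ρ ≡ ⟦ p′ ⟧ᶻ ρ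
identity {p = p} {p′} (same eq) ρ = trans (sym (correctᶻ p ρ)) (trans (cong (λ n → ⟦ n ⟧ᴺ ρ) eq) (correctᶻ p′ ρ))

Affine : Set
Affine = ℤ × ℤ × ℤ

aff : Affine → ℤ → ℤ → ℤ
aff (a , b , c) x y = a ℤ.* x ℤ.+ b ℤ.* y ℤ.+ c

affᴾ : ∀ {n} → Affine → Poly n → Poly n → Poly n
affᴾ (a , b , c) x y = conᶻ a ⊠ x ⊹ conᶻ b ⊠ y ⊹ conᶻ c

affᵇ : Affine → Bool → Bool → Bool
affᵇ (a , b , c) x y = ((parity a ∧ x) xor (parity b ∧ y)) xor parity c

parity-aff : ∀ A x y → parity (aff A x y) ≡ affᵇ A (parity x) (parity y)
parity-aff (a , b , c) x y = trans (parity-+ (a ℤ.* x ℤ.+ b ℤ.* y) c)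
  (cong (_xor parity c) (trans (parity-+ (a ℤ.* x) (b ℤ.* y)) (cong₂ _xor_ (parity-* a x) (parity-* b y))))

2exᴾ : ∀ {n} → ℕ → ℕ → Poly n → Poly n
2exᴾ r s x = conᶻ (+ r) ⊠ (x ⊠ x ⊹ x) ⊹ conᶻ (+ s) ⊠ (x ⊠ x ⊟ x)

record Family : Set where
  constructor family
  field
    w₁ : Weight
    r₁ s₁ : ℕ
    A₁ : Affine
    w₂ : Weight
    r₂ s₂ : ℕ
    A₂ : Affine

opaque
  terms : Family → ℤ × ℤ → PS
  terms (family w₁ r₁ s₁ A₁ w₂ r₂ s₂ A₂) (x , y) = θ-term w₁ r₁ s₁ (aff A₁ x y) *ˢ θ-term w₂ r₂ s₂ (aff A₂ x y)

exᴾ : ∀ {n} → Family → Poly n → Poly n → Poly n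
exᴾ (family w₁ r₁ s₁ A₁ w₂ r₂ s₂ A₂) x y = 2exᴾ r₁ s₁ (affᴾ A₁ x y) ⊹ 2exᴾ r₂ s₂ (affᴾ A₂ x y)

weightᵇ : Family → Bool → Bool → ℤ
weightᵇ (family w₁ r₁ s₁ A₁ w₂ r₂ s₂ A₂) x y = w₁ (affᵇ A₁ x y) ℤ.* w₂ (affᵇ A₂ x y)

-- The affine map (J, N) is inverse to (U, V) and carries the terms of f to c q^e times the terms of
-- g. Exponents are compared after doubling. The weights depend only on parities, so four Boolean
-- cases settle them.
Change : Family → Family → ℤ → ℕ → Affine → Affine → Affine → Affine → Set
Change f g c e J N U V =
    (affᴾ J (affᴾ U x y) (affᴾ V x y) ≡ᴾ x)
  × (affᴾ N (affᴾ U x y) (affᴾ V x y) ≡ᴾ y)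
  × (affᴾ U (affᴾ J x y) (affᴾ N x y) ≡ᴾ x)
  × (affᴾ V (affᴾ J x y) (affᴾ N x y) ≡ᴾ y)
  × (conᶻ (+ 2) ⊠ conᶻ (+ e) ⊹ exᴾ g x y ≡ᴾ exᴾ f (affᴾ J x y) (affᴾ N x y))
  × Weights false false × Weights false true × Weights true false × Weights true true
  where
  Weights : Bool → Bool → Set
  Weights a b = c ℤ.* weightᵇ g a b ≡ weightᵇ f (affᵇ J a b) (affᵇ N a b)
  x y : Poly 2
  x = varᶻ zero
  y = varᶻ (suc zero)

pattern checked = same refl , same refl , same refl , same refl , same refl , refl , refl , refl , refl

opaque
  unfolding terms
  HasSum-change : ∀ f g c e J N U V → Change f g c e J N U V → ∀ {s} → HasSum (terms g) s → HasSum (terms f) (tm c e *ˢ s)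
  HasSum-change f@(family w₁ r₁ s₁ A₁ w₂ r₂ s₂ A₂) g@(family w₃ r₃ s₃ A₃ w₄ r₄ s₄ A₄) c e J N U V (e₁ , e₂ , e₃ , e₄ , e₅ , w₀₀ , w₀₁ , w₁₀ , w₁₁) S =
    HasSum-iso (λ { (x , y) → aff J x y , aff N x y }) (λ { (x , y) → aff U x y , aff V x y })
      (λ { (x , y) → cong₂ _,_ (identity e₃ (x ∷ y ∷ [])) (identity e₄ (x ∷ y ∷ [])) })
      (λ { (x , y) → cong₂ _,_ (identity e₁ (x ∷ y ∷ [])) (identity e₂ (x ∷ y ∷ [])) })
      (λ { (x , y) → term x y }) (HasSum-scale (tm c e) S)
    where
    e₆ : ∀ a b → c ℤ.* weightᵇ g a b ≡ weightᵇ f (affᵇ J a b) (affᵇ N a b)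
    e₆ false false = w₀₀
    e₆ false true  = w₀₁
    e₆ true  false = w₁₀
    e₆ true  true  = w₁₁
    module _ (x y : ℤ) where
      x₁ = aff A₁ (aff J x y) (aff N x y)
      x₂ = aff A₂ (aff J x y) (aff N x y)
      x₃ = aff A₃ x y
      x₄ = aff A₄ x y
      weights : c ℤ.* (w₃ (parity x₃) ℤ.* w₄ (parity x₄)) ≡ w₁ (parity x₁) ℤ.* w₂ (parity x₂)
      weights = trans (cong (ℤ._*_ c) (cong₂ (λ a b → w₃ a ℤ.* w₄ b) (parity-aff A₃ x y) (parity-aff A₄ x y)))
        (trans (e₆ (parity x) (parity y)) (sym (cong₂ (λ a b → w₁ a ℤ.* w₂ b)
          (trans (parity-aff A₁ _ _) (cong₂ (affᵇ A₁) (parity-aff J x y) (parity-aff N x y)))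
          (trans (parity-aff A₂ _ _) (cong₂ (affᵇ A₂) (parity-aff J x y) (parity-aff N x y))))))
      double : ∀ m n → + 2 ℤ.* + (m ℕ.+ n) ≡ + 2 ℤ.* + m ℤ.+ + 2 ℤ.* + n
      double m n = trans (cong (ℤ._*_ (+ 2)) (ℤP.pos-+ m n)) (ℤP.*-distribˡ-+ (+ 2) (+ m) (+ n))
      exponents : e ℕ.+ (ex r₃ s₃ x₃ ℕ.+ ex r₄ s₄ x₄) ≡ ex r₁ s₁ x₁ ℕ.+ ex r₂ s₂ x₂
      exponents = ℤP.+-injective (ℤP.*-cancelˡ-≡ (+ 2) _ _ (trans
        (trans (double e _) (cong (ℤ._+_ (+ 2 ℤ.* + e)) (trans (double (ex r₃ s₃ x₃) _) (cong₂ ℤ._+_ (2*ex r₃ s₃ x₃) (2*ex r₄ s₄ x₄)))))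
        (trans (identity e₅ (x ∷ y ∷ [])) (sym (trans (double (ex r₁ s₁ x₁) _) (cong₂ ℤ._+_ (2*ex r₁ s₁ x₁) (2*ex r₂ s₂ x₂)))))))
      term : tm c e *ˢ (θ-term w₃ r₃ s₃ x₃ *ˢ θ-term w₄ r₄ s₄ x₄) ≈ θ-term w₁ r₁ s₁ x₁ *ˢ θ-term w₂ r₂ s₂ x₂
      term = ≈-trans (*-cong ≈-refl (tm-* _ (ex r₃ s₃ x₃) _ (ex r₄ s₄ x₄))) (≈-trans (tm-* c e _ _)
        (≈-trans (subst₂ (λ w e′ → tm (c ℤ.* (w₃ (parity x₃) ℤ.* w₄ (parity x₄))) (e ℕ.+ (ex r₃ s₃ x₃ ℕ.+ ex r₄ s₄ x₄)) ≈ tm w e′) weights exponents ≈-refl)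
          (≈-sym (tm-* _ (ex r₁ s₁ x₁) _ (ex r₂ s₂ x₂)))))

X₁ X₂ : Affine
X₁ = + 1 , + 0 , + 0
X₂ = + 0 , + 1 , + 0

opaque
  unfolding terms
  θ-product : ∀ w₁ r₁ s₁ w₂ r₂ s₂ .{{_ : NonZero (r₁ ℕ.+ s₁)}} .{{_ : NonZero (r₂ ℕ.+ s₂)}} →
              HasSum (terms (family w₁ r₁ s₁ X₁ w₂ r₂ s₂ X₂)) (θ w₁ r₁ s₁ *ˢ θ w₂ r₂ s₂)
  θ-product w₁ r₁ s₁ w₂ r₂ s₂ = HasSum-cong
    (λ { (x , y) → subst₂ (λ a b → θ-term w₁ r₁ s₁ x *ˢ θ-term w₂ r₂ s₂ y ≈ θ-term w₁ r₁ s₁ a *ˢ θ-term w₂ r₂ s₂ b)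
                     (lemma₁ x y) (lemma₂ x y) ≈-refl })
    ≈-refl (HasSum-× (θ-sum w₁ r₁ s₁) (θ-sum w₂ r₂ s₂))
    where
    lemma₁ : ∀ x y → x ≡ + 1 ℤ.* x ℤ.+ + 0 ℤ.* y ℤ.+ + 0
    lemma₁ = solve-∀
    lemma₂ : ∀ x y → y ≡ + 0 ℤ.* x ℤ.+ + 1 ℤ.* y ℤ.+ + 0
    lemma₂ = solve-∀

  class-terms : ∀ k .{{_ : NonZero k}} a (r : Fin k) w₁ r₁ s₁ w₂ r₂ s₂ z →
    terms (family w₁ r₁ s₁ X₁ w₂ r₂ s₂ X₂) (class k a (r , z)) ≈ terms (family w₁ r₁ s₁ (+ k , a , + toℕ r) w₂ r₂ s₂ X₂) z
  class-terms k a r w₁ r₁ s₁ w₂ r₂ s₂ (x , y) =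
    subst₂ (λ u v → θ-term w₁ r₁ s₁ u *ˢ θ-term w₂ r₂ s₂ v ≈ θ-term w₁ r₁ s₁ (aff (+ k , a , + toℕ r) x y) *ˢ θ-term w₂ r₂ s₂ (aff X₂ x y))
      (sym (lemma₁ (aff (+ k , a , + toℕ r) x y) y)) (sym (lemma₂ x y (aff (+ k , a , + toℕ r) x y))) ≈-refl
    where
    lemma₁ : ∀ x y → + 1 ℤ.* x ℤ.+ + 0 ℤ.* y ℤ.+ + 0 ≡ x
    lemma₁ = solve-∀
    lemma₂ : ∀ x y z → + 0 ℤ.* z ℤ.+ + 1 ℤ.* y ℤ.+ + 0 ≡ + 0 ℤ.* x ℤ.+ + 1 ℤ.* y ℤ.+ + 0
    lemma₂ = solve-∀

θ-split : ∀ k .{{_ : NonZero k}} a w₁ r₁ s₁ w₂ r₂ s₂ .{{_ : NonZero (r₁ ℕ.+ s₁)}} .{{_ : NonZero (r₂ ℕ.+ s₂)}} {S : Fin k → PS} →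
          (∀ r → HasSum (terms (family w₁ r₁ s₁ (+ k , a , + toℕ r) w₂ r₂ s₂ X₂)) (S r)) →
          θ w₁ r₁ s₁ *ˢ θ w₂ r₂ s₂ ≈ sumFin k S
θ-split k a w₁ r₁ s₁ w₂ r₂ s₂ S = HasSum-unique (θ-product w₁ r₁ s₁ w₂ r₂ s₂)
  (HasSum-classes k a (λ r → HasSum-cong (λ z → ≈-sym (class-terms k a r w₁ r₁ s₁ w₂ r₂ s₂ z)) ≈-refl (S r)))

θ-class : ∀ k .{{_ : NonZero k}} a w₁ r₁ s₁ w₂ r₂ s₂ .{{_ : NonZero (r₁ ℕ.+ s₁)}} .{{_ : NonZero (r₂ ℕ.+ s₂)}} (r : Fin k) →
          ∃ (HasSum (terms (family w₁ r₁ s₁ (+ k , a , + toℕ r) w₂ r₂ s₂ X₂)))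
θ-class k a w₁ r₁ s₁ w₂ r₂ s₂ r = let (s , S) = HasSum-class k a (θ-product w₁ r₁ s₁ w₂ r₂ s₂) r in
  s , HasSum-cong (class-terms k a r w₁ r₁ s₁ w₂ r₂ s₂) ≈-refl S

θ-split₂ : ∀ a w₁ r₁ s₁ w₂ r₂ s₂ .{{_ : NonZero (r₁ ℕ.+ s₁)}} .{{_ : NonZero (r₂ ℕ.+ s₂)}} {S₀ S₁ : PS} →
           HasSum (terms (family w₁ r₁ s₁ (+ 2 , a , + 0) w₂ r₂ s₂ X₂)) S₀ →
           HasSum (terms (family w₁ r₁ s₁ (+ 2 , a , + 1) w₂ r₂ s₂ X₂)) S₁ →
           θ w₁ r₁ s₁ *ˢ θ w₂ r₂ s₂ ≈ S₀ +ˢ S₁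
θ-split₂ a w₁ r₁ s₁ w₂ r₂ s₂ {S₀} {S₁} H₀ H₁ = ≈-trans
  (θ-split 2 a w₁ r₁ s₁ w₂ r₂ s₂ {λ { zero → S₀ ; (suc zero) → S₁ }} (λ { zero → H₀ ; (suc zero) → H₁ }))
  (+-cong ≈-refl (+-identityʳ S₁))

θ-split₃ : ∀ a w₁ r₁ s₁ w₂ r₂ s₂ .{{_ : NonZero (r₁ ℕ.+ s₁)}} .{{_ : NonZero (r₂ ℕ.+ s₂)}} {S₀ S₁ S₂ : PS} →
           HasSum (terms (family w₁ r₁ s₁ (+ 3 , a , + 0) w₂ r₂ s₂ X₂)) S₀ →
           HasSum (terms (family w₁ r₁ s₁ (+ 3 , a , + 1) w₂ r₂ s₂ X₂)) S₁ →
           HasSum (terms (family w₁ r₁ s₁ (+ 3 , a , + 2) w₂ r₂ s₂ X₂)) S₂ →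
           θ w₁ r₁ s₁ *ˢ θ w₂ r₂ s₂ ≈ S₀ +ˢ (S₁ +ˢ S₂)
θ-split₃ a w₁ r₁ s₁ w₂ r₂ s₂ {S₀} {S₁} {S₂} H₀ H₁ H₂ = ≈-trans
  (θ-split 3 a w₁ r₁ s₁ w₂ r₂ s₂ {λ { zero → S₀ ; (suc zero) → S₁ ; (suc (suc zero)) → S₂ }}
    (λ { zero → H₀ ; (suc zero) → H₁ ; (suc (suc zero)) → H₂ }))
  (+-cong ≈-refl (+-cong ≈-refl (+-identityʳ S₂)))

θ-split₅ : ∀ a w₁ r₁ s₁ w₂ r₂ s₂ .{{_ : NonZero (r₁ ℕ.+ s₁)}} .{{_ : NonZero (r₂ ℕ.+ s₂)}} {S₀ S₁ S₂ S₃ S₄ : PS} →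
           HasSum (terms (family w₁ r₁ s₁ (+ 5 , a , + 0) w₂ r₂ s₂ X₂)) S₀ →
           HasSum (terms (family w₁ r₁ s₁ (+ 5 , a , + 1) w₂ r₂ s₂ X₂)) S₁ →
           HasSum (terms (family w₁ r₁ s₁ (+ 5 , a , + 2) w₂ r₂ s₂ X₂)) S₂ →
           HasSum (terms (family w₁ r₁ s₁ (+ 5 , a , + 3) w₂ r₂ s₂ X₂)) S₃ →
           HasSum (terms (family w₁ r₁ s₁ (+ 5 , a , + 4) w₂ r₂ s₂ X₂)) S₄ →
           θ w₁ r₁ s₁ *ˢ θ w₂ r₂ s₂ ≈ S₀ +ˢ (S₁ +ˢ (S₂ +ˢ (S₃ +ˢ S₄)))
θ-split₅ a w₁ r₁ s₁ w₂ r₂ s₂ {S₀} {S₁} {S₂} {S₃} {S₄} H₀ H₁ H₂ H₃ H₄ = ≈-trans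
  (θ-split 5 a w₁ r₁ s₁ w₂ r₂ s₂
    {λ { zero → S₀ ; (suc zero) → S₁ ; (suc (suc zero)) → S₂ ; (suc (suc (suc zero))) → S₃ ; (suc (suc (suc (suc zero)))) → S₄ }}
    (λ { zero → H₀ ; (suc zero) → H₁ ; (suc (suc zero)) → H₂ ; (suc (suc (suc zero))) → H₃ ; (suc (suc (suc (suc zero)))) → H₄ }))
  (+-cong ≈-refl (+-cong ≈-refl (+-cong ≈-refl (+-cong ≈-refl (+-identityʳ S₄)))))

-- Bilinear relations between theta series

F₁₁² : F 1 1 *ˢ F 1 1 ≈ tm (+ 1) 0 *ˢ (F 2 2 *ˢ F 2 2) +ˢ tm (+ 1) 1 *ˢ (F 4 0 *ˢ F 4 0)
F₁₁² = θ-split₂ (+ 1) plain 1 1 plain 1 1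
    -- On m ≡ n modulo 2 the substitution is m = x + y, n = x - y, with m² + n² = 2 x² + 2 y². On
    -- the other class m = x + y + 1, n = x - y, and the exponent becomes 1 + 4 x(x+1)/2 + 4
    -- y(y+1)/2.
    (HasSum-change _ _ (+ 1) 0 (+ 0 , + 1 , + 0) (+ 1 , -[1+ 0 ] , + 0) (+ 1 , + 1 , + 0) (+ 1 , + 0 , + 0) checked (θ-product plain 2 2 plain 2 2))
    (HasSum-change _ _ (+ 1) 1 (+ 0 , + 1 , + 0) (+ 1 , -[1+ 0 ] , + 0) (+ 1 , + 1 , + 0) (+ 1 , + 0 , + 0) checked (θ-product plain 4 0 plain 4 0))

F⁻₁₁² : F⁻ 1 1 *ˢ F⁻ 1 1 ≈ tm (+ 1) 0 *ˢ (F 2 2 *ˢ F 2 2) +ˢ tm -[1+ 0 ] 1 *ˢ (F 4 0 *ˢ F 4 0)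
F⁻₁₁² = θ-split₂ (+ 1) alternating 1 1 alternating 1 1
    (HasSum-change _ _ (+ 1) 0 (+ 0 , + 1 , + 0) (+ 1 , -[1+ 0 ] , + 0) (+ 1 , + 1 , + 0) (+ 1 , + 0 , + 0) checked (θ-product plain 2 2 plain 2 2))
    (HasSum-change _ _ -[1+ 0 ] 1 (+ 0 , + 1 , + 0) (+ 1 , -[1+ 0 ] , + 0) (+ 1 , + 1 , + 0) (+ 1 , + 0 , + 0) checked (θ-product plain 4 0 plain 4 0))

F₁₁*F⁻₁₁ : F 1 1 *ˢ F⁻ 1 1 ≈ tm (+ 1) 0 *ˢ (F⁻ 2 2 *ˢ F⁻ 2 2) +ˢ tm (+ 1) 1 *ˢ (F⁻ 4 0 *ˢ F⁻ 4 0)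
F₁₁*F⁻₁₁ = θ-split₂ (+ 1) plain 1 1 alternating 1 1
    (HasSum-change _ _ (+ 1) 0 (+ 0 , + 1 , + 0) (+ 1 , -[1+ 0 ] , + 0) (+ 1 , + 1 , + 0) (+ 1 , + 0 , + 0) checked (θ-product alternating 2 2 alternating 2 2))
    (HasSum-change _ _ (+ 1) 1 (+ 0 , + 1 , + 0) (+ 1 , -[1+ 0 ] , + 0) (+ 1 , + 1 , + 0) (+ 1 , + 0 , + 0) checked (θ-product alternating 4 0 alternating 4 0))

-- This relation and the next three express products with r + s = 10 through the four series
-- `F 12 8`, `F 14 6`, `F 16 4`, `F 18 2`, which `weierstrass` then eliminates.
F⁻₆₄*F⁻₈₂ : F⁻ 6 4 *ˢ F⁻ 8 2 ≈ tm (+ 1) 0 *ˢ (F 14 6 *ˢ F 12 8) +ˢ tm -[1+ 0 ] 2 *ˢ (F 16 4 *ˢ F 18 2)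
F⁻₆₄*F⁻₈₂ = θ-split₂ (+ 1) alternating 6 4 alternating 8 2
    (HasSum-change _ _ (+ 1) 0 (+ 0 , -[1+ 0 ] , + 0) (+ 1 , + 1 , + 0) (+ 1 , + 1 , + 0) (-[1+ 0 ] , + 0 , + 0) checked (θ-product plain 14 6 plain 12 8))
    (HasSum-change _ _ -[1+ 0 ] 2 (+ 0 , + 1 , + 0) (-[1+ 0 ] , -[1+ 0 ] , -[1+ 0 ]) (-[1+ 0 ] , -[1+ 0 ] , -[1+ 0 ]) (+ 1 , + 0 , + 0) checked (θ-product plain 16 4 plain 18 2))

F₇₃*F₉₁ : F 7 3 *ˢ F 9 1 ≈ tm (+ 1) 0 *ˢ (F 16 4 *ˢ F 12 8) +ˢ tm (+ 1) 1 *ˢ (F 14 6 *ˢ F 18 2)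
F₇₃*F₉₁ = θ-split₂ (+ 1) plain 7 3 plain 9 1
    (HasSum-change _ _ (+ 1) 0 (+ 0 , -[1+ 0 ] , + 0) (+ 1 , + 1 , + 0) (+ 1 , + 1 , + 0) (-[1+ 0 ] , + 0 , + 0) checked (θ-product plain 16 4 plain 12 8))
    (HasSum-change _ _ (+ 1) 1 (+ 0 , + 1 , + 0) (-[1+ 0 ] , -[1+ 0 ] , -[1+ 0 ]) (-[1+ 0 ] , -[1+ 0 ] , -[1+ 0 ]) (+ 1 , + 0 , + 0) checked (θ-product plain 14 6 plain 18 2))

F₅₅*F₇₃ : F 5 5 *ˢ F 7 3 ≈ tm (+ 1) 0 *ˢ (F 12 8 *ˢ F 12 8) +ˢ tm (+ 1) 3 *ˢ (F 18 2 *ˢ F 18 2)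
F₅₅*F₇₃ = θ-split₂ (+ 1) plain 5 5 plain 7 3
    (HasSum-change _ _ (+ 1) 0 (+ 0 , -[1+ 0 ] , + 0) (+ 1 , + 1 , + 0) (+ 1 , + 1 , + 0) (-[1+ 0 ] , + 0 , + 0) checked (θ-product plain 12 8 plain 12 8))
    (HasSum-change _ _ (+ 1) 3 (+ 0 , + 1 , + 0) (-[1+ 0 ] , -[1+ 0 ] , -[1+ 0 ]) (-[1+ 0 ] , -[1+ 0 ] , -[1+ 0 ]) (+ 1 , + 0 , + 0) checked (θ-product plain 18 2 plain 18 2))

F₅₅*F₉₁ : F 5 5 *ˢ F 9 1 ≈ tm (+ 1) 0 *ˢ (F 14 6 *ˢ F 14 6) +ˢ tm (+ 1) 1 *ˢ (F 16 4 *ˢ F 16 4)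
F₅₅*F₉₁ = θ-split₂ (+ 1) plain 5 5 plain 9 1
    (HasSum-change _ _ (+ 1) 0 (+ 0 , -[1+ 0 ] , + 0) (+ 1 , + 1 , + 0) (+ 1 , + 1 , + 0) (-[1+ 0 ] , + 0 , + 0) checked (θ-product plain 14 6 plain 14 6))
    (HasSum-change _ _ (+ 1) 1 (+ 0 , + 1 , + 0) (-[1+ 0 ] , -[1+ 0 ] , -[1+ 0 ]) (-[1+ 0 ] , -[1+ 0 ] , -[1+ 0 ]) (+ 1 , + 0 , + 0) checked (θ-product plain 16 4 plain 16 4))

F⁻₁₃² : F⁻ 1 3 *ˢ F⁻ 1 3 ≈ tm (+ 1) 0 *ˢ (F 6 2 *ˢ F 4 4) +ˢ tm -[1+ 0 ] 1 *ˢ (F 6 2 *ˢ F 8 0)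
F⁻₁₃² = θ-split₂ (+ 1) alternating 1 3 alternating 1 3
    (HasSum-change _ _ (+ 1) 0 (+ 0 , + 1 , + 0) (-[1+ 0 ] , -[1+ 0 ] , + 0) (-[1+ 0 ] , -[1+ 0 ] , + 0) (+ 1 , + 0 , + 0) checked (θ-product plain 6 2 plain 4 4))
    (HasSum-change _ _ -[1+ 0 ] 1 (+ 0 , + 1 , + 0) (+ 1 , -[1+ 0 ] , + 0) (+ 1 , + 1 , + 0) (+ 1 , + 0 , + 0) checked (θ-product plain 6 2 plain 8 0))

-- On the ideal of 2 + i the norm is 5 (x² + y²). Multiplication by i permutes the four other
-- classes cyclically and preserves the norm, so they contribute equally.
F₁₁²-mod₅ : F 1 1 *ˢ F 1 1 ≈ tm (+ 1) 0 *ˢ (F 5 5 *ˢ F 5 5) +ˢ (tm (+ 1) 1 *ˢ (F 7 3 *ˢ F 9 1) +ˢ (tm (+ 1) 1 *ˢ (F 7 3 *ˢ F 9 1) +ˢ (tm (+ 1) 1 *ˢ (F 7 3 *ˢ F 9 1) +ˢ tm (+ 1) 1 *ˢ (F 7 3 *ˢ F 9 1))))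
F₁₁²-mod₅ = θ-split₅ (+ 2) plain 1 1 plain 1 1
    (HasSum-change _ _ (+ 1) 0 (+ 0 , -[1+ 0 ] , + 0) (+ 1 , + 2 , + 0) (+ 2 , + 1 , + 0) (-[1+ 0 ] , + 0 , + 0) checked (θ-product plain 5 5 plain 5 5))
    (HasSum-change _ _ (+ 1) 1 (+ 1 , + 0 , + 0) (-[1+ 1 ] , + 1 , + 0) (+ 1 , + 0 , + 0) (+ 2 , + 1 , + 0) checked (θ-product plain 7 3 plain 9 1))
    (HasSum-change _ _ (+ 1) 1 (+ 0 , + 1 , + 0) (-[1+ 0 ] , -[1+ 1 ] , -[1+ 0 ]) (-[1+ 1 ] , -[1+ 0 ] , -[1+ 0 ]) (+ 1 , + 0 , + 0) checked (θ-product plain 7 3 plain 9 1))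
    (HasSum-change _ _ (+ 1) 1 (+ 0 , -[1+ 0 ] , -[1+ 0 ]) (+ 1 , + 2 , + 1) (+ 2 , + 1 , + 1) (-[1+ 0 ] , + 0 , -[1+ 0 ]) checked (θ-product plain 7 3 plain 9 1))
    (HasSum-change _ _ (+ 1) 1 (-[1+ 0 ] , + 0 , -[1+ 0 ]) (+ 2 , -[1+ 0 ] , + 0) (-[1+ 0 ] , + 0 , -[1+ 0 ]) (-[1+ 1 ] , -[1+ 0 ] , -[1+ 1 ]) checked (θ-product plain 7 3 plain 9 1))

q⁰≈1 : tm (+ 1) 0 ≈ const (+ 1)
q⁰≈1 = tm-zero (+ 1)

tm-neg : ∀ e → tm -[1+ 0 ] e ≈ -ˢ q^ e
tm-neg e = ≈-trans (≈-sym (tm-const -[1+ 0 ] (+ 1) e)) (solve 1 (λ x → con -[1+ 0 ] :* x := :- x) ≈-refl (q^ e))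

-- Multiplication by 1 + √-5 relates the forms X² + 5 Y² and u² + 5 v². The solutions with X, Y divisible by 3 cancel.
F₄₀*F₁₀₁₀ : F 4 0 *ˢ F 10 10 ≈ q^ 2 *ˢ (F 2 2 *ˢ F 20 0) +ˢ const (+ 2) *ˢ (F⁻ 2 4 *ˢ F⁻ 10 20)
F₄₀*F₁₀₁₀ =
  let (s₀ , S₀) = θ-class 3 (+ 5) plain 4 0 plain 10 10 zero
      (t₀ , T₀) = θ-class 3 (+ 5) plain 2 2 plain 20 0 zero
      (t₁ , T₁) = θ-class 3 (+ 5) plain 2 2 plain 20 0 (suc zero)
      left : F 4 0 *ˢ F 10 10 ≈ s₀ +ˢ (tm (+ 1) 2 *ˢ t₁ +ˢ tm (+ 1) 0 *ˢ s₀)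
      left = θ-split₃ (+ 5) plain 4 0 plain 10 10 S₀
        (HasSum-change _ _ (+ 1) 2 (-[1+ 0 ] , + 0 , + 0) (+ 1 , + 1 , + 0) (-[1+ 0 ] , + 0 , + 0) (+ 1 , + 1 , + 0) checked T₁)
        (HasSum-change _ _ (+ 1) 0 (-[1+ 0 ] , + 0 , -[1+ 0 ]) (+ 0 , -[1+ 0 ] , + 0) (-[1+ 0 ] , + 0 , -[1+ 0 ]) (+ 0 , -[1+ 0 ] , + 0) checked S₀)
      right : F 2 2 *ˢ F 20 0 ≈ t₀ +ˢ (t₁ +ˢ tm (+ 1) 0 *ˢ t₀)
      right = θ-split₃ (+ 5) plain 2 2 plain 20 0 T₀ T₁
        (HasSum-change _ _ (+ 1) 0 (-[1+ 0 ] , + 0 , + 1) (+ 0 , -[1+ 0 ] , -[1+ 0 ]) (-[1+ 0 ] , + 0 , + 1) (+ 0 , -[1+ 0 ] , -[1+ 0 ]) checked T₀)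
      signed : F⁻ 2 4 *ˢ F⁻ 10 20 ≈ tm (+ 1) 0 *ˢ s₀ +ˢ tm -[1+ 0 ] 2 *ˢ t₀
      signed = θ-split₂ (+ 1) alternating 2 4 alternating 10 20
        (HasSum-change _ _ (+ 1) 0 (+ 0 , + 1 , + 0) (-[1+ 0 ] , -[1+ 1 ] , + 0) (-[1+ 1 ] , -[1+ 0 ] , + 0) (+ 1 , + 0 , + 0) checked S₀)
        (HasSum-change _ _ -[1+ 0 ] 2 (+ 0 , + 1 , + 0) (-[1+ 0 ] , -[1+ 1 ] , + 0) (-[1+ 1 ] , -[1+ 0 ] , + 0) (+ 1 , + 0 , + 0) checked T₀)
  -- Up to q⁰ = 1 the three products are 2 s₀ + q² t₁, t₁ + 2 t₀ and s₀ - q² t₀. Eliminating the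
  -- unevaluated class sums s₀, t₀, t₁ leaves the claim.
  in ≈-trans left (≈-trans
       (comb₂ (solve 6 (λ s₀ t₀ t₁ o m q → s₀ :+ (q :* t₁ :+ o :* s₀) :=
                q :* (t₀ :+ (t₁ :+ o :* t₀)) :+ con (+ 2) :* (o :* s₀ :+ m :* t₀)
                :+ (:- s₀ :- q :* t₀) :* (o :- con (+ 1)) :+ (con -[1+ 1 ] :* t₀) :* (m :- :- q)) ≈-refl
                s₀ t₀ t₁ (tm (+ 1) 0) (tm -[1+ 0 ] 2) (q^ 2))
              q⁰≈1 (tm-neg 2))
       (+-cong (*-cong ≈-refl (≈-sym right)) (*-cong ≈-refl (≈-sym signed))))

-- Dissections and symmetries of a single theta series

Affine₁ : Set
Affine₁ = ℤ × ℤ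

aff₁ : Affine₁ → ℤ → ℤ
aff₁ (a , c) x = a ℤ.* x ℤ.+ c

-- The map x ↦ i x + j is required to be an involution, so that it is its own inverse; x ↦ x and x ↦
-- -1 - x suffice below.
Change₁ : Weight → ℕ → ℕ → Affine₁ → Weight → ℕ → ℕ → ℤ → ℕ → Affine₁ → Set
Change₁ w r s (a , b) w′ r′ s′ c e (i , j) =
    (conᶻ i ⊠ (conᶻ i ⊠ x ⊹ conᶻ j) ⊹ conᶻ j ≡ᴾ x)
  × (conᶻ (+ 2) ⊠ conᶻ (+ e) ⊹ 2exᴾ r′ s′ x ≡ᴾ 2exᴾ r s (conᶻ a ⊠ (conᶻ i ⊠ x ⊹ conᶻ j) ⊹ conᶻ b))
  × (∀ p → c ℤ.* w′ p ≡ w ((parity a ∧ ((parity i ∧ p) xor parity j)) xor parity b))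
  where
  x : Poly 1
  x = varᶻ zero

HasSum-change₁ : ∀ w r s A w′ r′ s′ c e I → Change₁ w r s A w′ r′ s′ c e I → ∀ {t} →
                 HasSum (θ-term w′ r′ s′) t → HasSum (λ x → θ-term w r s (aff₁ A x)) (tm c e *ˢ t)
HasSum-change₁ w r s (a , b) w′ r′ s′ c e (i , j) (e₁ , e₂ , e₃) S =
  HasSum-iso (aff₁ (i , j)) (aff₁ (i , j)) (λ x → identity e₁ (x ∷ [])) (λ x → identity e₁ (x ∷ [])) term (HasSum-scale (tm c e) S)
  where
  parity-aff₁ : ∀ a b x → parity (aff₁ (a , b) x) ≡ (parity a ∧ parity x) xor parity b
  parity-aff₁ a b x = trans (parity-+ (a ℤ.* x) b) (cong (_xor parity b) (parity-* a x))
  module _ (x : ℤ) where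
    y = aff₁ (a , b) (aff₁ (i , j) x)
    weights : c ℤ.* w′ (parity x) ≡ w (parity y)
    weights = trans (e₃ (parity x)) (cong w (sym (trans (parity-aff₁ a b _) (cong (λ p → (parity a ∧ p) xor parity b) (parity-aff₁ i j x)))))
    exponents : e ℕ.+ ex r′ s′ x ≡ ex r s y
    exponents = ℤP.+-injective (ℤP.*-cancelˡ-≡ (+ 2) _ _ (trans (trans (cong (ℤ._*_ (+ 2)) (ℤP.pos-+ e _))
      (trans (ℤP.*-distribˡ-+ (+ 2) (+ e) (+ ex r′ s′ x)) (cong (ℤ._+_ (+ 2 ℤ.* + e)) (2*ex r′ s′ x))))
      (trans (identity e₂ (x ∷ [])) (sym (2*ex r s y)))))
    term : tm c e *ˢ θ-term w′ r′ s′ x ≈ θ-term w r s y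
    term = ≈-trans (tm-* c e _ _) (subst₂ (λ v n → tm (c ℤ.* w′ (parity x)) (e ℕ.+ ex r′ s′ x) ≈ tm v n) weights exponents ≈-refl)

-- The reflection x ↦ -1 - x preserves the exponent 4 x(x+1)/2 and flips the parity of x, so the
-- series equals its negative.
F⁻₄₀≈0 : F⁻ 4 0 ≈ 0ˢ
F⁻₄₀≈0 = const-cancel (+ 2) (λ ()) (comb₂
  (solve 2 (λ f m → con (+ 2) :* f := con (+ 2) :* con (+ 0) :+ con (+ 1) :* (f :- m :* f) :+ f :* (m :- :- con (+ 1))) ≈-refl (F⁻ 4 0) (tm -[1+ 0 ] 0))
  odd-symmetry (≈-trans (tm-neg 0) (-‿cong q⁰≈1)))
  where
  odd-symmetry : F⁻ 4 0 ≈ tm -[1+ 0 ] 0 *ˢ F⁻ 4 0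
  odd-symmetry = HasSum-unique (θ-sum alternating 4 0) (HasSum-cong
    (λ x → subst (λ y → θ-term alternating 4 0 (+ 1 ℤ.* x ℤ.+ + 0) ≈ θ-term alternating 4 0 y) (lemma x) ≈-refl) ≈-refl
    (HasSum-change₁ alternating 4 0 (+ 1 , + 0) alternating 4 0 -[1+ 0 ] 0 (-[1+ 0 ] , -[1+ 0 ])
      (same refl , same refl , λ { false → refl ; true → refl }) (θ-sum alternating 4 0)))
    where
    lemma : ∀ x → + 1 ℤ.* x ℤ.+ + 0 ≡ x
    lemma = solve-∀

θ-halves : ∀ w r s .{{_ : NonZero (r ℕ.+ s)}} {S₀ S₁ : PS} →
           HasSum (λ x → θ-term w r s (aff₁ (+ 2 , + 0) x)) S₀ → HasSum (λ x → θ-term w r s (aff₁ (+ 2 , + 1) x)) S₁ →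
           θ w r s ≈ S₀ +ˢ S₁
θ-halves w r s {S₀} {S₁} H₀ H₁ = ≈-trans (HasSum-unique (θ-sum w r s)
  (HasSum-residues 2 {s = λ { zero → S₀ ; (suc zero) → S₁ }} (λ { zero → H₀ ; (suc zero) → H₁ }))) (+-cong ≈-refl (+-identityʳ S₁))

-- The same reflection exchanges even and odd x, so the two halves agree. In Ramanujan's notation
-- `F 6 2` is ψ(q²).
F₂₀≈2F₆₂ : F 2 0 ≈ const (+ 2) *ˢ F 6 2
F₂₀≈2F₆₂ = ≈-trans (θ-halves plain 2 0
    (HasSum-change₁ plain 2 0 (+ 2 , + 0) plain 6 2 (+ 1) 0 (+ 1 , + 0) (same refl , same refl , λ _ → refl) (θ-sum plain 6 2))
    (HasSum-change₁ plain 2 0 (+ 2 , + 1) plain 6 2 (+ 1) 0 (-[1+ 0 ] , -[1+ 0 ]) (same refl , same refl , λ _ → refl) (θ-sum plain 6 2)))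
  (comb₁ (solve 2 (λ o f → o :* f :+ o :* f := con (+ 2) :* f :+ con (+ 2) :* f :* (o :- con (+ 1))) ≈-refl (tm (+ 1) 0) (F 6 2)) q⁰≈1)

F⁻₁₁-halves : F⁻ 1 1 ≈ F 4 4 -ˢ q^ 1 *ˢ F 8 0
F⁻₁₁-halves = ≈-trans (θ-halves alternating 1 1
    (HasSum-change₁ alternating 1 1 (+ 2 , + 0) plain 4 4 (+ 1) 0 (+ 1 , + 0) (same refl , same refl , λ { false → refl ; true → refl }) (θ-sum plain 4 4))
    (HasSum-change₁ alternating 1 1 (+ 2 , + 1) plain 8 0 -[1+ 0 ] 1 (+ 1 , + 0) (same refl , same refl , λ { false → refl ; true → refl }) (θ-sum plain 8 0)))
  (comb₂ (solve 5 (λ o m q f g → o :* f :+ m :* g := f :- q :* g :+ f :* (o :- con (+ 1)) :+ g :* (m :- :- q)) ≈-refl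
     (tm (+ 1) 0) (tm -[1+ 0 ] 1) (q^ 1) (F 4 4) (F 8 0)) q⁰≈1 (tm-neg 1))

θ-dil : ∀ k .{{_ : NonZero k}} w r s r′ s′ .{{_ : NonZero (r ℕ.+ s)}} .{{_ : NonZero (r′ ℕ.+ s′)}} →
        k ℕ.* r ≡ r′ → k ℕ.* s ≡ s′ → dil k (θ w r s) ≈ θ w r′ s′
θ-dil k w r s r′ s′ refl refl = HasSum-unique (HasSum-cong term ≈-refl (HasSum-dil k (θ-sum w r s))) (θ-sum w (k ℕ.* r) (k ℕ.* s))
  where
  term : ∀ x → dil k (θ-term w r s x) ≈ θ-term w (k ℕ.* r) (k ℕ.* s) x
  term x = ≈-trans (dil-tm k _ (ex r s x)) (subst (λ e → tm (w (parity x)) (k ℕ.* ex r s x) ≈ tm (w (parity x)) e)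
    (trans (ℕP.*-distribˡ-+ k (r ℕ.* tri x) _) (sym (cong₂ ℕ._+_ (ℕP.*-assoc k r (tri x)) (ℕP.*-assoc k s (tri (ℤ.- x)))))) ≈-refl)

-- The Jacobi triple product

1ˢ : PS
1ˢ = const (+ 1)

tm-cong : ∀ w {e e′} → e ≡ e′ → tm w e ≈ tm w e′
tm-cong w refl = ≈-refl

prod : (ℕ → ℕ) → ℕ → PS
prod a zero    = 1ˢ
prod a (suc n) = (1ˢ -ˢ q^ (a n)) *ˢ prod a n

multiples : ℕ → ℕ → ℕ
multiples k i = k ℕ.* suc i

progression : ℕ → ℕ → ℕ → ℕ
progression r p i = r ℕ.+ p ℕ.* i

module Binomials (P : ℕ) where
  -- The Gaussian binomial coefficient of k + l over k in base q^P, by its Pascal rule. Indexing by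
  -- k and l avoids subtraction.
  G : ℕ → ℕ → PS
  G zero    l       = 1ˢ
  G (suc k) zero    = 1ˢ
  G (suc k) (suc l) = G k (suc l) +ˢ q^ (P ℕ.* suc k) *ˢ G (suc k) l

  poch : ℕ → PS
  poch = prod (multiples P)

  G-zeroʳ : ∀ k → G k 0 ≈ 1ˢ
  G-zeroʳ zero    = ≈-refl
  G-zeroʳ (suc k) = ≈-refl

  -- The quotient formula for Gaussian binomials, with the denominators multiplied out.
  G-poch : ∀ k l → G k l *ˢ (poch k *ˢ poch l) ≈ poch (k ℕ.+ l)
  G-poch zero    l       = solve 1 (λ x → con (+ 1) :* (con (+ 1) :* x) := x) ≈-refl (poch l)
  G-poch (suc k) zero    = subst (λ n → 1ˢ *ˢ (poch (suc k) *ˢ 1ˢ) ≈ poch n) (sym (ℕP.+-identityʳ (suc k)))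
    (solve 1 (λ x → con (+ 1) :* (x :* con (+ 1)) := x) ≈-refl (poch (suc k)))
  G-poch (suc k) (suc l) = ≈-trans
    (comb₂ (solve 7 (λ g h a b x y n → (g :+ x :* h) :* (((con (+ 1) :- x) :* a) :* ((con (+ 1) :- y) :* b)) :=
              (con (+ 1) :- x :* y) :* n :+ (con (+ 1) :- x) :* (g :* (a :* ((con (+ 1) :- y) :* b)) :- n)
                 :+ x :* (con (+ 1) :- y) :* (h :* (((con (+ 1) :- x) :* a) :* b) :- n)) ≈-refl
              (G k (suc l)) (G (suc k) l) (poch k) (poch l) (q^ (P ℕ.* suc k)) (q^ (P ℕ.* suc l)) (poch (suc k ℕ.+ l)))
           (subst (λ n → G k (suc l) *ˢ (poch k *ˢ poch (suc l)) ≈ poch n) (ℕP.+-suc k l) (G-poch k (suc l)))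
           (G-poch (suc k) l))
    (subst (λ n → (1ˢ -ˢ q^ (P ℕ.* suc k) *ˢ q^ (P ℕ.* suc l)) *ˢ poch (suc k ℕ.+ l) ≈ poch n) (cong suc (sym (ℕP.+-suc k l)))
      (*-cong (+-cong ≈-refl (-‿cong (≈-trans (q^-+ (P ℕ.* suc k) (P ℕ.* suc l)) (tm-cong (+ 1) (lemma P k l))))) ≈-refl))
    where
    lemma : ∀ P k l → P ℕ.* suc k ℕ.+ P ℕ.* suc l ≡ P ℕ.* suc (suc k ℕ.+ l)
    lemma = ℕSolver.solve-∀

  -- The sum of h k l over all k + l = n.
  sumAnti : (ℕ → ℕ → PS) → ℕ → PS
  sumAnti h zero    = h 0 0
  sumAnti h (suc n) = h 0 (suc n) +ˢ sumAnti (h ∘ suc) n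

  sumAnti-pascal : ∀ n (h A B : ℕ → ℕ → PS) → (∀ l → h 0 (suc l) ≈ A 0 l) → (∀ k → h (suc k) 0 ≈ B k 0) →
                   (∀ k l → h (suc k) (suc l) ≈ B k (suc l) +ˢ A (suc k) l) → sumAnti h (suc n) ≈ sumAnti A n +ˢ sumAnti B n
  sumAnti-pascal zero    h A B p q r = +-cong (p 0) (q 0)
  sumAnti-pascal (suc n) h A B p q r = ≈-trans
    (+-cong (p (suc n)) (sumAnti-pascal′ n (h ∘ suc) (A ∘ suc) B (λ l → r 0 l) (λ k → q (suc k)) (λ k l → r (suc k) l)))
    (solve 3 (λ a s b → a :+ (s :+ b) := a :+ s :+ b) ≈-refl (A 0 (suc n)) (sumAnti (A ∘ suc) n) (sumAnti B (suc n)))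
    where
    -- The same for the shifted rows, whose first entry also receives a contribution of B.
    sumAnti-pascal′ : ∀ n (h A B : ℕ → ℕ → PS) → (∀ l → h 0 (suc l) ≈ B 0 (suc l) +ˢ A 0 l) → (∀ k → h (suc k) 0 ≈ B (suc k) 0) →
                      (∀ k l → h (suc k) (suc l) ≈ B (suc k) (suc l) +ˢ A (suc k) l) →
                      sumAnti h (suc n) ≈ sumAnti A n +ˢ sumAnti B (suc n)
    sumAnti-pascal′ zero    h A B p q r = ≈-trans (+-cong (p 0) (q 0))
      (solve 3 (λ a b c → b :+ a :+ c := a :+ (b :+ c)) ≈-refl (A 0 0) (B 0 1) (B 1 0))
    sumAnti-pascal′ (suc n) h A B p q r = ≈-trans
      (+-cong (p (suc n)) (sumAnti-pascal′ n (h ∘ suc) (A ∘ suc) (B ∘ suc) (λ l → r 0 l) (λ k → q (suc k)) (λ k l → r (suc k) l)))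
      (solve 4 (λ a s b t → b :+ a :+ (s :+ t) := a :+ s :+ (b :+ t)) ≈-refl
        (A 0 (suc n)) (sumAnti (A ∘ suc) n) (B 0 (suc (suc n))) (sumAnti (B ∘ suc) (suc n)))

  sumAnti-scale : ∀ c h n → sumAnti (λ k l → c *ˢ h k l) n ≈ c *ˢ sumAnti h n
  sumAnti-scale c h zero    = ≈-refl
  sumAnti-scale c h (suc n) = ≈-trans (+-cong ≈-refl (sumAnti-scale c (h ∘ suc) n)) (≈-sym (distribˡ c _ _))

  sumAnti-cong : ∀ n {h g} → (∀ k l → k ℕ.+ l ≡ n → h k l ≈ g k l) → sumAnti h n ≈ sumAnti g n
  sumAnti-cong zero    p = p 0 0 refl
  sumAnti-cong (suc n) p = +-cong (p 0 (suc n) refl) (sumAnti-cong n (λ k l e → p (suc k) l (cong suc e)))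

  sumAnti-list : ∀ {X : Set} (F : X → PS) N n h (ι : ℕ → X) → (∀ k l → k ℕ.+ l ≡ n → h k l ≈[ N ] F (ι k)) →
                 sumAnti h n ≈[ N ] sumˢ F (applyUpTo ι (suc n))
  sumAnti-list F N zero    h ι p = ≈[]-trans (p 0 0 refl) (≈⇒≈[] (≈-sym (+-identityʳ _)))
  sumAnti-list F N (suc n) h ι p = +-cong[] (p 0 (suc n) refl) (sumAnti-list F N n (h ∘ suc) (ι ∘ suc) (λ k l e → p (suc k) l (cong suc e)))

  sign : ℕ → ℤ
  sign k = alternating (odd k)

  sign-suc : ∀ k → -[1+ 0 ] ℤ.* sign k ≡ sign (suc k)
  sign-suc k with odd k
  ... | false = refl
  ... | true  = refl

  t : ℕ → ℕ
  t zero    = 0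
  t (suc k) = t k ℕ.+ k

  2*t : ∀ k → + 2 ℤ.* + t k ≡ + k ℤ.* + k ℤ.- + k
  2*t zero    = refl
  2*t (suc k) = trans (lemma (+ t k) (+ k)) (trans (cong (λ z → z ℤ.+ + 2 ℤ.* + k) (2*t k)) (lemma′ (+ k)))
    where
    lemma : ∀ t k → + 2 ℤ.* (t ℤ.+ k) ≡ + 2 ℤ.* t ℤ.+ + 2 ℤ.* k
    lemma = solve-∀
    lemma′ : ∀ k → k ℤ.* k ℤ.- k ℤ.+ + 2 ℤ.* k ≡ (+ 1 ℤ.+ k) ℤ.* (+ 1 ℤ.+ k) ℤ.- (+ 1 ℤ.+ k)
    lemma′ = solve-∀

  -- The q-binomial theorem for ∏ (q ^ Y - q ^ (X + P i)).
  module Rothe (Y : ℕ) where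
    R : ℕ → ℕ → PS
    R zero    X = 1ˢ
    R (suc n) X = (q^ Y -ˢ q^ X) *ˢ R n (X ℕ.+ P)

    summand : ℕ → ℕ → ℕ → PS
    summand X k l = tm (sign k) (P ℕ.* t k ℕ.+ k ℕ.* X ℕ.+ l ℕ.* Y) *ˢ G k l

    rothe : ∀ n X → R n X ≈ sumAnti (summand X) n
    rothe zero    X = ≈-sym (≈-trans (*-identityʳ _) (≈-trans (tm-cong (+ 1) (lemma P)) (tm-zero (+ 1))))
      where
      lemma : ∀ P → P ℕ.* 0 ℕ.+ 0 ℕ.+ 0 ≡ 0
      lemma = ℕSolver.solve-∀
    rothe (suc n) X = ≈-trans (*-cong ≈-refl (rothe n (X ℕ.+ P)))
      (≈-trans (solve 3 (λ y x s → (y :- x) :* s := y :* s :+ (:- x) :* s) ≈-refl (q^ Y) (q^ X) (sumAnti (summand (X ℕ.+ P)) n))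
      (≈-trans (+-cong (≈-sym (sumAnti-scale (q^ Y) _ n)) (≈-sym (sumAnti-scale (-ˢ q^ X) _ n)))
        (≈-sym (sumAnti-pascal n (summand X) A B first last inner))))
      where
      A B : ℕ → ℕ → PS
      A k l = q^ Y *ˢ summand (X ℕ.+ P) k l
      B k l = (-ˢ q^ X) *ˢ summand (X ℕ.+ P) k l
      A-value : ∀ k l → A k l ≈ tm (sign k) (P ℕ.* t k ℕ.+ k ℕ.* X ℕ.+ suc l ℕ.* Y) *ˢ (q^ (P ℕ.* k) *ˢ G k l)
      A-value k l = ≈-trans (≈-sym (*-assoc _ _ _)) (≈-trans (*-cong (≈-trans (tm-* (+ 1) Y (sign k) _)
          (≈-trans (subst₂ (λ w e → tm (+ 1 ℤ.* sign k) (Y ℕ.+ (P ℕ.* t k ℕ.+ k ℕ.* (X ℕ.+ P) ℕ.+ l ℕ.* Y)) ≈ tm w e)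
             (ℤP.*-comm (+ 1) (sign k)) (lemma P (t k) k X l Y) ≈-refl) (≈-sym (tm-* (sign k) (P ℕ.* t k ℕ.+ k ℕ.* X ℕ.+ suc l ℕ.* Y) (+ 1) (P ℕ.* k))))) ≈-refl) (*-assoc _ _ _))
        where
        lemma : ∀ P t k X l Y → Y ℕ.+ (P ℕ.* t ℕ.+ k ℕ.* (X ℕ.+ P) ℕ.+ l ℕ.* Y) ≡ P ℕ.* t ℕ.+ k ℕ.* X ℕ.+ suc l ℕ.* Y ℕ.+ P ℕ.* k
        lemma = ℕSolver.solve-∀
      B-value : ∀ k l → B k l ≈ tm (sign (suc k)) (P ℕ.* t (suc k) ℕ.+ suc k ℕ.* X ℕ.+ l ℕ.* Y) *ˢ G k l
      B-value k l = ≈-trans (≈-sym (*-assoc _ _ _)) (*-cong (≈-trans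
          (*-cong (≈-trans (solve 1 (λ x → :- x := con -[1+ 0 ] :* x) ≈-refl (q^ X)) (tm-const -[1+ 0 ] (+ 1) X)) ≈-refl)
          (≈-trans (tm-* -[1+ 0 ] X (sign k) _)
            (subst₂ (λ w e → tm (-[1+ 0 ] ℤ.* sign k) (X ℕ.+ (P ℕ.* t k ℕ.+ k ℕ.* (X ℕ.+ P) ℕ.+ l ℕ.* Y)) ≈ tm w e)
              (sign-suc k) (lemma P (t k) k X (l ℕ.* Y)) ≈-refl))) ≈-refl)
        where
        lemma : ∀ P t k X Z → X ℕ.+ (P ℕ.* t ℕ.+ k ℕ.* (X ℕ.+ P) ℕ.+ Z) ≡ P ℕ.* (t ℕ.+ k) ℕ.+ suc k ℕ.* X ℕ.+ Z
        lemma = ℕSolver.solve-∀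
      first : ∀ l → summand X 0 (suc l) ≈ A 0 l
      first l = ≈-sym (≈-trans (A-value 0 l) (*-cong ≈-refl (≈-trans (*-cong (≈-trans (tm-cong (+ 1) (ℕP.*-zeroʳ P)) (tm-zero (+ 1))) ≈-refl) (*-identityˡ _))))
      last : ∀ k → summand X (suc k) 0 ≈ B k 0
      last k = ≈-sym (≈-trans (B-value k 0) (*-cong ≈-refl (G-zeroʳ k)))
      inner : ∀ k l → summand X (suc k) (suc l) ≈ B k (suc l) +ˢ A (suc k) l
      inner k l = ≈-trans (distribˡ _ _ _) (+-cong (≈-sym (B-value k (suc l))) (≈-sym (A-value (suc k) l)))

    R-snoc : ∀ n X → R (suc n) X ≈ R n X *ˢ (q^ Y -ˢ q^ (X ℕ.+ P ℕ.* n))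
    R-snoc zero    X = ≈-trans (*-comm _ _) (*-cong ≈-refl (+-cong ≈-refl (-‿cong (tm-cong (+ 1) (lemma X P)))))
      where
      lemma : ∀ X P → X ≡ X ℕ.+ P ℕ.* 0
      lemma = ℕSolver.solve-∀
    R-snoc (suc n) X = ≈-trans (*-cong ≈-refl (R-snoc n (X ℕ.+ P))) (≈-trans (≈-sym (*-assoc _ _ _))
      (*-cong ≈-refl (+-cong ≈-refl (-‿cong (tm-cong (+ 1) (lemma X P n))))))
      where
      lemma : ∀ X P n → X ℕ.+ P ℕ.+ P ℕ.* n ≡ X ℕ.+ P ℕ.* suc n
      lemma = ℕSolver.solve-∀

    R-+ : ∀ a b X → R (a ℕ.+ b) X ≈ R a X *ˢ R b (X ℕ.+ P ℕ.* a)
    R-+ zero    b X = ≈-sym (≈-trans (*-identityˡ _) (subst (λ x → R b (X ℕ.+ P ℕ.* 0) ≈ R b x) (lemma X P) ≈-refl))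
      where
      lemma : ∀ X P → X ℕ.+ P ℕ.* 0 ≡ X
      lemma = ℕSolver.solve-∀
    R-+ (suc a) b X = ≈-trans (*-cong ≈-refl (R-+ a b (X ℕ.+ P))) (≈-trans (≈-sym (*-assoc _ _ _))
      (*-cong ≈-refl (subst (λ x → R b (X ℕ.+ P ℕ.+ P ℕ.* a) ≈ R b x) (lemma X P a) ≈-refl)))
      where
      lemma : ∀ X P n → X ℕ.+ P ℕ.+ P ℕ.* n ≡ X ℕ.+ P ℕ.* suc n
      lemma = ℕSolver.solve-∀

    R-upper : ∀ n X → R n (Y ℕ.+ X) ≈ q^ (n ℕ.* Y) *ˢ prod (progression X P) n
    R-upper zero    X = ≈-sym (≈-trans (*-cong (tm-zero (+ 1)) ≈-refl) (*-identityˡ _))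
    R-upper (suc n) X = ≈-trans (R-snoc n (Y ℕ.+ X)) (≈-trans
      (*-cong (R-upper n X) (+-cong ≈-refl (-‿cong (≈-trans (tm-cong (+ 1) (ℕP.+-assoc Y X _)) (≈-sym (q^-+ Y (X ℕ.+ P ℕ.* n)))))))
      (≈-trans (solve 4 (λ a p y x → a :* p :* (y :- y :* x) := y :* a :* ((con (+ 1) :- x) :* p)) ≈-refl
                 (q^ (n ℕ.* Y)) (prod (progression X P) n) (q^ Y) (q^ (X ℕ.+ P ℕ.* n)))
               (*-cong (q^-+ Y (n ℕ.* Y)) ≈-refl)))

    -- By the hypothesis each factor q^Y - q^(X + P i) equals -q^(X + P i) (1 - q^(s + P (n - 1 -
    -- i))). So the low factors turn into the progression of s, in reversed order, times a signed
    -- monomial.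
    R-lower : ∀ n X s → Y ℕ.+ P ≡ X ℕ.+ s ℕ.+ P ℕ.* n → R n X ≈ tm (sign n) (n ℕ.* X ℕ.+ P ℕ.* t n) *ˢ prod (progression s P) n
    R-lower zero    X s e = ≈-sym (≈-trans (*-cong (≈-trans (tm-cong (+ 1) (ℕP.*-zeroʳ P)) (tm-zero (+ 1))) ≈-refl) (*-identityˡ _))
    R-lower (suc n) X s e = ≈-trans (*-cong (+-cong (≈-trans (tm-cong (+ 1) Y≡) (≈-sym (q^-+ X _))) ≈-refl) (R-lower n (X ℕ.+ P) s e′))
      (≈-trans (solve 4 (λ x z a p → (x :* z :- x) :* (a :* p) := (con -[1+ 0 ] :* x :* a) :* ((con (+ 1) :- z) :* p)) ≈-refl
                 (q^ X) (q^ (s ℕ.+ P ℕ.* n)) (tm (sign n) (n ℕ.* (X ℕ.+ P) ℕ.+ P ℕ.* t n)) (prod (progression s P) n))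
        (*-cong (≈-trans (*-cong (tm-const -[1+ 0 ] (+ 1) X) ≈-refl) (≈-trans (tm-* -[1+ 0 ] X (sign n) _)
          (subst₂ (λ w e → tm (-[1+ 0 ] ℤ.* sign n) (X ℕ.+ (n ℕ.* (X ℕ.+ P) ℕ.+ P ℕ.* t n)) ≈ tm w e) (sign-suc n) (lemma X n P (t n)) ≈-refl))) ≈-refl))
      where
      Y≡ : Y ≡ X ℕ.+ (s ℕ.+ P ℕ.* n)
      Y≡ = ℕP.+-cancelʳ-≡ P Y _ (trans e (lemma₁ X s P n))
        where
        lemma₁ : ∀ X s P n → X ℕ.+ s ℕ.+ P ℕ.* suc n ≡ X ℕ.+ (s ℕ.+ P ℕ.* n) ℕ.+ P
        lemma₁ = ℕSolver.solve-∀
      e′ : Y ℕ.+ P ≡ X ℕ.+ P ℕ.+ s ℕ.+ P ℕ.* n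
      e′ = trans e (lemma₂ X s P n)
        where
        lemma₂ : ∀ X s P n → X ℕ.+ s ℕ.+ P ℕ.* suc n ≡ X ℕ.+ P ℕ.+ s ℕ.+ P ℕ.* n
        lemma₂ = ℕSolver.solve-∀
      lemma : ∀ X n P t → X ℕ.+ (n ℕ.* (X ℕ.+ P) ℕ.+ P ℕ.* t) ≡ suc n ℕ.* X ℕ.+ P ℕ.* (t ℕ.+ n)
      lemma = ℕSolver.solve-∀

opaque
  -- The infinite product of 1 - q^(k i) over i ≥ 1, that is, q^(-k/24) η(k z). Its n-th coefficient
  -- is read off after n factors.
  E : ℕ → PS
  E k n = prod (multiples k) n n

  prod-stable : ∀ (a : ℕ → ℕ) N m d → (∀ i → m ≤ i → N < a i) → prod a (d ℕ.+ m) ≈[ N ] prod a m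
  prod-stable a N m zero    h = ≈⇒≈[] ≈-refl
  prod-stable a N m (suc d) h = ≈[]-trans (*-cong[] factor (prod-stable a N m d h)) (≈⇒≈[] (*-identityˡ _))
    where
    factor : 1ˢ -ˢ q^ (a (d ℕ.+ m)) ≈[ N ] 1ˢ
    factor = coeffs≤ λ i i≤N → trans (+ˢ-coeff 1ˢ _ i) (trans (cong (ℤ._+_ (1ˢ i)) (trans (-ˢ-coeff (q^ (a (d ℕ.+ m))) i)
      (cong ℤ.-_ (tm-off (+ 1) (a (d ℕ.+ m)) i (ℕP.<⇒≢ (ℕP.≤-<-trans i≤N (h (d ℕ.+ m) (ℕP.m≤n+m m d)))))))) (ℤP.+-identityʳ _))

  multiples-large : ∀ k .{{_ : NonZero k}} i m → m ≤ i → m < multiples k i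
  multiples-large k i m m≤i = ℕP.≤-trans (s≤s m≤i) (ℕP.m≤n*m (suc i) k)

  E-prod : ∀ k .{{_ : NonZero k}} N m → N ≤ m → E k ≈[ N ] prod (multiples k) m
  E-prod k N m N≤m = coeffs≤ λ i i≤N → let i≤m = ℕP.≤-trans i≤N N≤m in
    sym (coeff≤ (subst (λ n → prod (multiples k) n ≈[ i ] prod (multiples k) i) (ℕP.m∸n+n≡m i≤m)
      (prod-stable (multiples k) i i (m ℕ.∸ i) (λ j i≤j → multiples-large k j i i≤j))) i ℕP.≤-refl)

E-zero : ∀ k .{{_ : NonZero k}} → E k 0 ≡ + 1
E-zero k = trans (coeff≤ (E-prod k 0 0 z≤n) 0 z≤n) (const-zero (+ 1))

unit-cancel[] : ∀ f {g h} n → f 0 ≡ + 1 → f *ˢ g ≈[ n ] f *ˢ h → g ≈[ n ] h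
unit-cancel[] f {g} {h} n f0 eq = coeffs≤ λ i i≤n → ℤP.i-j≡0⇒i≡j (g i) (h i) (trans (sym (difference g h i)) (go i i≤n (<-wellFounded i)))
  where
  difference : ∀ g h i → (g -ˢ h) i ≡ g i ℤ.- h i
  difference g h i = trans (+ˢ-coeff g (-ˢ h) i) (cong (ℤ._+_ (g i)) (-ˢ-coeff h i))
  go : ∀ i → i ≤ n → Acc _<_ i → (g -ˢ h) i ≡ + 0
  go i i≤n (acc rec) = trans (sym (ℤP.*-identityˡ _)) (trans (cong (ℤ._* (g -ˢ h) i) (sym f0))
    (trans (sym (*ˢ-leading 0 i f (g -ˢ h) (λ _ ()) (λ j j<i → go j (ℕP.≤-trans (ℕP.<⇒≤ j<i) i≤n) (rec j<i))))
    (trans (coeff (solve 3 (λ f g h → f :* (g :- h) := f :* g :- f :* h) ≈-refl f g h) i)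
    (trans (difference (f *ˢ g) (f *ˢ h) i) (ℤP.i≡j⇒i-j≡0 (coeff≤ eq i i≤n))))))

module _ (r s : ℕ) .{{_ : NonZero (r ℕ.+ s)}} (N : ℕ) where
  private
    P m Y : ℕ
    P = r ℕ.+ s
    m = suc N
    -- With this shift `R (m ℕ.+ m) r` is the product of 1 - q^(r + P i) over -m ≤ i < m, cleared of
    -- negative exponents. The factors with i ≥ 0 give the progression of r, those with i < 0 that
    -- of s = P - r.
    Y = P ℕ.* m
  open Binomials P
  open Rothe Y

  -- Modulo a high power of q, the central q-binomial coefficients are 1 / E P.
  G*E : ∀ k l n → n ≤ k → n ≤ l → G k l *ˢ E P ≈[ n ] 1ˢ
  G*E k l n n≤k n≤l = unit-cancel[] (E P) n (E-zero P) (≈[]-trans (≈⇒≈[] (solve 2 (λ e g → e :* (g :* e) := g :* (e :* e)) ≈-refl (E P) (G k l)))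
    (≈[]-trans (*-cong[] (≈⇒≈[] ≈-refl) (*-cong[] (E-prod P n k n≤k) (E-prod P n l n≤l)))
    (≈[]-trans (≈⇒≈[] (G-poch k l)) (≈[]-trans (≈[]-sym (E-prod P n (k ℕ.+ l) (ℕP.≤-trans n≤k (ℕP.m≤m+n k l)))) (≈⇒≈[] (≈-sym (*-identityʳ _)))))))

  -- The exponent of the monomial that splits off from both sides of Rothe's identity and is then
  -- cancelled.
  M : ℕ
  M = m ℕ.* r ℕ.+ P ℕ.* t m ℕ.+ m ℕ.* Y

  product-side : R (m ℕ.+ m) r ≈ tm (sign m) M *ˢ (prod (progression r P) m *ˢ prod (progression s P) m)
  product-side = ≈-trans (R-+ m m r) (≈-trans
    (*-cong (R-lower m r s (lemma P m)) (≈-trans (subst (λ x → R m x ≈ R m (Y ℕ.+ r)) (ℕP.+-comm Y r) ≈-refl) (R-upper m r)))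
    (≈-trans (solve 4 (λ a u b v → a :* u :* (b :* v) := a :* b :* (v :* u)) ≈-refl
       (tm (sign m) (m ℕ.* r ℕ.+ P ℕ.* t m)) (prod (progression s P) m) (q^ (m ℕ.* Y)) (prod (progression r P) m))
     (*-cong (≈-trans (tm-* (sign m) (m ℕ.* r ℕ.+ P ℕ.* t m) (+ 1) (m ℕ.* Y))
        (subst (λ w → tm (sign m ℤ.* + 1) M ≈ tm w M) (ℤP.*-identityʳ (sign m)) ≈-refl)) ≈-refl)))
    where
    lemma : ∀ P m → P ℕ.* m ℕ.+ P ≡ P ℕ.+ P ℕ.* m
    lemma = ℕSolver.solve-∀

  central : ℕ → ℤ
  central k = k ℤ.⊖ m

  -- Recentring the index at m completes the square in the exponent. The identity is checked doubled
  -- and in ℤ, where l = 2 m - k may be substituted.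
  summand-central : ∀ k l → k ℕ.+ l ≡ m ℕ.+ m → summand r k l ≈ tm (sign m) M *ˢ (θ-term alternating r s (central k) *ˢ G k l)
  summand-central k l e = ≈-trans (*-cong (≈-trans
      (subst₂ (λ w n → tm (sign k) (P ℕ.* t k ℕ.+ k ℕ.* r ℕ.+ l ℕ.* Y) ≈ tm w n) signs exponents ≈-refl)
      (≈-sym (tm-* (sign m) M (alternating (parity (central k))) (ex r s (central k))))) ≈-refl) (*-assoc _ _ _)
    where
    signs : sign k ≡ sign m ℤ.* alternating (parity (central k))
    signs = trans (lemma (odd k) (odd m)) (cong (λ b → sign m ℤ.* alternating b) (sym (odd-⊖ k m)))
      where
      lemma : ∀ a b → alternating a ≡ alternating b ℤ.* alternating (a xor b)
      lemma false false = refl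
      lemma false true  = refl
      lemma true  false = refl
      lemma true  true  = refl
    l≡ : + l ≡ + m ℤ.+ + m ℤ.- + k
    l≡ = trans (lemma (+ k) (+ l)) (cong (ℤ._- + k) (trans (sym (ℤP.pos-+ k l)) (trans (cong +_ e) (ℤP.pos-+ m m))))
      where
      lemma : ∀ k l → l ≡ k ℤ.+ l ℤ.- k
      lemma = solve-∀
    lhs : + 2 ℤ.* + (P ℕ.* t k ℕ.+ k ℕ.* r ℕ.+ l ℕ.* Y) ≡
          (+ r ℤ.+ + s) ℤ.* (+ k ℤ.* + k ℤ.- + k) ℤ.+ + 2 ℤ.* (+ k ℤ.* + r) ℤ.+ + 2 ℤ.* ((+ m ℤ.+ + m ℤ.- + k) ℤ.* ((+ r ℤ.+ + s) ℤ.* + m))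
    lhs = trans (cong (ℤ._*_ (+ 2)) (trans (ℤP.pos-+ (P ℕ.* t k ℕ.+ k ℕ.* r) (l ℕ.* Y)) (cong₂ ℤ._+_
            (trans (ℤP.pos-+ (P ℕ.* t k) (k ℕ.* r)) (cong₂ ℤ._+_ (trans (ℤP.pos-* P (t k)) (cong (ℤ._* + t k) (ℤP.pos-+ r s))) (ℤP.pos-* k r)))
            (trans (ℤP.pos-* l Y) (cong₂ ℤ._*_ l≡ (trans (ℤP.pos-* P m) (cong (ℤ._* + m) (ℤP.pos-+ r s))))))))
          (trans (lemma (+ r ℤ.+ + s) (+ t k) (+ k ℤ.* + r) ((+ m ℤ.+ + m ℤ.- + k) ℤ.* ((+ r ℤ.+ + s) ℤ.* + m)))
            (cong (λ z → (+ r ℤ.+ + s) ℤ.* z ℤ.+ + 2 ℤ.* (+ k ℤ.* + r) ℤ.+ + 2 ℤ.* ((+ m ℤ.+ + m ℤ.- + k) ℤ.* ((+ r ℤ.+ + s) ℤ.* + m))) (2*t k)))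
      where
      lemma : ∀ p t a b → + 2 ℤ.* (p ℤ.* t ℤ.+ a ℤ.+ b) ≡ p ℤ.* (+ 2 ℤ.* t) ℤ.+ + 2 ℤ.* a ℤ.+ + 2 ℤ.* b
      lemma = solve-∀
    rhs : + 2 ℤ.* + (M ℕ.+ ex r s (central k)) ≡
          + 2 ℤ.* (+ m ℤ.* + r) ℤ.+ (+ r ℤ.+ + s) ℤ.* (+ m ℤ.* + m ℤ.- + m) ℤ.+ + 2 ℤ.* (+ m ℤ.* ((+ r ℤ.+ + s) ℤ.* + m))
            ℤ.+ 2ex r s (+ k ℤ.- + m)
    rhs = trans (cong (ℤ._*_ (+ 2)) (trans (ℤP.pos-+ M (ex r s (central k))) (cong (ℤ._+ + ex r s (central k))
            (trans (ℤP.pos-+ (m ℕ.* r ℕ.+ P ℕ.* t m) (m ℕ.* Y)) (cong₂ ℤ._+_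
              (trans (ℤP.pos-+ (m ℕ.* r) (P ℕ.* t m)) (cong₂ ℤ._+_ (ℤP.pos-* m r) (trans (ℤP.pos-* P (t m)) (cong (ℤ._* + t m) (ℤP.pos-+ r s)))))
              (trans (ℤP.pos-* m Y) (cong (ℤ._*_ (+ m)) (trans (ℤP.pos-* P m) (cong (ℤ._* + m) (ℤP.pos-+ r s))))))))))
          (trans (lemma (+ m ℤ.* + r) (+ r ℤ.+ + s) (+ t m) (+ m ℤ.* ((+ r ℤ.+ + s) ℤ.* + m)) (+ ex r s (central k)))
            (cong₂ (λ z w → + 2 ℤ.* (+ m ℤ.* + r) ℤ.+ (+ r ℤ.+ + s) ℤ.* z ℤ.+ + 2 ℤ.* (+ m ℤ.* ((+ r ℤ.+ + s) ℤ.* + m)) ℤ.+ w)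
              (2*t m) (trans (2*ex r s (central k)) (cong (2ex r s) (sym (ℤP.m-n≡m⊖n k m))))))
      where
      lemma : ∀ a p t b e → + 2 ℤ.* (a ℤ.+ p ℤ.* t ℤ.+ b ℤ.+ e) ≡ + 2 ℤ.* a ℤ.+ p ℤ.* (+ 2 ℤ.* t) ℤ.+ + 2 ℤ.* b ℤ.+ + 2 ℤ.* e
      lemma = solve-∀
    exponents : P ℕ.* t k ℕ.+ k ℕ.* r ℕ.+ l ℕ.* Y ≡ M ℕ.+ ex r s (central k)
    exponents = ℤP.+-injective (ℤP.*-cancelˡ-≡ (+ 2) _ _ (trans lhs (trans (lemma (+ r) (+ s) (+ k) (+ m)) (sym rhs))))
      where
      lemma : ∀ r s k m → (r ℤ.+ s) ℤ.* (k ℤ.* k ℤ.- k) ℤ.+ + 2 ℤ.* (k ℤ.* r) ℤ.+ + 2 ℤ.* ((m ℤ.+ m ℤ.- k) ℤ.* ((r ℤ.+ s) ℤ.* m)) ≡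
              + 2 ℤ.* (m ℤ.* r) ℤ.+ (r ℤ.+ s) ℤ.* (m ℤ.* m ℤ.- m) ℤ.+ + 2 ℤ.* (m ℤ.* ((r ℤ.+ s) ℤ.* m))
                ℤ.+ (r ℤ.* ((k ℤ.- m) ℤ.* (k ℤ.- m) ℤ.+ (k ℤ.- m)) ℤ.+ s ℤ.* ((k ℤ.- m) ℤ.* (k ℤ.- m) ℤ.- (k ℤ.- m)))
      lemma = solve-∀

  finite-triple-product : prod (progression r P) m *ˢ prod (progression s P) m ≈
                          sumAnti (λ k l → θ-term alternating r s (central k) *ˢ G k l) (m ℕ.+ m)
  finite-triple-product = *ˢ-cancelˡ M (tm (sign m) M) (λ i i<M → tm-off (sign m) M i (ℕP.<⇒≢ i<M))
    (λ e → sign≢0 (odd m) (trans (sym (tm-diag (sign m) M)) e))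
    (≈-trans (≈-sym product-side) (≈-trans (rothe (m ℕ.+ m) r) (≈-trans (sumAnti-cong (m ℕ.+ m) summand-central)
      (sumAnti-scale (tm (sign m) M) (λ k l → θ-term alternating r s (central k) *ˢ G k l) (m ℕ.+ m)))))
    where
    sign≢0 : ∀ b → alternating b ≢ + 0
    sign≢0 false ()
    sign≢0 true  ()

  central-cases : ∀ k l → k ℕ.+ l ≡ m ℕ.+ m → (k ≤ l × ℤ.∣ central k ∣ ℕ.+ k ≡ m) ⊎ (l ≤ k × ℤ.∣ central k ∣ ℕ.+ l ≡ m)
  central-cases k l e with ℕP.≤-total k m
  ... | inj₁ k≤m = inj₁ (ℕP.≤-trans k≤m (ℕP.+-cancelˡ-≤ k m l (ℕP.≤-trans (ℕP.+-monoˡ-≤ m k≤m) (ℕP.≤-reflexive (sym e)))) ,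
                         trans (cong (ℕ._+ k) (trans (cong ℤ.∣_∣ (ℤP.⊖-≤ k≤m)) (ℤP.∣-i∣≡∣i∣ (+ (m ℕ.∸ k))))) (ℕP.m∸n+n≡m k≤m))
  ... | inj₂ m≤k = inj₂ (ℕP.≤-trans l≤m m≤k , ℕP.+-cancelˡ-≡ m _ _ (trans (trans (sym (ℕP.+-assoc m _ l))
                         (cong (ℕ._+ l) (trans (cong (m ℕ.+_) (cong ℤ.∣_∣ (ℤP.⊖-≥ m≤k))) (ℕP.m+[n∸m]≡n m≤k)))) e))
    where
    l≤m : l ≤ m
    l≤m = ℕP.+-cancelˡ-≤ m l m (ℕP.≤-trans (ℕP.+-monoˡ-≤ l m≤k) (ℕP.≤-reflexive e))

  -- The binomial is close to 1 / E P only up to degree min(k, l), which is poor near the ends of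
  -- the range; but there the theta term itself has large degree.
  term-limit : ∀ k l → k ℕ.+ l ≡ m ℕ.+ m → E P *ˢ (θ-term alternating r s (central k) *ˢ G k l) ≈[ N ] θ-term alternating r s (central k)
  term-limit k l e = ≈[]-trans (≈⇒≈[] (solve 3 (λ e t g → e :* (t :* g) := t :* (g :* e)) ≈-refl (E P) _ (G k l)))
    (≈[]-trans (tm-*-cong[] _ (ex r s (central k)) N (λ i h → coeff≤ (G*E k l i (bound₁ i h) (bound₂ i h)) i ℕP.≤-refl)) (≈⇒≈[] (*-identityʳ _)))
    where
    -- ex (central k) + i ≤ N < m, while ∣ central k ∣ ≤ 1 + ex (central k).
    room : ∀ i n → ex r s (central k) ℕ.+ i ≤ N → ℤ.∣ central k ∣ ℕ.+ n ≡ m → i ≤ n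
    room i n h eq = ℕP.+-cancelˡ-≤ ℤ.∣ central k ∣ i n (ℕP.≤-trans (ℕP.+-monoˡ-≤ i (∣x∣≤1+ex r s (central k)))
      (ℕP.≤-trans (s≤s h) (ℕP.≤-reflexive (sym eq))))
    bound₁ : ∀ i → ex r s (central k) ℕ.+ i ≤ N → i ≤ k
    bound₁ i h with central-cases k l e
    ... | inj₁ (k≤l , eq) = room i k h eq
    ... | inj₂ (l≤k , eq) = ℕP.≤-trans (room i l h eq) l≤k
    bound₂ : ∀ i → ex r s (central k) ℕ.+ i ≤ N → i ≤ l
    bound₂ i h with central-cases k l e
    ... | inj₁ (k≤l , eq) = ℕP.≤-trans (room i k h eq) k≤l
    ... | inj₂ (l≤k , eq) = room i l h eq

  central-injective : ∀ i j → central i ≡ central j → i ≡ j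
  central-injective i j e = ℤP.+-injective (ℤ-+-cancelˡ (ℤ.- + m) (+ i) (+ j) (trans (swap i) (trans e (sym (swap j)))))
    where
    swap : ∀ i → ℤ.- + m ℤ.+ + i ≡ central i
    swap i = trans (ℤP.+-comm (ℤ.- + m) (+ i)) (ℤP.m-n≡m⊖n i m)

  window : List ℤ
  window = applyUpTo central (suc (m ℕ.+ m))

  ∈-window : ∀ x → ℤ.∣ x ∣ ≤ m → x ∈ window
  ∈-window (+ a) h = subst (_∈ window) (trans (ℤP.⊖-≥ (ℕP.m≤m+n m a)) (cong +_ (ℕP.m+n∸m≡n m a)))
    (MemP.∈-applyUpTo⁺ central (s≤s (ℕP.+-monoʳ-≤ m h)))
  ∈-window -[1+ a ] h = subst (_∈ window) (trans (ℤP.⊖-≤ (ℕP.m∸n≤m m (suc a))) (cong (λ z → ℤ.- + z) (ℕP.m∸[m∸n]≡n h)))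
    (MemP.∈-applyUpTo⁺ central (s≤s (ℕP.≤-trans (ℕP.m∸n≤m m (suc a)) (ℕP.m≤m+n m m))))

  window-sum : F⁻ r s ≈[ N ] sumˢ (θ-term alternating r s) window
  window-sum = coeffs≤ λ i i≤N → trans (coeff≤ (sums S N) i i≤N) (trans (sumˢ-coeff _ (support S N) i)
    (trans (sumOver-unique (λ x → θ-term alternating r s x i) (unique S N)
              (UniqueP.applyUpTo⁺₁ central (suc (m ℕ.+ m)) (λ i<j _ e → ℕP.<⇒≢ i<j (central-injective _ _ e)))
              (λ x → covers S N x i i≤N) (cover i i≤N))
    (sym (sumˢ-coeff _ window i))))
    where
    S = θ-sum alternating r s
    cover : ∀ i → i ≤ N → ∀ x → θ-term alternating r s x i ≢ + 0 → x ∈ window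
    cover i i≤N x nz with i ℕ.≟ ex r s x
    ... | yes refl = ∈-window x (ℕP.≤-trans (∣x∣≤1+ex r s x) (s≤s i≤N))
    ... | no  i≢e  = contradiction (tm-off _ (ex r s x) i i≢e) nz

  triple-product : F⁻ r s ≈[ N ] E P *ˢ (prod (progression r P) m *ˢ prod (progression s P) m)
  triple-product = ≈[]-sym (≈[]-trans (≈⇒≈[] (≈-trans (*-cong ≈-refl finite-triple-product)
      (≈-sym (sumAnti-scale (E P) (λ k l → θ-term alternating r s (central k) *ˢ G k l) (m ℕ.+ m)))))
    (≈[]-trans (sumAnti-list (θ-term alternating r s) N (m ℕ.+ m) _ central term-limit) (≈[]-sym window-sum)))

-- Theta series as eta products

factor-cong : ∀ {a b} → a ≡ b → 1ˢ -ˢ q^ a ≈ 1ˢ -ˢ q^ b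
factor-cong refl = ≈-refl

-- Here and in the next three lemmas the factors of an eta product are sorted by the residue class
-- of their index, which makes the progressions of the triple product visible.
interleave₂ : ∀ m → prod (multiples 1) (m ℕ.* 2) ≈ prod (progression 1 2) m *ˢ prod (multiples 2) m
interleave₂ zero    = ≈-sym (*-identityˡ _)
interleave₂ (suc m) = ≈-trans
  (*-cong (factor-cong (l₂ m)) (*-cong (factor-cong (l₁ m)) (interleave₂ m)))
  (solve 4 (λ x y p r → y :* (x :* (p :* r)) := x :* p :* (y :* r)) ≈-refl _ _ (prod (progression 1 2) m) (prod (multiples 2) m))
  where
  l₁ : ∀ m → 1 ℕ.* suc (m ℕ.* 2) ≡ 1 ℕ.+ 2 ℕ.* m
  l₁ = ℕSolver.solve-∀
  l₂ : ∀ m → 1 ℕ.* suc (suc (m ℕ.* 2)) ≡ 2 ℕ.* suc m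
  l₂ = ℕSolver.solve-∀

interleave₃ : ∀ m → prod (multiples 2) (m ℕ.* 3) ≈ prod (progression 2 6) m *ˢ prod (progression 4 6) m *ˢ prod (multiples 6) m
interleave₃ zero    = solve 0 (con (+ 1) := con (+ 1) :* con (+ 1) :* con (+ 1)) ≈-refl
interleave₃ (suc m) = ≈-trans
  (*-cong (factor-cong (l₃ m)) (*-cong (factor-cong (l₂ m)) (*-cong (factor-cong (l₁ m)) (interleave₃ m))))
  (solve 6 (λ x y z p r s → z :* (y :* (x :* (p :* r :* s))) := x :* p :* (y :* r) :* (z :* s)) ≈-refl
     _ _ _ (prod (progression 2 6) m) (prod (progression 4 6) m) (prod (multiples 6) m))
  where
  l₁ : ∀ m → 2 ℕ.* suc (m ℕ.* 3) ≡ 2 ℕ.+ 6 ℕ.* m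
  l₁ = ℕSolver.solve-∀
  l₂ : ∀ m → 2 ℕ.* suc (suc (m ℕ.* 3)) ≡ 4 ℕ.+ 6 ℕ.* m
  l₂ = ℕSolver.solve-∀
  l₃ : ∀ m → 2 ℕ.* suc (suc (suc (m ℕ.* 3))) ≡ 6 ℕ.* suc m
  l₃ = ℕSolver.solve-∀

interleave₄ : ∀ m → prod (multiples 1) (m ℕ.* 4) ≈ prod (progression 1 4) m *ˢ prod (progression 3 4) m *ˢ prod (multiples 2) (m ℕ.* 2)
interleave₄ zero    = solve 0 (con (+ 1) := con (+ 1) :* con (+ 1) :* con (+ 1)) ≈-refl
interleave₄ (suc m) = ≈-trans
  (*-cong (factor-cong (l₄ m)) (*-cong (factor-cong (l₃ m)) (*-cong (factor-cong (l₂ m)) (*-cong (factor-cong (l₁ m)) (interleave₄ m)))))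
  (solve 7 (λ x y z w p r s → w :* (z :* (y :* (x :* (p :* r :* s)))) := x :* p :* (z :* r) :* (w :* (y :* s))) ≈-refl
     _ _ _ _ (prod (progression 1 4) m) (prod (progression 3 4) m) (prod (multiples 2) (m ℕ.* 2)))
  where
  l₁ : ∀ m → 1 ℕ.* suc (m ℕ.* 4) ≡ 1 ℕ.+ 4 ℕ.* m
  l₁ = ℕSolver.solve-∀
  l₂ : ∀ m → 1 ℕ.* suc (suc (m ℕ.* 4)) ≡ 2 ℕ.* suc (m ℕ.* 2)
  l₂ = ℕSolver.solve-∀
  l₃ : ∀ m → 1 ℕ.* suc (suc (suc (m ℕ.* 4))) ≡ 3 ℕ.+ 4 ℕ.* m
  l₃ = ℕSolver.solve-∀
  l₄ : ∀ m → 1 ℕ.* suc (suc (suc (suc (m ℕ.* 4)))) ≡ 2 ℕ.* suc (suc (m ℕ.* 2))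
  l₄ = ℕSolver.solve-∀

interleave₅ : ∀ m → prod (multiples 2) (m ℕ.* 5) ≈
  prod (progression 2 10) m *ˢ prod (progression 4 10) m *ˢ prod (progression 6 10) m *ˢ prod (progression 8 10) m *ˢ prod (multiples 10) m
interleave₅ zero    = solve 0 (con (+ 1) := con (+ 1) :* con (+ 1) :* con (+ 1) :* con (+ 1) :* con (+ 1)) ≈-refl
interleave₅ (suc m) = ≈-trans
  (*-cong (factor-cong (l₅ m)) (*-cong (factor-cong (l₄ m)) (*-cong (factor-cong (l₃ m)) (*-cong (factor-cong (l₂ m)) (*-cong (factor-cong (l₁ m)) (interleave₅ m))))))
  (solve 10 (λ x y z w v p r s t u → v :* (w :* (z :* (y :* (x :* (p :* r :* s :* t :* u))))) := x :* p :* (y :* r) :* (z :* s) :* (w :* t) :* (v :* u)) ≈-refl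
     _ _ _ _ _ (prod (progression 2 10) m) (prod (progression 4 10) m) (prod (progression 6 10) m) (prod (progression 8 10) m) (prod (multiples 10) m))
  where
  l₁ : ∀ m → 2 ℕ.* suc (m ℕ.* 5) ≡ 2 ℕ.+ 10 ℕ.* m
  l₁ = ℕSolver.solve-∀
  l₂ : ∀ m → 2 ℕ.* suc (suc (m ℕ.* 5)) ≡ 4 ℕ.+ 10 ℕ.* m
  l₂ = ℕSolver.solve-∀
  l₃ : ∀ m → 2 ℕ.* suc (suc (suc (m ℕ.* 5))) ≡ 6 ℕ.+ 10 ℕ.* m
  l₃ = ℕSolver.solve-∀
  l₄ : ∀ m → 2 ℕ.* suc (suc (suc (suc (m ℕ.* 5)))) ≡ 8 ℕ.+ 10 ℕ.* m
  l₄ = ℕSolver.solve-∀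
  l₅ : ∀ m → 2 ℕ.* suc (suc (suc (suc (suc (m ℕ.* 5))))) ≡ 10 ℕ.* suc m
  l₅ = ℕSolver.solve-∀

N≤sN*k : ∀ N k .{{_ : NonZero k}} → N ≤ suc N ℕ.* k
N≤sN*k N k = ℕP.≤-trans (ℕP.n≤1+n N) (ℕP.m≤m*n (suc N) k)

-- Euler's pentagonal number theorem in q²: the residues 2, 4, 0 modulo 6 exhaust the even numbers.
F⁻₂₄≈E₂ : F⁻ 2 4 ≈ E 2
F⁻₂₄≈E₂ = ≈[]⇒≈ λ N → let m = suc N in
  ≈[]-trans (triple-product 2 4 N) (≈[]-trans (*-cong[] (E-prod 6 N m (ℕP.n≤1+n N)) (≈⇒≈[] ≈-refl))
  (≈[]-trans (≈⇒≈[] (≈-trans (*-comm _ _) (≈-sym (interleave₃ m)))) (≈[]-sym (E-prod 2 N (m ℕ.* 3) (N≤sN*k N 3)))))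

-- The progressions of 2, 4, 6, 8 modulo 10 and one of the two factors `E 10` make up `E 2`; the
-- other `E 10` remains.
F⁻₆₄*F⁻₈₂≈E₂*E₁₀ : F⁻ 6 4 *ˢ F⁻ 8 2 ≈ E 2 *ˢ E 10
F⁻₆₄*F⁻₈₂≈E₂*E₁₀ = ≈[]⇒≈ λ N → let m = suc N in
  ≈[]-trans (*-cong[] (triple-product 6 4 N) (triple-product 8 2 N))
  (≈[]-trans (*-cong[] (*-cong[] (E-prod 10 N m (ℕP.n≤1+n N)) (≈⇒≈[] ≈-refl)) (≈⇒≈[] ≈-refl))
  (≈[]-trans (≈⇒≈[] (≈-trans (solve 6 (λ e u a b c d → u :* (c :* b) :* (e :* (d :* a)) := a :* b :* c :* d :* u :* e) ≈-refl
      (E 10) (prod (multiples 10) m) (prod (progression 2 10) m) (prod (progression 4 10) m) (prod (progression 6 10) m) (prod (progression 8 10) m))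
    (*-cong (≈-sym (interleave₅ m)) ≈-refl))) (*-cong[] (≈[]-sym (E-prod 2 N (m ℕ.* 5) (N≤sN*k N 5))) (≈⇒≈[] ≈-refl))))

F⁻₁₁*E₂ : F⁻ 1 1 *ˢ E 2 ≈ E 1 *ˢ E 1
F⁻₁₁*E₂ = ≈[]⇒≈ λ N →
  let m  = suc N
      e₂ = E-prod 2 N m (ℕP.n≤1+n N)
      e₁ = ≈[]-trans (≈⇒≈[] (≈-sym (interleave₂ m))) (≈[]-sym (E-prod 1 N (m ℕ.* 2) (N≤sN*k N 2)))
  in
  ≈[]-trans (*-cong[] (≈[]-trans (triple-product 1 1 N) (*-cong[] e₂ (≈⇒≈[] ≈-refl))) e₂)
  (≈[]-trans (≈⇒≈[] (solve 2 (λ u a → u :* (a :* a) :* u := a :* u :* (a :* u)) ≈-refl (prod (multiples 2) m) (prod (progression 1 2) m)))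
  (*-cong[] e₁ e₁))

F⁻₁₃*E₂ : F⁻ 1 3 *ˢ E 2 ≈ E 1 *ˢ E 4
F⁻₁₃*E₂ = ≈[]⇒≈ λ N → let m = suc N in
  ≈[]-trans (*-cong[] (triple-product 1 3 N) (E-prod 2 N (m ℕ.* 2) (N≤sN*k N 2)))
  (≈[]-trans (≈⇒≈[] (≈-trans (solve 4 (λ e a b u → e :* (a :* b) :* u := a :* b :* u :* e) ≈-refl
      (E 4) (prod (progression 1 4) m) (prod (progression 3 4) m) (prod (multiples 2) (m ℕ.* 2)))
    (*-cong (≈-sym (interleave₄ m)) ≈-refl))) (*-cong[] (≈[]-sym (E-prod 1 N (m ℕ.* 4) (N≤sN*k N 4))) (≈⇒≈[] ≈-refl)))

dil-factor : ∀ k .{{_ : NonZero k}} e → dil k (1ˢ -ˢ q^ e) ≈ 1ˢ -ˢ q^ (k ℕ.* e)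
dil-factor k e = ≈-trans (dil-+ˢ k _ _) (+-cong (dil-const k (+ 1)) (≈-trans (dil-neg k _) (-‿cong (dil-tm k (+ 1) e))))

dil-E : ∀ j k l .{{_ : NonZero j}} .{{_ : NonZero k}} .{{_ : NonZero l}} → j ℕ.* k ≡ l → dil j (E k) ≈ E l
dil-E j k l refl = ≈[]⇒≈ λ n → ≈[]-trans (dil-cong[] j (E-prod k n n ℕP.≤-refl))
  (≈[]-trans (≈⇒≈[] (dil-prod n)) (≈[]-sym (E-prod (j ℕ.* k) n n ℕP.≤-refl)))
  where
  dil-prod : ∀ n → dil j (prod (multiples k) n) ≈ prod (multiples (j ℕ.* k)) n
  dil-prod zero    = dil-const j (+ 1)
  dil-prod (suc n) = ≈-trans (dil-*ˢ j _ _) (*-cong (≈-trans (dil-factor j _) (factor-cong (sym (ℕP.*-assoc j k (suc n))))) (dil-prod n))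

F₁₁*F⁻₁₁≈F⁻₂₂² : F 1 1 *ˢ F⁻ 1 1 ≈ F⁻ 2 2 *ˢ F⁻ 2 2
F₁₁*F⁻₁₁≈F⁻₂₂² = ≈-trans F₁₁*F⁻₁₁ (comb₂ (solve 4 (λ o q f z → o :* (f :* f) :+ q :* (z :* z) := f :* f :+ f :* f :* (o :- con (+ 1)) :+ q :* z :* (z :- con (+ 0))) ≈-refl
  (tm (+ 1) 0) (q^ 1) (F⁻ 2 2) (F⁻ 4 0)) q⁰≈1 F⁻₄₀≈0)

F⁻₂₂*E₄ : F⁻ 2 2 *ˢ E 4 ≈ E 2 *ˢ E 2
F⁻₂₂*E₄ = ≈-trans (≈-sym (*-cong (θ-dil 2 alternating 1 1 2 2 refl refl) (dil-E 2 2 4 refl)))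
  (≈-trans (≈-sym (dil-*ˢ 2 _ _)) (≈-trans (dil-cong 2 F⁻₁₁*E₂) (≈-trans (dil-*ˢ 2 _ _) (*-cong (dil-E 2 1 2 refl) (dil-E 2 1 2 refl)))))

-- The triple product covers alternating series only. The quotient for φ(q) is reached through φ(q)
-- φ(-q) = φ(-q²)².
F₁₁-eta : F 1 1 *ˢ (E 1 *ˢ E 1) *ˢ (E 4 *ˢ E 4) ≈ E 2 *ˢ E 2 *ˢ (E 2 *ˢ E 2) *ˢ E 2
F₁₁-eta = comb₃ (solve 6 (λ a a′ b′ e₁ e₂ e₄ → a :* (e₁ :* e₁) :* (e₄ :* e₄) := e₂ :* e₂ :* (e₂ :* e₂) :* e₂
      :+ (:- (a :* (e₄ :* e₄))) :* (a′ :* e₂ :- e₁ :* e₁)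
      :+ (e₂ :* (e₄ :* e₄)) :* (a :* a′ :- b′ :* b′)
      :+ (e₂ :* (b′ :* e₄ :+ e₂ :* e₂)) :* (b′ :* e₄ :- e₂ :* e₂)) ≈-refl (F 1 1) (F⁻ 1 1) (F⁻ 2 2) (E 1) (E 2) (E 4))
  F⁻₁₁*E₂ F₁₁*F⁻₁₁≈F⁻₂₂² F⁻₂₂*E₄

F⁻₁₃²≈F₆₂*F⁻₁₁ : F⁻ 1 3 *ˢ F⁻ 1 3 ≈ F 6 2 *ˢ F⁻ 1 1
F⁻₁₃²≈F₆₂*F⁻₁₁ = ≈-trans F⁻₁₃² (comb₃ (solve 7 (λ o m q f g h a′ → o :* (f :* g) :+ m :* (f :* h) := f :* a′
     :+ f :* g :* (o :- con (+ 1)) :+ f :* h :* (m :- :- q) :+ (:- f) :* (a′ :- (g :- q :* h))) ≈-refl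
     (tm (+ 1) 0) (tm -[1+ 0 ] 1) (q^ 1) (F 6 2) (F 4 4) (F 8 0) (F⁻ 1 1)) q⁰≈1 (tm-neg 1) F⁻₁₁-halves)

-- Follows from ψ(-q)² = ψ(q²) φ(-q) and the eta quotients of the two alternating series.
F₆₂-eta : F 6 2 *ˢ E 2 ≈ E 4 *ˢ E 4
F₆₂-eta = unit-cancel (E 1) (E-zero 1) (unit-cancel (E 1) (E-zero 1)
  (comb₃ (solve 6 (λ f g a′ e₁ e₂ e₄ → e₁ :* (e₁ :* (f :* e₂)) := e₁ :* (e₁ :* (e₄ :* e₄))
     :+ (:- (f :* e₂)) :* (a′ :* e₂ :- e₁ :* e₁) :+ (:- (e₂ :* e₂)) :* (g :* g :- f :* a′)
     :+ (g :* e₂ :+ e₁ :* e₄) :* (g :* e₂ :- e₁ :* e₄)) ≈-refl (F 6 2) (F⁻ 1 3) (F⁻ 1 1) (E 1) (E 2) (E 4))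
   F⁻₁₁*E₂ F⁻₁₃²≈F₆₂*F⁻₁₁ F⁻₁₃*E₂))

-- Logarithmic derivatives

-- The logarithmic derivative without division: f need not be a unit, and the later series A and C,
-- which start at q and q⁵, are not.
Dlog : PS → PS → Set
Dlog f L = D f ≈ f *ˢ L

Dlog-* : ∀ {f g L M} → Dlog f L → Dlog g M → Dlog (f *ˢ g) (L +ˢ M)
Dlog-* {f} {g} {L} {M} p q = ≈-trans (D-*ˢ f g) (≈-trans (+-cong (*-cong p ≈-refl) (*-cong ≈-refl q))
  (solve 4 (λ f g L M → f :* L :* g :+ f :* (g :* M) := f :* g :* (L :+ M)) ≈-refl f g L M))

Dlog-cong : ∀ {f g L M} → f ≈ g → L ≈ M → Dlog f L → Dlog g M
Dlog-cong p q d = ≈-trans (D-cong (≈-sym p)) (≈-trans d (*-cong p q))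

Dlog-/ : ∀ {f g L M} → g 0 ≡ + 1 → Dlog g M → Dlog (f *ˢ g) L → Dlog f (L -ˢ M)
Dlog-/ {f} {g} {L} {M} g0 q p = unit-cancel g g0
  (comb₂ (solve 6 (λ f g L M df dg → g :* df := g :* (f :* (L :- M)) :+ (:- f) :* (dg :- g :* M) :+ con (+ 1) :* ((df :* g :+ f :* dg) :- f :* g :* L)) ≈-refl
     f g L M (D f) (D g)) q (≈-trans (≈-sym (D-*ˢ f g)) p))

Dlog-dil : ∀ k .{{_ : NonZero k}} {f L} → Dlog f L → Dlog (dil k f) (const (+ k) *ˢ dil k L)
Dlog-dil k {f} {L} p = ≈-trans (D-dil k f) (≈-trans (*-cong ≈-refl (≈-trans (dil-cong k p) (dil-*ˢ k f L)))
  (solve 3 (λ c f L → c :* (f :* L) := f :* (c :* L)) ≈-refl (const (+ k)) (dil k f) (dil k L)))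

ones : PS
ones _ = + 1

-- The Lambert term k q^k / (1 - q^k).
lambert : (k : ℕ) → .{{_ : NonZero k}} → PS
lambert k = const (+ k) *ˢ (dil k ones -ˢ 1ˢ)

factor*ones : ∀ k .{{_ : NonZero k}} → (1ˢ -ˢ q^ k) *ˢ dil k ones ≈ 1ˢ
factor*ones k = comb₁ (solve 2 (λ q g → (con (+ 1) :- q) :* g := con (+ 1) :+ con (+ 1) :* (g :- (con (+ 1) :+ q :* g))) ≈-refl (q^ k) (dil k ones))
  (dil-tail k ones)

D-q^ : ∀ e → D (q^ e) ≈ const (+ e) *ˢ q^ e
D-q^ e = coeffs λ n → trans (D-coeff (q^ e) n) (trans (go n) (sym (const-*ˢ (+ e) (q^ e) n)))
  where
  go : ∀ n → + n ℤ.* q^ e n ≡ + e ℤ.* q^ e n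
  go n with n ℕ.≟ e
  ... | yes refl = refl
  ... | no  n≢e rewrite tm-off (+ 1) e n n≢e = trans (ℤP.*-zeroʳ (+ n)) (sym (ℤP.*-zeroʳ (+ e)))

D-1ˢ : D 1ˢ ≈ 0ˢ
D-1ˢ = coeffs λ { zero → trans (D-coeff 1ˢ 0) (sym (0ˢ-coeff 0)) ; (suc n) → trans (D-coeff 1ˢ (suc n))
  (trans (cong (ℤ._*_ (+ suc n)) (const-suc (+ 1) n)) (trans (ℤP.*-zeroʳ (+ suc n)) (sym (0ˢ-coeff (suc n))))) }

Dlog-factor : ∀ k .{{_ : NonZero k}} → Dlog (1ˢ -ˢ q^ k) (-ˢ lambert k)
Dlog-factor k = ≈-trans (D-+ˢ 1ˢ _) (≈-trans (+-cong D-1ˢ (≈-trans (D-neg (q^ k)) (-‿cong (D-q^ k))))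
  (comb₁ (solve 3 (λ q g c → con (+ 0) :+ :- (c :* q) := (con (+ 1) :- q) :* (:- (c :* (g :- con (+ 1)))) :+ c :* ((con (+ 1) :- q) :* g :- con (+ 1))) ≈-refl
     (q^ k) (dil k ones) (const (+ k))) (factor*ones k)))

lambertSum : ℕ → PS
lambertSum zero    = 0ˢ
lambertSum (suc n) = lambert (suc n) +ˢ lambertSum n

Dlog-prod : ∀ n → Dlog (prod (multiples 1) n) (-ˢ lambertSum n)
Dlog-prod zero    = ≈-trans D-1ˢ (solve 0 (con (+ 0) := con (+ 1) :* (:- con (+ 0))) ≈-refl)
Dlog-prod (suc n) = Dlog-cong (*-cong (factor-cong (sym (ℕP.*-identityˡ (suc n)))) ≈-refl)
  (solve 2 (λ a b → :- a :+ :- b := :- (a :+ b)) ≈-refl (lambert (suc n)) (lambertSum n)) (Dlog-* (Dlog-factor (suc n)) (Dlog-prod n))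

sigma : PS
sigma n = + σ n

divisorTerm : ℕ → ℕ → ℕ
divisorTerm x d = if does (d ∣? x) then d else 0

divisorSum : ℕ → ℕ → ℕ
divisorSum x zero    = 0
divisorSum x (suc n) = divisorTerm x (suc n) ℕ.+ divisorSum x n

σ-divisorSum : ∀ x → σ x ≡ divisorSum x x
σ-divisorSum x = go x
  where
  snoc : ∀ n → applyUpTo suc (suc n) ≡ applyUpTo suc n ++ (suc n ∷ [])
  snoc n = sym (ListP.applyUpTo-∷ʳ suc n)
  single : ∀ d → ListAction.sum (filter (_∣? x) (d ∷ [])) ≡ divisorTerm x d
  single d with d ∣? x
  ... | yes _ = ℕP.+-identityʳ d
  ... | no  _ = refl
  go : ∀ n → ListAction.sum (filter (_∣? x) (applyUpTo suc n)) ≡ divisorSum x n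
  go zero    = refl
  go (suc n) = trans (cong (ListAction.sum ∘ filter (_∣? x)) (snoc n)) (trans (cong ListAction.sum (ListP.filter-++ (_∣? x) (applyUpTo suc n) _))
    (trans (ListActionP.sum-++ (filter (_∣? x) (applyUpTo suc n)) _) (trans (cong₂ ℕ._+_ (go n) (single (suc n))) (ℕP.+-comm _ (divisorTerm x (suc n))))))

divisorSum-stable : ∀ x .{{_ : NonZero x}} d → divisorSum x (d ℕ.+ x) ≡ divisorSum x x
divisorSum-stable x zero    = refl
divisorSum-stable x (suc d) = trans (cong (ℕ._+ divisorSum x (d ℕ.+ x)) (cong (λ b → if b then suc d ℕ.+ x else 0)
  (dec-false (suc d ℕ.+ x ∣? x) (λ p → ℕP.<⇒≱ (ℕP.m<n+m x (s≤s z≤n)) (∣⇒≤ p))))) (divisorSum-stable x d)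

lambert-coeff : ∀ k .{{_ : NonZero k}} n → lambert k (suc n) ≡ + divisorTerm (suc n) k
lambert-coeff k n = trans (const-*ˢ (+ k) _ (suc n)) (trans (cong (ℤ._*_ (+ k)) (trans (+ˢ-coeff _ _ (suc n))
  (trans (cong₂ ℤ._+_ (dil-coeff k ones (suc n)) (trans (-ˢ-coeff 1ˢ (suc n)) (cong ℤ.-_ (const-suc (+ 1) n)))) (ℤP.+-identityʳ _)))) go)
  where
  go : + k ℤ.* (if does (k ∣? suc n) then + 1 else + 0) ≡ + divisorTerm (suc n) k
  go with does (k ∣? suc n)
  ... | true  = ℤP.*-identityʳ (+ k)
  ... | false = ℤP.*-zeroʳ (+ k)

lambertSum-coeff : ∀ m n → lambertSum m (suc n) ≡ + divisorSum (suc n) m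
lambertSum-coeff zero    n = 0ˢ-coeff (suc n)
lambertSum-coeff (suc m) n = trans (+ˢ-coeff _ _ (suc n)) (trans (cong₂ ℤ._+_ (lambert-coeff (suc m) n) (lambertSum-coeff m n))
  (sym (ℤP.pos-+ (divisorTerm (suc n) (suc m)) _)))

lambertSum-zero : ∀ m → lambertSum m 0 ≡ + 0
lambertSum-zero zero    = 0ˢ-coeff 0
lambertSum-zero (suc m) = trans (+ˢ-coeff _ _ 0) (cong₂ ℤ._+_
  (trans (const-*ˢ (+ suc m) _ 0) (trans (cong (ℤ._*_ (+ suc m)) (trans (+ˢ-coeff _ _ 0)
    (cong₂ ℤ._+_ (dil-0 (suc m) ones) (trans (-ˢ-coeff 1ˢ 0) (cong ℤ.-_ (const-zero (+ 1))))))) (ℤP.*-zeroʳ (+ suc m))))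
  (lambertSum-zero m))

lambertSum-sigma : ∀ n → lambertSum n ≈[ n ] sigma
lambertSum-sigma n = coeffs≤ λ
  { zero    _   → lambertSum-zero n
  ; (suc i) i≤n → trans (lambertSum-coeff n i) (cong +_ (trans
      (trans (cong (divisorSum (suc i)) (sym (ℕP.m∸n+n≡m i≤n))) (divisorSum-stable (suc i) (n ℕ.∸ suc i))) (sym (σ-divisorSum (suc i))))) }

-ˢ-cong[] : ∀ {f g n} → f ≈[ n ] g → -ˢ f ≈[ n ] -ˢ g
-ˢ-cong[] {f} {g} p = coeffs≤ λ i h → trans (-ˢ-coeff f i) (trans (cong ℤ.-_ (coeff≤ p i h)) (sym (-ˢ-coeff g i)))

-- The source of all divisor sums: the factor 1 - q^k contributes -k in exactly those positive
-- degrees that k divides.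
Dlog-E₁ : Dlog (E 1) (-ˢ sigma)
Dlog-E₁ = ≈[]⇒≈ λ n → let e = E-prod 1 n n ℕP.≤-refl in
  ≈[]-trans (coeffs≤ λ i h → trans (D-coeff (E 1) i) (trans (cong (ℤ._*_ (+ i)) (coeff≤ e i h)) (sym (D-coeff _ i))))
  (≈[]-trans (≈⇒≈[] (Dlog-prod n)) (*-cong[] (≈[]-sym e) (-ˢ-cong[] (lambertSum-sigma n))))

combine : PS → PS → PS → PS → ℤ → ℤ → ℤ → ℤ → ℤ → PS
combine f₁ f₂ f₄ f₈ c₀ c₁ c₂ c₄ c₈ = const c₀ +ˢ const c₁ *ˢ f₁ +ˢ const c₂ *ˢ f₂ +ˢ const c₄ *ˢ f₄ +ˢ const c₈ *ˢ f₈

linᴾ : ∀ {n} → (f₁ f₂ f₄ f₈ : Polynomial n) → ℤ → ℤ → ℤ → ℤ → ℤ → Polynomial n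
linᴾ f₁ f₂ f₄ f₈ c₀ c₁ c₂ c₄ c₈ = con c₀ :+ con c₁ :* f₁ :+ con c₂ :* f₂ :+ con c₄ :* f₄ :+ con c₈ :* f₈

dil-combine : ∀ k .{{_ : NonZero k}} {f₁ f₂ f₄ f₈ g₁ g₂ g₄ g₈} → dil k f₁ ≈ g₁ → dil k f₂ ≈ g₂ → dil k f₄ ≈ g₄ → dil k f₈ ≈ g₈ →
              ∀ c₀ c₁ c₂ c₄ c₈ → dil k (combine f₁ f₂ f₄ f₈ c₀ c₁ c₂ c₄ c₈) ≈ combine g₁ g₂ g₄ g₈ c₀ c₁ c₂ c₄ c₈
dil-combine k p₁ p₂ p₄ p₈ c₀ c₁ c₂ c₄ c₈ =
  ≈-trans (dil-+ˢ k _ _) (+-cong (≈-trans (dil-+ˢ k _ _) (+-cong (≈-trans (dil-+ˢ k _ _) (+-cong (≈-trans (dil-+ˢ k _ _)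
    (+-cong (dil-const k c₀) (scaled c₁ p₁))) (scaled c₂ p₂))) (scaled c₄ p₄))) (scaled c₈ p₈))
  where
  scaled : ∀ c {f g} → dil k f ≈ g → dil k (const c *ˢ f) ≈ const c *ˢ g
  scaled c p = ≈-trans (dil-const* k c _) (*-cong ≈-refl p)

s₁ s₂ s₄ s₈ s₁₆ s₅ s₁₀ s₂₀ s₄₀ : PS
s₁  = sigma
s₂  = dil 2 sigma
s₄  = dil 4 sigma
s₈  = dil 8 sigma
s₁₆ = dil 16 sigma
s₅  = dil 5 sigma
s₁₀ = dil 10 sigma
s₂₀ = dil 20 sigma
s₄₀ = dil 40 sigma

lin lin₅ : ℤ → ℤ → ℤ → ℤ → ℤ → PS
lin  = combine s₁ s₂ s₄ s₈
lin₅ = combine s₅ s₁₀ s₂₀ s₄₀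

dil₂-lin : ∀ c₀ c₁ c₂ c₄ → dil 2 (lin c₀ c₁ c₂ c₄ (+ 0)) ≈ lin c₀ (+ 0) c₁ c₂ c₄
dil₂-lin c₀ c₁ c₂ c₄ = ≈-trans
  (dil-combine 2 ≈-refl (dil-dil 2 2 4 refl sigma) (dil-dil 2 4 8 refl sigma) (dil-dil 2 8 16 refl sigma) c₀ c₁ c₂ c₄ (+ 0))
  (≈-trans (+-cong ≈-refl (zeroˡ s₁₆)) (≈-trans (+-identityʳ _)
    (solve 8 (λ k₀ k₁ k₂ k₄ f₁ f₂ f₄ f₈ → k₀ :+ k₁ :* f₂ :+ k₂ :* f₄ :+ k₄ :* f₈ := k₀ :+ con (+ 0) :* f₁ :+ k₁ :* f₂ :+ k₂ :* f₄ :+ k₄ :* f₈) ≈-refl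
      (const c₀) (const c₁) (const c₂) (const c₄) s₁ s₂ s₄ s₈)))

dil₅-lin : ∀ c₀ c₁ c₂ c₄ c₈ → dil 5 (lin c₀ c₁ c₂ c₄ c₈) ≈ lin₅ c₀ c₁ c₂ c₄ c₈
dil₅-lin = dil-combine 5 ≈-refl (dil-dil 5 2 10 refl sigma) (dil-dil 5 4 20 refl sigma) (dil-dil 5 8 40 refl sigma)

Dlog-F⁻₁₁ : Dlog (F⁻ 1 1) (lin (+ 0) -[1+ 1 ] (+ 2) (+ 0) (+ 0))
Dlog-F⁻₁₁ = Dlog-cong ≈-refl
  (≈-trans (+-cong ≈-refl (-‿cong (*-cong ≈-refl (dil-neg 2 sigma))))
    (solve 4 (λ f₁ f₂ f₄ f₈ → (:- f₁ :+ :- f₁) :- con (+ 2) :* (:- f₂) := linᴾ f₁ f₂ f₄ f₈ (+ 0) -[1+ 1 ] (+ 2) (+ 0) (+ 0)) ≈-refl s₁ s₂ s₄ s₈))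
  (Dlog-/ (E-zero 2) (Dlog-cong (dil-E 2 1 2 refl) ≈-refl (Dlog-dil 2 Dlog-E₁))
    (Dlog-cong (≈-sym F⁻₁₁*E₂) ≈-refl (Dlog-* Dlog-E₁ Dlog-E₁)))

opaque
  unfolding θ
  F⁻₁₁-zero : F⁻ 1 1 0 ≡ + 1
  F⁻₁₁-zero = refl

Dlog-F⁻₂₂ : Dlog (F⁻ 2 2) (const (+ 2) *ˢ lin (+ 0) (+ 0) -[1+ 1 ] (+ 2) (+ 0))
Dlog-F⁻₂₂ = Dlog-cong (θ-dil 2 alternating 1 1 2 2 refl refl) (*-cong ≈-refl (dil₂-lin (+ 0) -[1+ 1 ] (+ 2) (+ 0))) (Dlog-dil 2 Dlog-F⁻₁₁)

-- Read off from φ(q) = φ(-q²)² / φ(-q).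
Dlog-F₁₁ : Dlog (F 1 1) (lin (+ 0) (+ 2) -[1+ 9 ] (+ 8) (+ 0))
Dlog-F₁₁ = Dlog-cong ≈-refl
  (solve 4 (λ f₁ f₂ f₄ f₈ → let L = linᴾ f₁ f₂ f₄ f₈ in
     (con (+ 2) :* L (+ 0) (+ 0) -[1+ 1 ] (+ 2) (+ 0) :+ con (+ 2) :* L (+ 0) (+ 0) -[1+ 1 ] (+ 2) (+ 0)) :- L (+ 0) -[1+ 1 ] (+ 2) (+ 0) (+ 0) :=
     L (+ 0) (+ 2) -[1+ 9 ] (+ 8) (+ 0)) ≈-refl s₁ s₂ s₄ s₈)
  (Dlog-/ F⁻₁₁-zero Dlog-F⁻₁₁ (Dlog-cong (≈-sym F₁₁*F⁻₁₁≈F⁻₂₂²) ≈-refl (Dlog-* Dlog-F⁻₂₂ Dlog-F⁻₂₂)))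

Dlog-F₂₂ : Dlog (F 2 2) (const (+ 2) *ˢ lin (+ 0) (+ 0) (+ 2) -[1+ 9 ] (+ 8))
Dlog-F₂₂ = Dlog-cong (θ-dil 2 plain 1 1 2 2 refl refl) (*-cong ≈-refl (dil₂-lin (+ 0) (+ 2) -[1+ 9 ] (+ 8))) (Dlog-dil 2 Dlog-F₁₁)

-- In terms of φ(q) = ∑ q ^ n²: a, b, c, d are φ(q), φ(q²), φ(q⁵), φ(q¹⁰), a′ and b′ are φ(- q) and φ(- q²);
-- A and B (C and Δ) are the odd and the even part of a² (of c²).
a a′ b b′ c d p r A B C Δ : PS
a  = F 1 1
a′ = F⁻ 1 1
b  = F 2 2
b′ = F⁻ 2 2
c  = F 5 5
d  = F 10 10
p  = F 4 0
r  = F 20 0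
A  = q^ 1 *ˢ (p *ˢ p)
B  = b *ˢ b
C  = q^ 5 *ˢ (r *ˢ r)
Δ  = d *ˢ d

a²≈A+B : a *ˢ a ≈ A +ˢ B
a²≈A+B = ≈-trans F₁₁² (comb₁ (solve 4 (λ o q b p → o :* (b :* b) :+ q :* (p :* p) := q :* (p :* p) :+ b :* b :+ b :* b :* (o :- con (+ 1))) ≈-refl
  (tm (+ 1) 0) (q^ 1) b p) q⁰≈1)

a′²≈B-A : a′ *ˢ a′ ≈ B -ˢ A
a′²≈B-A = ≈-trans F⁻₁₁² (comb₂ (solve 5 (λ o m q b p → o :* (b :* b) :+ m :* (p :* p) := b :* b :- q :* (p :* p)
  :+ b :* b :* (o :- con (+ 1)) :+ p :* p :* (m :- :- q)) ≈-refl (tm (+ 1) 0) (tm -[1+ 0 ] 1) (q^ 1) b p) q⁰≈1 (tm-neg 1))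

-- The four square theorem. With K = Dlog (a / a′) and L = a⁴ - a′⁴, the duplication formulas for a and a′
-- give K(q) L(q²) = K(q²) L(q), which determines K up to a constant factor.

K K₂ L L₂ : PS
K  = lin (+ 0) (+ 4) -[1+ 11 ] (+ 8) (+ 0)
K₂ = lin (+ 0) (+ 0) (+ 4) -[1+ 11 ] (+ 8)
L  = a *ˢ a *ˢ (a *ˢ a) -ˢ a′ *ˢ a′ *ˢ (a′ *ˢ a′)
L₂ = b *ˢ b *ˢ (b *ˢ b) -ˢ b′ *ˢ b′ *ˢ (b′ *ˢ b′)

dil₂-a² : dil 2 (a *ˢ a) ≈ B
dil₂-a² = ≈-trans (dil-*ˢ 2 a a) (*-cong (θ-dil 2 plain 1 1 2 2 refl refl) (θ-dil 2 plain 1 1 2 2 refl refl))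

a²+a′² : a *ˢ a +ˢ a′ *ˢ a′ ≈ const (+ 2) *ˢ (b *ˢ b)
a²+a′² = comb₂ (solve 4 (λ a a′ A B → a :* a :+ a′ :* a′ := con (+ 2) :* B :+ con (+ 1) :* (a :* a :- (A :+ B)) :+ con (+ 1) :* (a′ :* a′ :- (B :- A))) ≈-refl
  a a′ A B) a²≈A+B a′²≈B-A

-- The derivative of a² + a′² = 2 b², with b² eliminated by the same relation.
K-duplication : const (+ 4) *ˢ (a *ˢ a +ˢ a′ *ˢ a′) *ˢ K₂ ≈ (a *ˢ a -ˢ a′ *ˢ a′) *ˢ K
K-duplication = comb₂
  (solve 7 (λ a a′ b f₁ f₂ f₄ f₈ →
     let L  = linᴾ f₁ f₂ f₄ f₈
         α  = L (+ 0) (+ 2) -[1+ 9 ] (+ 8) (+ 0)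
         α′ = L (+ 0) -[1+ 1 ] (+ 2) (+ 0) (+ 0)
         β  = con (+ 2) :* L (+ 0) (+ 0) (+ 2) -[1+ 9 ] (+ 8)
     in con (+ 4) :* (a :* a :+ a′ :* a′) :* L (+ 0) (+ 0) (+ 4) -[1+ 11 ] (+ 8) :=
        (a :* a :- a′ :* a′) :* L (+ 0) (+ 4) -[1+ 11 ] (+ 8) (+ 0)
        :+ con -[1+ 0 ] :* ((a :* a :* (α :+ α) :+ a′ :* a′ :* (α′ :+ α′)) :- con (+ 2) :* (b :* b :* (β :+ β)))
        :+ con (+ 2) :* β :* ((a :* a :+ a′ :* a′) :- con (+ 2) :* (b :* b))) ≈-refl a a′ b s₁ s₂ s₄ s₈)
  (≈-trans (≈-sym (+-cong (Dlog-* Dlog-F₁₁ Dlog-F₁₁) (Dlog-* Dlog-F⁻₁₁ Dlog-F⁻₁₁)))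
    (≈-trans (≈-sym (D-+ˢ _ _)) (≈-trans (D-cong a²+a′²) (≈-trans (D-const* (+ 2) _) (*-cong ≈-refl (Dlog-* Dlog-F₂₂ Dlog-F₂₂))))))
  a²+a′²

-- Since a² + a′² = 2 b² and a a′ = b′², the number 4 (b⁴ - b′⁴) is (a² + a′²)² - (2 a a′)².
L₂-value : const (+ 4) *ˢ L₂ ≈ (a *ˢ a -ˢ a′ *ˢ a′) *ˢ (a *ˢ a -ˢ a′ *ˢ a′)
L₂-value = comb₂ (solve 4 (λ a a′ b b′ → con (+ 4) :* (b :* b :* (b :* b) :- b′ :* b′ :* (b′ :* b′)) :=
     (a :* a :- a′ :* a′) :* (a :* a :- a′ :* a′)
     :+ (:- (a :* a :+ a′ :* a′ :+ con (+ 2) :* (b :* b))) :* ((a :* a :+ a′ :* a′) :- con (+ 2) :* (b :* b))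
     :+ con (+ 4) :* (a :* a′ :+ b′ :* b′) :* (a :* a′ :- b′ :* b′)) ≈-refl a a′ b b′)
  a²+a′² F₁₁*F⁻₁₁≈F⁻₂₂²

K*L₂ : K *ˢ L₂ ≈ K₂ *ˢ L
K*L₂ = const-cancel (+ 4) (λ ()) (comb₂ (solve 5 (λ a a′ K K₂ L₂ →
     let x = a :* a :+ a′ :* a′ ; y = a :* a :- a′ :* a′ in
     con (+ 4) :* (K :* L₂) := con (+ 4) :* (K₂ :* (a :* a :* (a :* a) :- a′ :* a′ :* (a′ :* a′)))
       :+ K :* (con (+ 4) :* L₂ :- y :* y) :+ (:- y) :* (con (+ 4) :* x :* K₂ :- y :* K)) ≈-refl a a′ K K₂ L₂)
  L₂-value K-duplication)

dil₂-L : dil 2 L ≈ L₂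
dil₂-L = ≈-trans (dil-+ˢ 2 _ _) (+-cong (fourth (θ-dil 2 plain 1 1 2 2 refl refl))
    (≈-trans (dil-neg 2 _) (-‿cong (fourth (θ-dil 2 alternating 1 1 2 2 refl refl)))))
  where
  fourth : ∀ {f g} → dil 2 f ≈ g → dil 2 (f *ˢ f *ˢ (f *ˢ f)) ≈ g *ˢ g *ˢ (g *ˢ g)
  fourth {f} {g} e = ≈-trans (dil-*ˢ 2 _ _) (*-cong square square)
    where
    square : dil 2 (f *ˢ f) ≈ g *ˢ g
    square = ≈-trans (dil-*ˢ 2 _ _) (*-cong e e)

-- If f vanishes below n ≥ 2, the coefficient of q^(n+2) is f n · g 1 on the left. On the right it
-- is 0, because f(q²) then starts at degree 2 n > n + 1 at the earliest and g at degree 1. Degrees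
-- 0 and 1 escape this comparison and are hypotheses.
duplication-unique : ∀ f g → f 0 ≡ + 0 → f 1 ≡ + 0 → g 0 ≡ + 0 → g 1 ≢ + 0 → f *ˢ dil 2 g ≈ dil 2 f *ˢ g → f ≈ 0ˢ
duplication-unique f g f0 f1 g0 g1 eq = coeffs λ n → trans (go n (<-wellFounded n)) (sym (0ˢ-coeff n))
  where
  g-low : ∀ i → i < 1 → g i ≡ + 0
  g-low zero    _       = g0
  g-low (suc i) (s≤s ())
  dil-g-low : ∀ i → i < 2 → dil 2 g i ≡ + 0
  dil-g-low i i<2 with dil-view 2 i
  ... | inj₁ (zero  , refl , h) = trans (h g) g0
  ... | inj₁ (suc m , refl , h) = contradiction i<2 (ℕP.≤⇒≯ (ℕP.m≤m*n 2 (suc m)))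
  ... | inj₂ (_ , h)            = h g
  go : ∀ n → Acc _<_ n → f n ≡ + 0
  go zero          _         = f0
  go (suc zero)    _         = f1
  go n@(suc (suc n′)) (acc rec) with ℤP.i*j≡0⇒i≡0∨j≡0 (f n) (trans (trans (cong (ℤ._*_ (f n)) (sym (dil-* 2 g 1)))
      (sym (*ˢ-leading n 2 f (dil 2 g) (λ i i<n → go i (rec i<n)) dil-g-low)))
    (trans (coeff eq (n ℕ.+ 2)) (trans (cong (dil 2 f *ˢ g) (ℕP.+-suc n 1)) (trans (*ˢ-leading (suc n) 1 (dil 2 f) g (λ i i<n → low i (ℕP.<⇒≤ i<n)) g-low)
      (cong (ℤ._* g 1) (low (suc n) ℕP.≤-refl))))))
    where
    low : ∀ i → i ≤ suc n → dil 2 f i ≡ + 0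
    low i i≤n with dil-view 2 i
    ... | inj₁ (m , refl , h) = trans (h f) (go m (rec (half m i≤n)))
      where
      half : ∀ m → 2 ℕ.* m ≤ suc n → m < n
      half m h with m ℕP.<? n
      ... | yes m<n = m<n
      ... | no  m≮n = contradiction (ℕP.≤-trans (ℕP.*-monoʳ-≤ 2 (ℕP.≮⇒≥ m≮n)) h)
                        (ℕP.<⇒≱ (subst (suc n <_) (cong (n ℕ.+_) (sym (ℕP.+-identityʳ n))) (ℕP.+-monoˡ-≤ n (s≤s (s≤s (z≤n {n′}))))))
    ... | inj₂ (_ , h)        = h f
  ... | inj₁ fn≡0 = fn≡0
  ... | inj₂ g1≡0 = contradiction g1≡0 g1

opaque
  unfolding θ _+ˢ_ dil
  L-zero : L 0 ≡ + 0
  L-zero = refl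
  L-one : L 1 ≡ + 16
  L-one = refl
  4K-L-zero : (const (+ 4) *ˢ K -ˢ L) 0 ≡ + 0
  4K-L-zero = refl
  4K-L-one : (const (+ 4) *ˢ K -ˢ L) 1 ≡ + 0
  4K-L-one = refl

-- The factor 4 makes both sides start with 16 q, which supplies the two initial coefficients for
-- `duplication-unique`.
L≈4K : L ≈ const (+ 4) *ˢ K
L≈4K = ≈-sym (-ˢ≈0⇒≈ (duplication-unique (const (+ 4) *ˢ K -ˢ L) L 4K-L-zero 4K-L-one L-zero (λ e → contradiction (trans (sym L-one) e) (λ ()))
  (≈-trans (*-cong ≈-refl dil₂-L) (≈-trans
    (comb₁ (solve 4 (λ K K₂ L L₂ → (con (+ 4) :* K :- L) :* L₂ := (con (+ 4) :* K₂ :- L₂) :* L :+ con (+ 4) :* (K :* L₂ :- K₂ :* L)) ≈-refl K K₂ L L₂) K*L₂)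
    (*-cong (≈-sym (≈-trans (dil-+ˢ 2 _ _) (+-cong (≈-trans (dil-const* 2 (+ 4) K) (*-cong ≈-refl (dil₂-lin (+ 0) (+ 4) -[1+ 11 ] (+ 8))))
       (≈-trans (dil-neg 2 L) (-‿cong dil₂-L))))) ≈-refl)))))

L₂≈4K₂ : L₂ ≈ const (+ 4) *ˢ K₂
L₂≈4K₂ = ≈-trans (≈-sym dil₂-L) (≈-trans (dil-cong 2 L≈4K) (≈-trans (dil-const* 2 (+ 4) K) (*-cong ≈-refl (dil₂-lin (+ 0) (+ 4) -[1+ 11 ] (+ 8)))))

-- Odd coefficients of f(q²) vanish, and an even degree descends to its half.
dil₂-fixed : ∀ f → f ≈ dil 2 f → f 0 ≡ + 0 → f ≈ 0ˢ
dil₂-fixed f eq f0 = coeffs λ n → trans (go n (<-wellFounded n)) (sym (0ˢ-coeff n))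
  where
  go : ∀ n → Acc _<_ n → f n ≡ + 0
  go n (acc rec) with dil-view 2 n
  ... | inj₁ (zero  , refl , h) = f0
  ... | inj₁ (suc m , refl , h) = trans (coeff eq n) (trans (h f) (go (suc m) (rec (subst (suc m <_) (ℕP.*-comm (suc m) 2) (ℕP.m<m*n (suc m) 2 (s≤s (s≤s z≤n)))))))
  ... | inj₂ (_ , h)            = trans (coeff eq n) (h f)

opaque
  unfolding θ _+ˢ_ dil
  four-squares-zero : (a *ˢ a *ˢ (a *ˢ a) -ˢ lin (+ 1) (+ 8) (+ 0) -[1+ 31 ] (+ 0)) 0 ≡ + 0
  four-squares-zero = refl

-- From 2 (a⁴ - b⁴) = L + 2 L₂ = 4 K + 8 K₂ the claim at q and the claim at q² have the same defect.
-- So the defect is invariant under q ↦ q², and its constant term is 0.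
four-squares : a *ˢ a *ˢ (a *ˢ a) ≈ lin (+ 1) (+ 8) (+ 0) -[1+ 31 ] (+ 0)
four-squares = -ˢ≈0⇒≈ (dil₂-fixed _ (≈-trans
  (const-cancel (+ 2) (λ ()) (comb₃ (solve 8 (λ a a′ b b′ f₁ f₂ f₄ f₈ →
     let M = linᴾ f₁ f₂ f₄ f₈
         k = M (+ 0) (+ 4) -[1+ 11 ] (+ 8) (+ 0)
         k₂ = M (+ 0) (+ 0) (+ 4) -[1+ 11 ] (+ 8)
     in con (+ 2) :* (a :* a :* (a :* a) :- M (+ 1) (+ 8) (+ 0) -[1+ 31 ] (+ 0)) :=
        con (+ 2) :* (b :* b :* (b :* b) :- M (+ 1) (+ 0) (+ 8) (+ 0) -[1+ 31 ])
        :+ con (+ 1) :* ((a :* a :* (a :* a) :- a′ :* a′ :* (a′ :* a′)) :- con (+ 4) :* k)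
        :+ con (+ 2) :* ((b :* b :* (b :* b) :- b′ :* b′ :* (b′ :* b′)) :- con (+ 4) :* k₂)
        :+ con (+ 1) :* ((a :* a :* (a :* a) :+ a′ :* a′ :* (a′ :* a′)) :- (con (+ 4) :* (b :* b :* (b :* b)) :- con (+ 2) :* (b′ :* b′ :* (b′ :* b′))))) ≈-refl
       a a′ b b′ s₁ s₂ s₄ s₈) L≈4K L₂≈4K₂ even))
  (≈-sym (≈-trans (dil-+ˢ 2 _ _) (+-cong (≈-trans (dil-*ˢ 2 _ _) (*-cong dil₂-a² dil₂-a²))
    (≈-trans (dil-neg 2 _) (-‿cong (dil₂-lin (+ 1) (+ 8) (+ 0) -[1+ 31 ]))))))) four-squares-zero)
  where
  even : a *ˢ a *ˢ (a *ˢ a) +ˢ a′ *ˢ a′ *ˢ (a′ *ˢ a′) ≈ const (+ 4) *ˢ (b *ˢ b *ˢ (b *ˢ b)) -ˢ const (+ 2) *ˢ (b′ *ˢ b′ *ˢ (b′ *ˢ b′))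
  even = comb₂ (solve 4 (λ a a′ b b′ → a :* a :* (a :* a) :+ a′ :* a′ :* (a′ :* a′) :=
       con (+ 4) :* (b :* b :* (b :* b)) :- con (+ 2) :* (b′ :* b′ :* (b′ :* b′))
       :+ (a :* a :+ a′ :* a′ :+ con (+ 2) :* (b :* b)) :* ((a :* a :+ a′ :* a′) :- con (+ 2) :* (b :* b))
       :+ (:- (con (+ 2) :* (a :* a′ :+ b′ :* b′))) :* (a :* a′ :- b′ :* b′)) ≈-refl a a′ b b′)
    a²+a′² F₁₁*F⁻₁₁≈F⁻₂₂²

-- Values of the quadratic monomials in A, B and in C, Δ

B²-value : B *ˢ B ≈ lin (+ 1) (+ 0) (+ 8) (+ 0) -[1+ 31 ]
B²-value = ≈-trans (≈-sym (≈-trans (dil-*ˢ 2 _ _) (*-cong dil₂-a² dil₂-a²))) (≈-trans (dil-cong 2 four-squares) (dil₂-lin (+ 1) (+ 8) (+ 0) -[1+ 31 ]))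
-- Here a⁴ - a′⁴ = (A + B)² - (B - A)² = 4 A B.
AB-value : A *ˢ B ≈ K
AB-value = const-cancel (+ 4) (λ ()) (comb₃ (solve 5 (λ a a′ A B K → con (+ 4) :* (A :* B) := con (+ 4) :* K
    :+ con (+ 1) :* ((a :* a :* (a :* a) :- a′ :* a′ :* (a′ :* a′)) :- con (+ 4) :* K)
    :+ (:- (a :* a :+ (A :+ B))) :* (a :* a :- (A :+ B))
    :+ (a′ :* a′ :+ (B :- A)) :* (a′ :* a′ :- (B :- A))) ≈-refl a a′ A B K)
  L≈4K a²≈A+B a′²≈B-A)

A²-value : A *ˢ A ≈ lin (+ 0) (+ 0) (+ 16) -[1+ 47 ] (+ 32)
A²-value = comb₂ (solve 7 (λ a A B f₁ f₂ f₄ f₈ → let M = linᴾ f₁ f₂ f₄ f₈ in A :* A := M (+ 0) (+ 0) (+ 16) -[1+ 47 ] (+ 32)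
    :+ con (+ 1) :* ((A :+ B) :* (A :+ B) :- M (+ 1) (+ 8) (+ 0) -[1+ 31 ] (+ 0))
    :+ con -[1+ 0 ] :* ((con (+ 2) :* (A :* B) :+ B :* B) :- (con (+ 2) :* M (+ 0) (+ 4) -[1+ 11 ] (+ 8) (+ 0) :+ M (+ 1) (+ 0) (+ 8) (+ 0) -[1+ 31 ]))) ≈-refl a A B s₁ s₂ s₄ s₈)
  (≈-trans (≈-sym (*-cong a²≈A+B a²≈A+B)) four-squares) (+-cong (*-cong ≈-refl AB-value) B²-value)

dil₅-A : dil 5 A ≈ C
dil₅-A = ≈-trans (dil-q^* 5 1 _) (*-cong ≈-refl (≈-trans (dil-*ˢ 5 _ _) (*-cong (θ-dil 5 plain 4 0 20 0 refl refl) (θ-dil 5 plain 4 0 20 0 refl refl))))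

dil₅-B : dil 5 B ≈ Δ
dil₅-B = ≈-trans (dil-*ˢ 5 _ _) (*-cong (θ-dil 5 plain 2 2 10 10 refl refl) (θ-dil 5 plain 2 2 10 10 refl refl))

dil₅-a² : dil 5 (a *ˢ a) ≈ c *ˢ c
dil₅-a² = ≈-trans (dil-*ˢ 5 _ _) (*-cong (θ-dil 5 plain 1 1 5 5 refl refl) (θ-dil 5 plain 1 1 5 5 refl refl))

c²≈C+Δ : c *ˢ c ≈ C +ˢ Δ
c²≈C+Δ = ≈-trans (≈-sym dil₅-a²) (≈-trans (dil-cong 5 a²≈A+B) (≈-trans (dil-+ˢ 5 A B) (+-cong dil₅-A dil₅-B)))

Δ²-value : Δ *ˢ Δ ≈ lin₅ (+ 1) (+ 0) (+ 8) (+ 0) -[1+ 31 ]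
Δ²-value = ≈-trans (≈-sym (≈-trans (dil-*ˢ 5 B B) (*-cong dil₅-B dil₅-B))) (≈-trans (dil-cong 5 B²-value) (dil₅-lin (+ 1) (+ 0) (+ 8) (+ 0) -[1+ 31 ]))

CΔ-value : C *ˢ Δ ≈ lin₅ (+ 0) (+ 4) -[1+ 11 ] (+ 8) (+ 0)
CΔ-value = ≈-trans (≈-sym (≈-trans (dil-*ˢ 5 A B) (*-cong dil₅-A dil₅-B))) (≈-trans (dil-cong 5 AB-value) (dil₅-lin (+ 0) (+ 4) -[1+ 11 ] (+ 8) (+ 0)))

C²-value : C *ˢ C ≈ lin₅ (+ 0) (+ 0) (+ 16) -[1+ 47 ] (+ 32)
C²-value = ≈-trans (≈-sym (≈-trans (dil-*ˢ 5 A A) (*-cong dil₅-A dil₅-A))) (≈-trans (dil-cong 5 A²-value) (dil₅-lin (+ 0) (+ 0) (+ 16) -[1+ 47 ] (+ 32)))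

c⁴-value : c *ˢ c *ˢ (c *ˢ c) ≈ lin₅ (+ 1) (+ 8) (+ 0) -[1+ 31 ] (+ 0)
c⁴-value = ≈-trans (≈-sym (≈-trans (dil-*ˢ 5 _ _) (*-cong dil₅-a² dil₅-a²))) (≈-trans (dil-cong 5 four-squares) (dil₅-lin (+ 1) (+ 8) (+ 0) -[1+ 31 ] (+ 0)))

-- Relations of level 20 and 40

h h₂ P α₁ α₂ α₃ : PS
h  = E 2 *ˢ E 10
h₂ = E 4 *ˢ E 20
P  = F 7 3 *ˢ F 9 1
α₁ = q^ 1 *ˢ (h *ˢ h)
α₂ = q^ 2 *ˢ (h₂ *ˢ h₂)
α₃ = q^ 3 *ˢ (b *ˢ h *ˢ F 60 20)

q²≈q*q : q^ 2 ≈ q^ 1 *ˢ q^ 1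
q²≈q*q = ≈-sym (q^-+ 1 1)

q³≈q*q*q : q^ 3 ≈ q^ 1 *ˢ (q^ 1 *ˢ q^ 1)
q³≈q*q*q = ≈-sym (≈-trans (*-cong ≈-refl (q^-+ 1 1)) (q^-+ 1 2))

q⁵≈ : q^ 5 ≈ q^ 1 *ˢ (q^ 1 *ˢ q^ 1) *ˢ (q^ 1 *ˢ q^ 1)
q⁵≈ = ≈-sym (≈-trans (*-cong (≈-trans (*-cong ≈-refl (q^-+ 1 1)) (q^-+ 1 2)) (q^-+ 1 1)) (q^-+ 3 2))

a²-c² : a *ˢ a -ˢ c *ˢ c ≈ const (+ 4) *ˢ (q^ 1 *ˢ P)
a²-c² = ≈-trans (+-cong F₁₁²-mod₅ ≈-refl) (comb₁ (solve 4 (λ o q c P → o :* (c :* c) :+ (q :* P :+ (q :* P :+ (q :* P :+ q :* P))) :- c :* c :=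
  con (+ 4) :* (q :* P) :+ c :* c :* (o :- con (+ 1))) ≈-refl (tm (+ 1) 0) (q^ 1) c P) q⁰≈1)

-- A three-term relation of Weierstrass: the four products of theta series are 2 × 2 minors.
weierstrass : c *ˢ c *ˢ P ≈ h *ˢ h +ˢ q^ 1 *ˢ (P *ˢ P)
weierstrass = ≈-trans (solve 3 (λ c f g → c :* c :* (f :* g) := (c :* f) :* (c :* g)) ≈-refl c (F 7 3) (F 9 1))
  (≈-trans (*-cong e₀₂ e₀₄) (≈-trans
   (solve 5 (λ u₂ u₄ u₆ u₈ q →
      (u₂ :* u₂ :+ q :* (q :* q) :* (u₈ :* u₈)) :* (u₄ :* u₄ :+ q :* (u₆ :* u₆)) :=
      (u₄ :* u₂ :- q :* q :* (u₆ :* u₈)) :* (u₄ :* u₂ :- q :* q :* (u₆ :* u₈))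
        :+ q :* ((u₆ :* u₂ :+ q :* (u₄ :* u₈)) :* (u₆ :* u₂ :+ q :* (u₄ :* u₈)))) ≈-refl (F 12 8) (F 14 6) (F 16 4) (F 18 2) (q^ 1))
   (≈-sym (+-cong (*-cong e₁₃ e₁₃) (*-cong ≈-refl (*-cong e₂₄ e₂₄))))))
  where
  unscale : ∀ {f} → tm (+ 1) 0 *ˢ f ≈ f
  unscale = ≈-trans (*-cong q⁰≈1 ≈-refl) (*-identityˡ _)
  e₀₂ : c *ˢ F 7 3 ≈ F 12 8 *ˢ F 12 8 +ˢ q^ 1 *ˢ (q^ 1 *ˢ q^ 1) *ˢ (F 18 2 *ˢ F 18 2)
  e₀₂ = ≈-trans F₅₅*F₇₃ (+-cong unscale (*-cong q³≈q*q*q ≈-refl))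
  e₀₄ : c *ˢ F 9 1 ≈ F 14 6 *ˢ F 14 6 +ˢ q^ 1 *ˢ (F 16 4 *ˢ F 16 4)
  e₀₄ = ≈-trans F₅₅*F₉₁ (+-cong unscale ≈-refl)
  e₂₄ : P ≈ F 16 4 *ˢ F 12 8 +ˢ q^ 1 *ˢ (F 14 6 *ˢ F 18 2)
  e₂₄ = ≈-trans F₇₃*F₉₁ (+-cong unscale ≈-refl)
  e₁₃ : h ≈ F 14 6 *ˢ F 12 8 -ˢ q^ 1 *ˢ q^ 1 *ˢ (F 16 4 *ˢ F 18 2)
  e₁₃ = ≈-trans (≈-trans (≈-sym F⁻₆₄*F⁻₈₂≈E₂*E₁₀) F⁻₆₄*F⁻₈₂) (+-cong unscale
    (≈-trans (*-cong (≈-trans (tm-neg 2) (-‿cong q²≈q*q)) ≈-refl) (solve 2 (λ x y → (:- x) :* y := :- (x :* y)) ≈-refl (q^ 1 *ˢ q^ 1) (F 16 4 *ˢ F 18 2))))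

-- With a² = c² + 4 q P the left side becomes 16 q (c² P - q P²), and `weierstrass` evaluates the
-- bracket as h².
level-20 : (a *ˢ a -ˢ c *ˢ c) *ˢ (const (+ 5) *ˢ (c *ˢ c) -ˢ a *ˢ a) ≈ const (+ 16) *ˢ α₁
level-20 = comb₂ (solve 5 (λ a c q P h → (a :* a :- c :* c) :* (con (+ 5) :* (c :* c) :- a :* a) := con (+ 16) :* (q :* (h :* h))
    :+ (con (+ 5) :* (c :* c) :- a :* a :- con (+ 4) :* (q :* P)) :* ((a :* a :- c :* c) :- con (+ 4) :* (q :* P))
    :+ con (+ 16) :* q :* (c :* c :* P :- (h :* h :+ q :* (P :* P)))) ≈-refl a c (q^ 1) P h)
  a²-c² weierstrass

level-20′ : (A +ˢ B -ˢ (C +ˢ Δ)) *ˢ (const (+ 5) *ˢ (C +ˢ Δ) -ˢ (A +ˢ B)) ≈ const (+ 16) *ˢ α₁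
level-20′ = ≈-trans (*-cong (+-cong (≈-sym a²≈A+B) (-‿cong (≈-sym c²≈C+Δ))) (+-cong (*-cong ≈-refl (≈-sym c²≈C+Δ)) (-‿cong (≈-sym a²≈A+B)))) level-20

neg--ˢ : ∀ f → neg (-ˢ f) ≈ -ˢ neg f
neg--ˢ f = ≈-trans (neg-cong (solve 1 (λ f → :- f := con -[1+ 0 ] :* f) ≈-refl f))
  (≈-trans (neg-const* -[1+ 0 ] f) (solve 1 (λ f → con -[1+ 0 ] :* f := :- f) ≈-refl (neg f)))

neg-odd : ∀ {f g} → f ≈ dil 2 g → neg (q^ 1 *ˢ f) ≈ -ˢ (q^ 1 *ˢ f)
neg-odd {f} {g} e = ≈-trans (neg-*ˢ (q^ 1) f) (≈-trans (*-cong neg-q¹ (≈-trans (neg-cong e) (≈-trans (neg-dil₂ g) (≈-sym e))))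
  (solve 2 (λ q f → (:- q) :* f := :- (q :* f)) ≈-refl (q^ 1) f))

dil₂-* : ∀ {f f′ g g′} → f ≈ dil 2 g → f′ ≈ dil 2 g′ → f *ˢ f′ ≈ dil 2 (g *ˢ g′)
dil₂-* e e′ = ≈-trans (*-cong e e′) (≈-sym (dil-*ˢ 2 _ _))

neg-even-series : ∀ {f g} → f ≈ dil 2 g → neg f ≈ f
neg-even-series {f} {g} e = ≈-trans (neg-cong e) (≈-trans (neg-dil₂ g) (≈-sym e))

neg-A : neg A ≈ -ˢ A
neg-A = neg-odd (dil₂-* (≈-sym (θ-dil 2 plain 2 0 4 0 refl refl)) (≈-sym (θ-dil 2 plain 2 0 4 0 refl refl)))

neg-B : neg B ≈ B
neg-B = neg-even-series (dil₂-* (≈-sym (θ-dil 2 plain 1 1 2 2 refl refl)) (≈-sym (θ-dil 2 plain 1 1 2 2 refl refl)))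

neg-Δ : neg Δ ≈ Δ
neg-Δ = neg-even-series (dil₂-* (≈-sym (θ-dil 2 plain 5 5 10 10 refl refl)) (≈-sym (θ-dil 2 plain 5 5 10 10 refl refl)))

neg-C : neg C ≈ -ˢ C
neg-C = ≈-trans (neg-cong C≈) (≈-trans (neg-odd (dil₂-* (≈-sym (dil-tm 2 (+ 1) 2)) (dil₂-* r≈ r≈))) (-‿cong (≈-sym C≈)))
  where
  r≈ = ≈-sym (θ-dil 2 plain 10 0 20 0 refl refl)
  C≈ : C ≈ q^ 1 *ˢ (q^ 4 *ˢ (r *ˢ r))
  C≈ = ≈-trans (*-cong (≈-sym (q^-+ 1 4)) ≈-refl) (*-assoc _ _ _)

neg-α₁ : neg α₁ ≈ -ˢ α₁
neg-α₁ = neg-odd (dil₂-* h≈ h≈)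
  where
  h≈ : h ≈ dil 2 (E 1 *ˢ E 5)
  h≈ = dil₂-* (≈-sym (dil-E 2 1 2 refl)) (≈-sym (dil-E 2 5 10 refl))

-- Under q ↦ -q the odd series A, C, α₁ change sign while B and Δ stay. Adding this to `level-20′`
-- gives the even relation `R₁≈0`, from which α₁ drops out; subtracting gives `odd-part`.
level-20-neg : ((-ˢ A) +ˢ B -ˢ ((-ˢ C) +ˢ Δ)) *ˢ (const (+ 5) *ˢ ((-ˢ C) +ˢ Δ) -ˢ ((-ˢ A) +ˢ B)) ≈ const (+ 16) *ˢ (-ˢ α₁)
level-20-neg = ≈-trans (≈-sym (≈-trans (neg-*ˢ _ _) (*-cong (difference x y) (≈-trans (neg-+ˢ _ _) (+-cong (≈-trans (neg-const* (+ 5) _) (*-cong ≈-refl y)) (≈-trans (neg--ˢ _) (-‿cong x)))))))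
  (≈-trans (neg-cong level-20′) (≈-trans (neg-const* (+ 16) α₁) (*-cong ≈-refl neg-α₁)))
  where
  x : neg (A +ˢ B) ≈ (-ˢ A) +ˢ B
  x = ≈-trans (neg-+ˢ A B) (+-cong neg-A neg-B)
  y : neg (C +ˢ Δ) ≈ (-ˢ C) +ˢ Δ
  y = ≈-trans (neg-+ˢ C Δ) (+-cong neg-C neg-Δ)
  difference : ∀ {f f′ g g′} → neg f ≈ f′ → neg g ≈ g′ → neg (f -ˢ g) ≈ f′ -ˢ g′
  difference e e′ = ≈-trans (neg-+ˢ _ _) (+-cong e (≈-trans (neg--ˢ _) (-‿cong e′)))

ρ₁ : ∀ {n} → (A B C D : Polynomial n) → Polynomial n
ρ₁ A B C D = A :* A :- con (+ 6) :* A :* C :+ con (+ 5) :* C :* C :+ B :* B :- con (+ 6) :* B :* D :+ con (+ 5) :* D :* D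

R₁ : PS
R₁ = A *ˢ A -ˢ const (+ 6) *ˢ A *ˢ C +ˢ const (+ 5) *ˢ C *ˢ C +ˢ B *ˢ B -ˢ const (+ 6) *ˢ B *ˢ Δ +ˢ const (+ 5) *ˢ Δ *ˢ Δ

R₁≈0 : R₁ ≈ 0ˢ
R₁≈0 = const-cancel (+ 2) (λ ()) (comb₂ (solve 5 (λ A B C D α → con (+ 2) :* ρ₁ A B C D := con (+ 2) :* con (+ 0)
    :+ con -[1+ 0 ] :* ((A :+ B :- (C :+ D)) :* (con (+ 5) :* (C :+ D) :- (A :+ B)) :- con (+ 16) :* α)
    :+ con -[1+ 0 ] :* (((:- A) :+ B :- ((:- C) :+ D)) :* (con (+ 5) :* ((:- C) :+ D) :- ((:- A) :+ B)) :- con (+ 16) :* (:- α))) ≈-refl A B C Δ α₁)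
  level-20′ level-20-neg)

odd-part : const (+ 6) *ˢ (A *ˢ Δ) +ˢ const (+ 6) *ˢ (B *ˢ C) -ˢ const (+ 2) *ˢ (A *ˢ B) -ˢ const (+ 10) *ˢ (C *ˢ Δ) ≈ const (+ 16) *ˢ α₁
odd-part = const-cancel (+ 2) (λ ()) (comb₂ (solve 5 (λ A B C D α →
    con (+ 2) :* (con (+ 6) :* (A :* D) :+ con (+ 6) :* (B :* C) :- con (+ 2) :* (A :* B) :- con (+ 10) :* (C :* D)) := con (+ 2) :* (con (+ 16) :* α)
    :+ con (+ 1) :* ((A :+ B :- (C :+ D)) :* (con (+ 5) :* (C :+ D) :- (A :+ B)) :- con (+ 16) :* α)
    :+ con -[1+ 0 ] :* (((:- A) :+ B :- ((:- C) :+ D)) :* (con (+ 5) :* ((:- C) :+ D) :- ((:- A) :+ B)) :- con (+ 16) :* (:- α))) ≈-refl A B C Δ α₁)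
  level-20′ level-20-neg)

level-40 : (B -ˢ Δ) *ˢ (const (+ 5) *ˢ Δ -ˢ B) ≈ const (+ 16) *ˢ α₂
level-40 = ≈-trans (≈-sym (≈-trans (dil-*ˢ 2 _ _) (*-cong
      (≈-trans (dil-+ˢ 2 _ _) (+-cong dil₂-a² (≈-trans (dil-neg 2 _) (-‿cong y))))
      (≈-trans (dil-+ˢ 2 _ _) (+-cong (≈-trans (dil-const* 2 (+ 5) _) (*-cong ≈-refl y)) (≈-trans (dil-neg 2 _) (-‿cong dil₂-a²)))))))
  (≈-trans (dil-cong 2 level-20) (≈-trans (dil-const* 2 (+ 16) α₁) (*-cong ≈-refl (≈-trans (dil-q^* 2 1 _)
    (*-cong ≈-refl (≈-trans (dil-*ˢ 2 _ _) (*-cong h≈ h≈)))))))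
  where
  y : dil 2 (c *ˢ c) ≈ Δ
  y = ≈-trans (dil-*ˢ 2 _ _) (*-cong (θ-dil 2 plain 5 5 10 10 refl refl) (θ-dil 2 plain 5 5 10 10 refl refl))
  h≈ : dil 2 h ≈ h₂
  h≈ = ≈-trans (dil-*ˢ 2 _ _) (*-cong (dil-E 2 2 4 refl) (dil-E 2 10 20 refl))

p*d : p *ˢ d ≈ q^ 1 *ˢ q^ 1 *ˢ (b *ˢ r) +ˢ const (+ 2) *ˢ h
p*d = ≈-trans F₄₀*F₁₀₁₀ (+-cong (*-cong q²≈q*q ≈-refl) (*-cong ≈-refl (*-cong F⁻₂₄≈E₂ F⁻₁₀₂₀≈E₁₀)))
  where
  F⁻₁₀₂₀≈E₁₀ : F⁻ 10 20 ≈ E 10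
  F⁻₁₀₂₀≈E₁₀ = ≈-trans (≈-sym (θ-dil 5 alternating 2 4 10 20 refl refl)) (≈-trans (dil-cong 5 F⁻₂₄≈E₂) (dil-E 5 2 10 refl))

r≈2F₆₀₂₀ : r ≈ const (+ 2) *ˢ F 60 20
r≈2F₆₀₂₀ = ≈-trans (≈-sym (θ-dil 10 plain 2 0 20 0 refl refl)) (≈-trans (dil-cong 10 F₂₀≈2F₆₂)
  (≈-trans (dil-const* 10 (+ 2) _) (*-cong ≈-refl (θ-dil 10 plain 6 2 60 20 refl refl))))

-- A square root of A B C Δ. Eliminating α₁ between `odd-part` and `4α₁` makes 4 Z a polynomial in
-- A, B, C, Δ. Its square is the second equation of the curve, next to `R₁≈0`.
Z : PS
Z = q^ 1 *ˢ (q^ 1 *ˢ q^ 1) *ˢ (p *ˢ r *ˢ (b *ˢ d))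

C≈q-power : C ≈ q^ 1 *ˢ (q^ 1 *ˢ q^ 1) *ˢ (q^ 1 *ˢ q^ 1) *ˢ (r *ˢ r)
C≈q-power = *-cong q⁵≈ ≈-refl

Z² : Z *ˢ Z ≈ A *ˢ B *ˢ (C *ˢ Δ)
Z² = comb₁ (solve 6 (λ q p b r d C → let z = q :* (q :* q) :* (p :* r :* (b :* d)) in
    z :* z := q :* (p :* p) :* (b :* b) :* (C :* (d :* d))
    :+ (:- (q :* (p :* p) :* (b :* b) :* (d :* d))) :* (C :- q :* (q :* q) :* (q :* q) :* (r :* r))) ≈-refl (q^ 1) p b r d C)
  C≈q-power

-- The square of p d - q² b r = 2 h, multiplied by q.
4α₁ : const (+ 4) *ˢ α₁ ≈ A *ˢ Δ +ˢ B *ˢ C -ˢ const (+ 2) *ˢ Z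
4α₁ = comb₂ (solve 7 (λ q p b r d C h → con (+ 4) :* (q :* (h :* h)) :=
    q :* (p :* p) :* (d :* d) :+ b :* b :* C :- con (+ 2) :* (q :* (q :* q) :* (p :* r :* (b :* d)))
    :+ (:- (q :* (p :* d :- q :* q :* (b :* r) :+ con (+ 2) :* h))) :* (p :* d :- (q :* q :* (b :* r) :+ con (+ 2) :* h))
    :+ (:- (b :* b)) :* (C :- q :* (q :* q) :* (q :* q) :* (r :* r))) ≈-refl (q^ 1) p b r d C h)
  p*d C≈q-power

-- The relation p d - q² b r = 2 h multiplied by q³ b r, with r = 2 ψ(q²⁰) on the right.
4α₃ : const (+ 4) *ˢ α₃ ≈ Z -ˢ B *ˢ C
4α₃ = ≈-trans (*-cong ≈-refl (*-cong q³≈q*q*q ≈-refl)) (comb₃ (solve 8 (λ q p b r d C h f → con (+ 4) :* (q :* (q :* q) :* (b :* h :* f)) :=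
    q :* (q :* q) :* (p :* r :* (b :* d)) :- b :* b :* C
    :+ (:- (q :* (q :* q) :* b :* r)) :* (p :* d :- (q :* q :* (b :* r) :+ con (+ 2) :* h))
    :+ b :* b :* (C :- q :* (q :* q) :* (q :* q) :* (r :* r))
    :+ (:- (con (+ 2) :* (q :* (q :* q) :* (b :* h)))) :* (r :- con (+ 2) :* f)) ≈-refl (q^ 1) p b r d C h (F 60 20))
  p*d C≈q-power r≈2F₆₀₂₀)

AΔ-BC : A *ˢ Δ -ˢ B *ˢ C ≈ const (+ 4) *ˢ α₁ +ˢ const (+ 8) *ˢ α₃
AΔ-BC = comb₂ (solve 7 (λ A B C D Z α₁ α₃ → A :* D :- B :* C := con (+ 4) :* α₁ :+ con (+ 8) :* α₃
    :+ con -[1+ 0 ] :* (con (+ 4) :* α₁ :- (A :* D :+ B :* C :- con (+ 2) :* Z))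
    :+ con -[1+ 1 ] :* (con (+ 4) :* α₃ :- (Z :- B :* C))) ≈-refl A B C Δ Z α₁ α₃)
  4α₁ 4α₃

4Z : const (+ 4) *ˢ Z ≈ A *ˢ B -ˢ A *ˢ Δ -ˢ B *ˢ C +ˢ const (+ 5) *ˢ C *ˢ Δ
4Z = const-cancel (+ 2) (λ ()) (comb₂ (solve 6 (λ A B C D Z α → con (+ 2) :* (con (+ 4) :* Z) := con (+ 2) :* (A :* B :- A :* D :- B :* C :+ con (+ 5) :* C :* D)
    :+ con (+ 1) :* ((con (+ 6) :* (A :* D) :+ con (+ 6) :* (B :* C) :- con (+ 2) :* (A :* B) :- con (+ 10) :* (C :* D)) :- con (+ 16) :* α)
    :+ con (+ 4) :* (con (+ 4) :* α :- (A :* D :+ B :* C :- con (+ 2) :* Z))) ≈-refl A B C Δ Z α₁)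
  odd-part 4α₁)

W : PS
W = A *ˢ B -ˢ A *ˢ Δ -ˢ B *ˢ C +ˢ const (+ 5) *ˢ C *ˢ Δ

16ABCΔ : const (+ 16) *ˢ A *ˢ B *ˢ C *ˢ Δ ≈ W *ˢ W
16ABCΔ = comb₂ (solve 6 (λ A B C D Z W → con (+ 16) :* A :* B :* C :* D := W :* W
    :+ con -[1+ 15 ] :* (Z :* Z :- A :* B :* (C :* D))
    :+ (con (+ 4) :* Z :+ W) :* (con (+ 4) :* Z :- W)) ≈-refl A B C Δ Z W)
  Z² 4Z

-- The derivative of the even relation

λᴮ λᴬ μᴰ μᶜ : PS
λᴮ = lin (+ 0) (+ 0) (+ 8) -[1+ 39 ] (+ 32)
λᴬ = λᴮ +ˢ (B *ˢ B -ˢ A *ˢ A)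
μᴰ = const (+ 5) *ˢ lin₅ (+ 0) (+ 0) (+ 8) -[1+ 39 ] (+ 32)
μᶜ = μᴰ +ˢ const (+ 5) *ˢ (Δ *ˢ Δ -ˢ C *ˢ C)

Dlog-B : Dlog B λᴮ
Dlog-B = Dlog-cong ≈-refl (solve 4 (λ f₁ f₂ f₄ f₈ → let M = linᴾ f₁ f₂ f₄ f₈ in
    con (+ 2) :* M (+ 0) (+ 0) (+ 2) -[1+ 9 ] (+ 8) :+ con (+ 2) :* M (+ 0) (+ 0) (+ 2) -[1+ 9 ] (+ 8) := M (+ 0) (+ 0) (+ 8) -[1+ 39 ] (+ 32)) ≈-refl s₁ s₂ s₄ s₈)
  (Dlog-* Dlog-F₂₂ Dlog-F₂₂)

-- Obtained from D A = D (a²) - D B: the logarithmic derivatives of a² and B differ by A (B - A), by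
-- `AB-value` and `A²-value`.
Dlog-A : Dlog A λᴬ
Dlog-A = comb₃ (solve 8 (λ A B DA DB f₁ f₂ f₄ f₈ →
    let M = linᴾ f₁ f₂ f₄ f₈
        α = M (+ 0) (+ 2) -[1+ 9 ] (+ 8) (+ 0)
        lam = M (+ 0) (+ 0) (+ 8) -[1+ 39 ] (+ 32)
    in DA := A :* (lam :+ (B :* B :- A :* A))
       :+ con (+ 1) :* ((DA :+ DB) :- (A :+ B) :* (α :+ α))
       :+ con -[1+ 0 ] :* (DB :- B :* lam)
       :+ (:- (A :+ B)) :* ((A :* B :- A :* A) :- (M (+ 0) (+ 4) -[1+ 11 ] (+ 8) (+ 0) :- M (+ 0) (+ 0) (+ 16) -[1+ 47 ] (+ 32)))) ≈-refl
    A B (D A) (D B) s₁ s₂ s₄ s₈)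
  (≈-trans (≈-sym (D-+ˢ A B)) (Dlog-cong a²≈A+B ≈-refl (Dlog-* Dlog-F₁₁ Dlog-F₁₁)))
  Dlog-B
  (+-cong AB-value (-‿cong A²-value))

Dlog-Δ : Dlog Δ μᴰ
Dlog-Δ = Dlog-cong dil₅-B (*-cong ≈-refl (dil₅-lin (+ 0) (+ 0) (+ 8) -[1+ 39 ] (+ 32))) (Dlog-dil 5 Dlog-B)

Dlog-C : Dlog C μᶜ
Dlog-C = Dlog-cong dil₅-A (≈-trans (*-cong ≈-refl (≈-trans (dil-+ˢ 5 _ _) (+-cong (dil₅-lin (+ 0) (+ 0) (+ 8) -[1+ 39 ] (+ 32))
    (≈-trans (dil-+ˢ 5 _ _) (+-cong (≈-trans (dil-*ˢ 5 B B) (*-cong dil₅-B dil₅-B))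
      (≈-trans (dil-neg 5 _) (-‿cong (≈-trans (dil-*ˢ 5 A A) (*-cong dil₅-A dil₅-A)))))))))
    (distribˡ _ _ _))
  (Dlog-dil 5 Dlog-A)

D-0ˢ : D 0ˢ ≈ 0ˢ
D-0ˢ = coeffs λ n → trans (D-coeff 0ˢ n) (trans (cong (ℤ._*_ (+ n)) (0ˢ-coeff n)) (trans (ℤP.*-zeroʳ (+ n)) (sym (0ˢ-coeff n))))

-- Because `R₁` is homogeneous, the left side equals 2 y₁ (λᴮ - μᴰ) + 2 μᴰ R₁ plus a quartic in A,
-- B, C, Δ, with `y₁` as defined below. On the curve this determines λᴮ - μᴰ.
D-R₁ : A *ˢ A *ˢ (λᴬ +ˢ λᴬ) +ˢ const -[1+ 5 ] *ˢ (A *ˢ C *ˢ (λᴬ +ˢ μᶜ)) +ˢ const (+ 5) *ˢ (C *ˢ C *ˢ (μᶜ +ˢ μᶜ))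
       +ˢ B *ˢ B *ˢ (λᴮ +ˢ λᴮ) +ˢ const -[1+ 5 ] *ˢ (B *ˢ Δ *ˢ (λᴮ +ˢ μᴰ)) +ˢ const (+ 5) *ˢ (Δ *ˢ Δ *ˢ (μᴰ +ˢ μᴰ)) ≈ 0ˢ
D-R₁ = ≈-trans (≈-sym (sum (sum (sum (sum (sum (Dlog-* Dlog-A Dlog-A) (scaled -[1+ 5 ] (Dlog-* Dlog-A Dlog-C))) (scaled (+ 5) (Dlog-* Dlog-C Dlog-C)))
         (Dlog-* Dlog-B Dlog-B)) (scaled -[1+ 5 ] (Dlog-* Dlog-B Dlog-Δ))) (scaled (+ 5) (Dlog-* Dlog-Δ Dlog-Δ))))
  (≈-trans (D-cong (≈-trans (solve 4 (λ A B C D → A :* A :+ con -[1+ 5 ] :* (A :* C) :+ con (+ 5) :* (C :* C) :+ B :* B :+ con -[1+ 5 ] :* (B :* D) :+ con (+ 5) :* (D :* D) := ρ₁ A B C D) ≈-refl A B C Δ) R₁≈0)) D-0ˢ)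
  where
  sum : ∀ {f f′ g g′} → D f ≈ f′ → D g ≈ g′ → D (f +ˢ g) ≈ f′ +ˢ g′
  sum e e′ = ≈-trans (D-+ˢ _ _) (+-cong e e′)
  scaled : ∀ c {f f′} → D f ≈ f′ → D (const c *ˢ f) ≈ const c *ˢ f′
  scaled c e = ≈-trans (D-const* c _) (*-cong ≈-refl e)

-- On the curve, the cubic c₃ equals 8 C T and 2 C V. The cofactors l₁, l₂, l₃ express this in the ideal generated by
-- ρ₁ and 16 A B C D - w²; the factor v removes the extraneous component A : B = C : D of that ideal.
module _ {n : ℕ} (A B C D : Polynomial n) where
  quadᴾ y₁ᴾ c₃ᴾ vᴾ wᴾ l₁ᴾ l₂ᴾ l₃ᴾ : Polynomial n
  quadᴾ = con (+ 2) :* A :* A :+ A :* B :- B :* B :+ A :* D :- B :* C :- con (+ 10) :* C :* C :- con (+ 5) :* C :* D :+ con (+ 5) :* D :* D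
  y₁ᴾ   = A :* A :- con (+ 3) :* A :* C :+ B :* B :- con (+ 3) :* B :* D
  c₃ᴾ   = A :* B :* B :+ con (+ 2) :* A :* B :* C :- con (+ 2) :* A :* B :* D :+ con (+ 2) :* A :* C :* D :+ A :* D :* D :- B :* B :* C
            :- con (+ 2) :* B :* C :* C :- con (+ 2) :* B :* C :* D :- con (+ 10) :* C :* C :* D :- con (+ 5) :* C :* D :* D
  vᴾ    = B :* C :- A :* D
  wᴾ    = A :* B :- A :* D :- B :* C :+ con (+ 5) :* C :* D
  l₁ᴾ   = con -[1+ 24 ] :* C :* C :* D :* D :* D :- con (+ 5) :* B :* C :* C :* D :* D :+ con (+ 20) :* B :* C :* C :* C :* C :+ B :* B :* C :* C :* D
            :+ B :* B :* B :* C :* C :+ con (+ 10) :* A :* C :* D :* D :* D :- con (+ 20) :* A :* C :* C :* C :* D :+ A :* B :* C :* D :* D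
            :+ A :* B :* B :* B :* C :- A :* A :* D :* D :* D :+ con (+ 2) :* A :* A :* B :* D :* D :- A :* A :* B :* B :* D
  l₂ᴾ   = con -[1+ 4 ] :* D :* D :* D :- con (+ 5) :* C :* C :* D :+ con (+ 3) :* B :* D :* D :+ con (+ 5) :* B :* C :* C :- con (+ 2) :* A :* C :* D
  l₃ᴾ   = D :* D :+ con (+ 4) :* C :* D :+ con (+ 4) :* C :* C :- con (+ 2) :* B :* D :+ con (+ 4) :* B :* C :+ B :* B

-- `quad` is read off from the third formula: four times its right side becomes `V` once the divisor
-- sums and cusp forms are expressed through the monomials in A, B, C, Δ. `y₁` is half the
-- coefficient of λᴮ in the derivative of `R₁`.
quad y₁ v c₃ V T : PS
quad = const (+ 2) *ˢ A *ˢ A +ˢ A *ˢ B -ˢ B *ˢ B +ˢ A *ˢ Δ -ˢ B *ˢ C -ˢ const (+ 10) *ˢ C *ˢ C -ˢ const (+ 5) *ˢ C *ˢ Δ +ˢ const (+ 5) *ˢ Δ *ˢ Δ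
y₁   = A *ˢ A -ˢ const (+ 3) *ˢ A *ˢ C +ˢ B *ˢ B -ˢ const (+ 3) *ˢ B *ˢ Δ
v    = B *ˢ C -ˢ A *ˢ Δ
c₃   = A *ˢ B *ˢ B +ˢ const (+ 2) *ˢ A *ˢ B *ˢ C -ˢ const (+ 2) *ˢ A *ˢ B *ˢ Δ +ˢ const (+ 2) *ˢ A *ˢ C *ˢ Δ +ˢ A *ˢ Δ *ˢ Δ -ˢ B *ˢ B *ˢ C
         -ˢ const (+ 2) *ˢ B *ˢ C *ˢ C -ˢ const (+ 2) *ˢ B *ˢ C *ˢ Δ -ˢ const (+ 10) *ˢ C *ˢ C *ˢ Δ -ˢ const (+ 5) *ˢ C *ˢ Δ *ˢ Δ
V    = const (+ 2) *ˢ (μᴰ -ˢ λᴮ) +ˢ quad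
T    = a *ˢ b *ˢ (c *ˢ d)

opaque
  unfolding θ _+ˢ_ dil
  y₁-zero : y₁ 0 ≡ -[1+ 1 ]
  y₁-zero = refl
  v-zero : v 0 ≡ + 0
  v-zero = refl
  v-one : v 1 ≡ -[1+ 3 ]
  v-one = refl
  C-five : C 5 ≡ + 4
  C-five = refl
  V+4T-zero : (V +ˢ const (+ 4) *ˢ T) 0 ≡ + 8
  V+4T-zero = refl

cancel-nonzero : ∀ n f {g h m} → (∀ i → i < n → f i ≡ + 0) → f n ≡ m → m ≢ + 0 → f *ˢ g ≈ f *ˢ h → g ≈ h
cancel-nonzero n f low lead m≢0 = *ˢ-cancelˡ n f low (λ e → m≢0 (trans (sym lead) e))

C-low : ∀ i → i < 5 → C i ≡ + 0
C-low i i<5 = tm-*-< (+ 1) 5 (r *ˢ r) i i<5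

v-low : ∀ i → i < 1 → v i ≡ + 0
v-low zero    _        = v-zero
v-low (suc i) (s≤s ())

c₃≈2CV : c₃ ≈ const (+ 2) *ˢ C *ˢ V
c₃≈2CV = cancel-nonzero 0 y₁ (λ _ ()) y₁-zero (λ ()) (cancel-nonzero 1 v v-low v-one (λ ())
  (comb₃ (solve 6 (λ A B C D lam mu →
     let λA = lam :+ (B :* B :- A :* A)
         μC = mu :+ con (+ 5) :* (D :* D :- C :* C)
         DR = A :* A :* (λA :+ λA) :+ con -[1+ 5 ] :* (A :* C :* (λA :+ μC)) :+ con (+ 5) :* (C :* C :* (μC :+ μC))
              :+ B :* B :* (lam :+ lam) :+ con -[1+ 5 ] :* (B :* D :* (lam :+ mu)) :+ con (+ 5) :* (D :* D :* (mu :+ mu))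
         V  = con (+ 2) :* (mu :- lam) :+ quadᴾ A B C D
         y  = y₁ᴾ A B C D
         v  = vᴾ A B C D
     in v :* (y :* c₃ᴾ A B C D) := v :* (y :* (con (+ 2) :* C :* V))
        :+ v :* (con (+ 2) :* C) :* (DR :- con (+ 0))
        -- The term -4 v C mu removes the multiple 2 μᴰ R₁ contained in the derivative; `l₁ᴾ`
        -- belongs to the part free of logarithmic derivatives.
        :+ (l₁ᴾ A B C D :- con (+ 4) :* v :* C :* mu) :* (ρ₁ A B C D :- con (+ 0))
        :+ l₂ᴾ A B C D :* (con (+ 16) :* A :* B :* C :* D :- wᴾ A B C D :* wᴾ A B C D)) ≈-refl
     A B C Δ λᴮ μᴰ)
   D-R₁ R₁≈0 16ABCΔ))

T² : T *ˢ T ≈ (A +ˢ B) *ˢ B *ˢ ((C +ˢ Δ) *ˢ Δ)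
T² = ≈-trans (solve 4 (λ a b c d → (a :* b :* (c :* d)) :* (a :* b :* (c :* d)) := a :* a :* (b :* b) :* (c :* c :* (d :* d))) ≈-refl a b c d)
  (*-cong (*-cong a²≈A+B ≈-refl) (*-cong c²≈C+Δ ≈-refl))

-- Only the square of T is a polynomial in A, B, C, Δ, so c₃ = 8 C T can at first be shown only in
-- squared form.
c₃² : c₃ *ˢ c₃ ≈ const (+ 64) *ˢ C *ˢ C *ˢ (T *ˢ T)
c₃² = comb₃ (solve 5 (λ A B C D T → c₃ᴾ A B C D :* c₃ᴾ A B C D := con (+ 64) :* C :* C :* (T :* T)
     :+ (:- (con (+ 64) :* C :* C)) :* (T :* T :- (A :+ B) :* B :* ((C :+ D) :* D))
     :+ con (+ 16) :* B :* C :* C :* D :* (ρ₁ A B C D :- con (+ 0))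
     :+ (:- l₃ᴾ A B C D) :* (con (+ 16) :* A :* B :* C :* D :- wᴾ A B C D :* wᴾ A B C D)) ≈-refl A B C Δ T)
  T² R₁≈0 16ABCΔ

V≈4T : V ≈ const (+ 4) *ˢ T
-- In (V + 4 T) (V - 4 T) = 0 the first factor has constant term 8, namely 4 from `quad` and 4 from
-- 4 T, so it can be cancelled.
V≈4T = cancel-nonzero 0 (V +ˢ const (+ 4) *ˢ T) (λ _ ()) V+4T-zero (λ ())
  (≈-trans (solve 2 (λ V T → (V :+ con (+ 4) :* T) :* V := V :* V :+ con (+ 4) :* T :* V) ≈-refl V T)
  (≈-trans (+-cong V²≈16T² ≈-refl)
    (solve 2 (λ V T → con (+ 16) :* (T :* T) :+ con (+ 4) :* T :* V := (V :+ con (+ 4) :* T) :* (con (+ 4) :* T)) ≈-refl V T)))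
  where
  V²≈16T² : V *ˢ V ≈ const (+ 16) *ˢ (T *ˢ T)
  V²≈16T² = cancel-nonzero 5 C C-low C-five (λ ()) (cancel-nonzero 5 C C-low C-five (λ ()) (const-cancel (+ 4) (λ ())
    (comb₂ (solve 4 (λ C V T c₃ → con (+ 4) :* (C :* (C :* (V :* V))) := con (+ 4) :* (C :* (C :* (con (+ 16) :* (T :* T))))
       :+ (:- (c₃ :+ con (+ 2) :* C :* V)) :* (c₃ :- con (+ 2) :* C :* V) :+ con (+ 1) :* (c₃ :* c₃ :- con (+ 64) :* C :* C :* (T :* T))) ≈-refl C V T c₃)
     c₃≈2CV c₃²)))

-- The four theta identities

theta-1155 : const (+ 3) *ˢ (a *ˢ a *ˢ (c *ˢ c)) ≈
  lin (+ 0) (+ 4) (+ 0) -[1+ 15 ] (+ 0) +ˢ lin₅ (+ 3) (+ 20) (+ 0) -[1+ 79 ] (+ 0) +ˢ const (+ 8) *ˢ α₁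
theta-1155 = const-cancel (+ 2) (λ ()) (comb₃ (solve 11 (λ a c α f₁ f₂ f₄ f₈ f₅ f₁₀ f₂₀ f₄₀ → let M = linᴾ f₁ f₂ f₄ f₈ ; M₅ = linᴾ f₅ f₁₀ f₂₀ f₄₀ in
    con (+ 2) :* (con (+ 3) :* (a :* a :* (c :* c))) :=
    con (+ 2) :* (M (+ 0) (+ 4) (+ 0) -[1+ 15 ] (+ 0) :+ M₅ (+ 3) (+ 20) (+ 0) -[1+ 79 ] (+ 0) :+ con (+ 8) :* α)
    -- Expanded, `level-20` says 6 a² c² = a⁴ + 5 c⁴ + 16 α₁.
    :+ con (+ 1) :* (a :* a :* (a :* a) :- M (+ 1) (+ 8) (+ 0) -[1+ 31 ] (+ 0))
    :+ con (+ 5) :* (c :* c :* (c :* c) :- M₅ (+ 1) (+ 8) (+ 0) -[1+ 31 ] (+ 0))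
    :+ con (+ 1) :* ((a :* a :- c :* c) :* (con (+ 5) :* (c :* c) :- a :* a) :- con (+ 16) :* α)) ≈-refl
    a c α₁ s₁ s₂ s₄ s₈ s₅ s₁₀ s₂₀ s₄₀)
  four-squares c⁴-value level-20)

-- Three times the Eisenstein part shared by the second and fourth formulas, which differ only in
-- their cusp forms.
eisenstein : PS
eisenstein = lin (+ 3) (+ 2) -[1+ 1 ] (+ 4) -[1+ 15 ] +ˢ lin₅ (+ 0) (+ 10) -[1+ 9 ] (+ 20) -[1+ 79 ]

-- The sum of a² d² and b² c² is A Δ + B C + 2 B Δ, accessible through `odd-part` and `level-40`.
-- Their difference is A Δ - B C, so `AΔ-BC` separates the two afterwards.
theta-even : const (+ 3) *ˢ ((A +ˢ B) *ˢ Δ +ˢ B *ˢ (C +ˢ Δ)) ≈ const (+ 2) *ˢ eisenstein +ˢ const (+ 8) *ˢ α₁ +ˢ const (+ 16) *ˢ α₂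
theta-even = const-cancel (+ 2) (λ ()) (comb₃ (solve 14 (λ A B C D α₁ α₂ f₁ f₂ f₄ f₈ f₅ f₁₀ f₂₀ f₄₀ → let M = linᴾ f₁ f₂ f₄ f₈ ; M₅ = linᴾ f₅ f₁₀ f₂₀ f₄₀ in
    con (+ 2) :* (con (+ 3) :* ((A :+ B) :* D :+ B :* (C :+ D))) :=
    con (+ 2) :* (con (+ 2) :* (M (+ 3) (+ 2) -[1+ 1 ] (+ 4) -[1+ 15 ] :+ M₅ (+ 0) (+ 10) -[1+ 9 ] (+ 20) -[1+ 79 ]) :+ con (+ 8) :* α₁ :+ con (+ 16) :* α₂)
    :+ con (+ 2) :* (((A :* B :+ B :* B) :+ con (+ 5) :* (C :* D :+ D :* D))
         :- ((M (+ 0) (+ 4) -[1+ 11 ] (+ 8) (+ 0) :+ M (+ 1) (+ 0) (+ 8) (+ 0) -[1+ 31 ])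
             :+ con (+ 5) :* (M₅ (+ 0) (+ 4) -[1+ 11 ] (+ 8) (+ 0) :+ M₅ (+ 1) (+ 0) (+ 8) (+ 0) -[1+ 31 ])))
    :+ con (+ 1) :* ((con (+ 6) :* (A :* D) :+ con (+ 6) :* (B :* C) :- con (+ 2) :* (A :* B) :- con (+ 10) :* (C :* D)) :- con (+ 16) :* α₁)
    :+ con (+ 2) :* ((B :- D) :* (con (+ 5) :* D :- B) :- con (+ 16) :* α₂)) ≈-refl
    A B C Δ α₁ α₂ s₁ s₂ s₄ s₈ s₅ s₁₀ s₂₀ s₄₀)
  (+-cong (+-cong AB-value B²-value) (*-cong ≈-refl (+-cong CΔ-value Δ²-value))) odd-part level-40)

theta-1-1-10-10 : const (+ 3) *ˢ (a *ˢ a *ˢ (d *ˢ d)) ≈ eisenstein +ˢ const (+ 10) *ˢ α₁ +ˢ const (+ 8) *ˢ α₂ +ˢ const (+ 12) *ˢ α₃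
theta-1-1-10-10 = const-cancel (+ 2) (λ ()) (comb₃ (solve 9 (λ A B C D e α₁ α₂ α₃ x →
    con (+ 2) :* (con (+ 3) :* (x :* D)) :=
    con (+ 2) :* (e :+ con (+ 10) :* α₁ :+ con (+ 8) :* α₂ :+ con (+ 12) :* α₃)
    :+ con (+ 1) :* (con (+ 3) :* ((A :+ B) :* D :+ B :* (C :+ D)) :- (con (+ 2) :* e :+ con (+ 8) :* α₁ :+ con (+ 16) :* α₂))
    :+ con (+ 3) :* ((A :* D :- B :* C) :- (con (+ 4) :* α₁ :+ con (+ 8) :* α₃))
    :+ con (+ 6) :* D :* (x :- (A :+ B))) ≈-refl A B C Δ eisenstein α₁ α₂ α₃ (a *ˢ a))
  theta-even AΔ-BC a²≈A+B)

theta-2255 : const (+ 3) *ˢ (b *ˢ b *ˢ (c *ˢ c)) ≈ eisenstein -ˢ const (+ 2) *ˢ α₁ +ˢ const (+ 8) *ˢ α₂ -ˢ const (+ 12) *ˢ α₃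
theta-2255 = const-cancel (+ 2) (λ ()) (comb₃ (solve 9 (λ A B C D e α₁ α₂ α₃ x →
    con (+ 2) :* (con (+ 3) :* (B :* x)) :=
    con (+ 2) :* (e :- con (+ 2) :* α₁ :+ con (+ 8) :* α₂ :- con (+ 12) :* α₃)
    :+ con (+ 1) :* (con (+ 3) :* ((A :+ B) :* D :+ B :* (C :+ D)) :- (con (+ 2) :* e :+ con (+ 8) :* α₁ :+ con (+ 16) :* α₂))
    :+ con -[1+ 2 ] :* ((A :* D :- B :* C) :- (con (+ 4) :* α₁ :+ con (+ 8) :* α₃))
    :+ con (+ 6) :* B :* (x :- (C :+ D))) ≈-refl A B C Δ eisenstein α₁ α₂ α₃ (c *ˢ c))
  theta-even AΔ-BC c²≈C+Δ)

theta-1-2-5-10 : T ≈ lin (+ 0) (+ 1) -[1+ 0 ] -[1+ 1 ] (+ 8) +ˢ lin₅ (+ 1) -[1+ 4 ] (+ 5) (+ 10) -[1+ 39 ] +ˢ α₁ +ˢ const (+ 2) *ˢ α₃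
theta-1-2-5-10 = const-cancel (+ 4) (λ ()) (≈-trans (≈-sym V≈4T) (comb₃ (solve 14 (λ A B C D α₁ α₃ f₁ f₂ f₄ f₈ f₅ f₁₀ f₂₀ f₄₀ →
    let M   = linᴾ f₁ f₂ f₄ f₈
        M₅  = linᴾ f₅ f₁₀ f₂₀ f₄₀
        lam = M (+ 0) (+ 0) (+ 8) -[1+ 39 ] (+ 32)
        mu  = con (+ 5) :* M₅ (+ 0) (+ 0) (+ 8) -[1+ 39 ] (+ 32)
    in con (+ 2) :* (mu :- lam) :+ quadᴾ A B C D :=
       con (+ 4) :* (M (+ 0) (+ 1) -[1+ 0 ] -[1+ 1 ] (+ 8) :+ M₅ (+ 1) -[1+ 4 ] (+ 5) (+ 10) -[1+ 39 ] :+ α₁ :+ con (+ 2) :* α₃)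
       :+ con (+ 1) :* ((con (+ 2) :* (A :* A) :+ A :* B :- B :* B)
            :- (con (+ 2) :* M (+ 0) (+ 0) (+ 16) -[1+ 47 ] (+ 32) :+ M (+ 0) (+ 4) -[1+ 11 ] (+ 8) (+ 0) :- M (+ 1) (+ 0) (+ 8) (+ 0) -[1+ 31 ]))
       :+ con -[1+ 4 ] :* ((con (+ 2) :* (C :* C) :+ C :* D :- D :* D)
            :- (con (+ 2) :* M₅ (+ 0) (+ 0) (+ 16) -[1+ 47 ] (+ 32) :+ M₅ (+ 0) (+ 4) -[1+ 11 ] (+ 8) (+ 0) :- M₅ (+ 1) (+ 0) (+ 8) (+ 0) -[1+ 31 ]))
       :+ con (+ 1) :* ((A :* D :- B :* C) :- (con (+ 4) :* α₁ :+ con (+ 8) :* α₃))) ≈-refl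
    A B C Δ α₁ α₃ s₁ s₂ s₄ s₈ s₅ s₁₀ s₂₀ s₄₀)
  (+-cong (+-cong (*-cong ≈-refl A²-value) AB-value) (-‿cong B²-value))
  (+-cong (+-cong (*-cong ≈-refl C²-value) CΔ-value) (-‿cong Δ²-value))
  AΔ-BC))

-- Eta quotients

⊛≈*ˢ : ∀ f g → f ⊛ g ≈ f *ˢ g
⊛≈*ˢ f g = coeffs λ n → trans (⊛≡conv f g n) (sym (*ˢ-coeff f g n))

⊛-cong[] : ∀ {f f′ g g′ n} → f ≈[ n ] f′ → g ≈[ n ] g′ → f ⊛ g ≈[ n ] f′ *ˢ g′
⊛-cong[] {f} {g = g} e e′ = ≈[]-trans (≈⇒≈[] (⊛≈*ˢ f g)) (*-cong[] e e′)

one≈1ˢ : one ≈ 1ˢ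
one≈1ˢ = coeffs λ { zero → sym (const-zero (+ 1)) ; (suc n) → sym (const-suc (+ 1) n) }

^ˢ2 : ∀ {f g n} → f ≈[ n ] g → f ^ˢ 2 ≈[ n ] g *ˢ g
^ˢ2 e = ⊛-cong[] e (≈[]-trans (⊛-cong[] e (≈⇒≈[] one≈1ˢ)) (≈⇒≈[] (*-identityʳ _)))

^ˢ5 : ∀ {f g n} → f ≈[ n ] g → f ^ˢ 5 ≈[ n ] g *ˢ (g *ˢ (g *ˢ (g *ˢ g)))
^ˢ5 e = ⊛-cong[] e (⊛-cong[] e (⊛-cong[] e (^ˢ2 e)))

oneMinus-factor : ∀ k .{{_ : NonZero k}} → oneMinus k ≈ 1ˢ -ˢ q^ k
oneMinus-factor (suc k) = coeffs λ n → trans (go n) (sym (trans (+ˢ-coeff 1ˢ _ n) (cong (ℤ._+_ (1ˢ n)) (-ˢ-coeff (q^ (suc k)) n))))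
  where
  go : ∀ n → oneMinus (suc k) n ≡ 1ˢ n ℤ.+ ℤ.- q^ (suc k) n
  go zero    = cong (ℤ._+ + 0) (sym (const-zero (+ 1)))
  go (suc n) with suc n ℕ.≟ suc k
  ... | yes n≡k  = trans (cong (λ z → if z then ℤ.- (+ 1) else + 0) (dec-true (suc n ℕ.≟ suc k) n≡k))
                     (sym (cong₂ ℤ._+_ (const-suc (+ 1) n) (cong ℤ.-_ (trans (cong (q^ (suc k)) n≡k) (tm-diag (+ 1) k)))))
  ... | no  n≢k  = trans (cong (λ z → if z then ℤ.- (+ 1) else + 0) (dec-false (suc n ℕ.≟ suc k) n≢k))
                     (sym (cong₂ ℤ._+_ (const-suc (+ 1) n) (cong ℤ.-_ (tm-off (+ 1) (suc k) (suc n) n≢k))))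

Eprod-prod : ∀ k .{{_ : NonZero k}} M → Eprod k M ≈ prod (multiples k) M
Eprod-prod k zero    = one≈1ˢ
Eprod-prod k (suc M) = ≈-trans (⊛≈*ˢ _ _) (*-cong (oneMinus-factor (k ℕ.* suc M) {{ℕP.m*n≢0 k (suc M)}}) (Eprod-prod k M))

Eprod-E : ∀ k .{{_ : NonZero k}} n → Eprod k n ≈[ n ] E k
Eprod-E k n = ≈[]-trans (≈⇒≈[] (Eprod-prod k n)) (≈[]-sym (E-prod k n n ℕP.≤-refl))

Einv-prod : ∀ k .{{_ : NonZero k}} M → Einv k M *ˢ prod (multiples k) M ≈ 1ˢ
Einv-prod k zero    = ≈-trans (*-cong one≈1ˢ ≈-refl) (*-identityˡ _)
Einv-prod k (suc M) = ≈-trans (*-cong (≈-trans (⊛≈*ˢ _ _) (*-cong geom≈ ≈-refl)) ≈-refl)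
  (comb₂ (solve 4 (λ g i f p → g :* i :* (f :* p) := con (+ 1) :+ i :* p :* (f :* g :- con (+ 1)) :+ con (+ 1) :* (i :* p :- con (+ 1))) ≈-refl
    (dil (k ℕ.* suc M) ones) (Einv k M) (1ˢ -ˢ q^ (k ℕ.* suc M)) (prod (multiples k) M)) (factor*ones (k ℕ.* suc M)) (Einv-prod k M))
  where
  instance
    nonZero : NonZero (k ℕ.* suc M)
    nonZero = ℕP.m*n≢0 k (suc M)
  geom≈ : geom (k ℕ.* suc M) ≈ dil (k ℕ.* suc M) ones
  geom≈ = coeffs λ n → sym (dil-coeff (k ℕ.* suc M) ones n)

Einv-E : ∀ k .{{_ : NonZero k}} n → Einv k n *ˢ E k ≈[ n ] 1ˢ
Einv-E k n = ≈[]-trans (*-cong[] (≈⇒≈[] ≈-refl) (E-prod k n n ℕP.≤-refl)) (≈⇒≈[] (Einv-prod k n))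

shift-coeff : ∀ k {f g} n → f ≈[ n ] g → shift k f n ≡ (q^ k *ˢ g) n
shift-coeff k {f} n e = trans (shift≡q^* k f n) (coeff≤ (*-cong[] (≈⇒≈[] (≈-refl {q^ k})) e) n ℕP.≤-refl)

a₁≡ : ∀ n → a₁ n ≡ α₁ n
a₁≡ n = shift-coeff 1 n (≈[]-trans (⊛-cong[] (^ˢ2 (Eprod-E 2 n)) (^ˢ2 (Eprod-E 10 n)))
  (≈⇒≈[] (solve 2 (λ x y → x :* x :* (y :* y) := x :* y :* (x :* y)) ≈-refl (E 2) (E 10))))

a₂≡ : ∀ n → a₂ n ≡ α₂ n
a₂≡ n = shift-coeff 2 n (≈[]-trans (⊛-cong[] (^ˢ2 (Eprod-E 4 n)) (^ˢ2 (Eprod-E 20 n)))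
  (≈⇒≈[] (solve 2 (λ x y → x :* x :* (y :* y) := x :* y :* (x :* y)) ≈-refl (E 4) (E 20))))

F₂₂-eta : b *ˢ (E 2 *ˢ E 2) *ˢ (E 8 *ˢ E 8) ≈ E 4 *ˢ E 4 *ˢ (E 4 *ˢ E 4) *ˢ E 4
F₂₂-eta = ≈-trans (≈-sym (dil-product (dil-product (θ-dil 2 plain 1 1 2 2 refl refl) (dil-product e₂ e₂)) (dil-product e₈ e₈)))
  (≈-trans (dil-cong 2 F₁₁-eta) (dil-product (dil-product (dil-product e₄ e₄) (dil-product e₄ e₄)) e₄))
  where
  dil-product : ∀ {f g f′ g′} → dil 2 f ≈ f′ → dil 2 g ≈ g′ → dil 2 (f *ˢ g) ≈ f′ *ˢ g′
  dil-product e e′ = ≈-trans (dil-*ˢ 2 _ _) (*-cong e e′)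
  e₂ = dil-E 2 1 2 refl
  e₄ = dil-E 2 2 4 refl
  e₈ = dil-E 2 4 8 refl

F₆₀₂₀-eta : F 60 20 *ˢ E 20 ≈ E 40 *ˢ E 40
F₆₀₂₀-eta = ≈-trans (≈-sym (≈-trans (dil-*ˢ 10 _ _) (*-cong (θ-dil 10 plain 6 2 60 20 refl refl) (dil-E 10 2 20 refl))))
  (≈-trans (dil-cong 10 F₆₂-eta) (≈-trans (dil-*ˢ 10 _ _) (*-cong (dil-E 10 4 40 refl) (dil-E 10 4 40 refl))))

-- Multiplying by E 2 · (E 8)² · E 20 clears the truncated inverses in `a₃` and, at the same time,
-- the denominators of the eta quotients of φ(q²) and ψ(q²⁰).
a₃≡ : ∀ n → a₃ n ≡ α₃ n
a₃≡ n = shift-coeff 3 n (≈[]-trans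
    (⊛-cong[] (⊛-cong[] (⊛-cong[] (⊛-cong[] (⊛-cong[] (^ˢ5 (Eprod-E 4 n)) (Eprod-E 10 n)) (^ˢ2 (Eprod-E 40 n))) (≈⇒≈[] (≈-refl {i₂}))) (^ˢ2 (≈⇒≈[] (≈-refl {i₈})))) (≈⇒≈[] (≈-refl {i₂₀})))
    (unit-cancel[] (E 2) n (E-zero 2) (unit-cancel[] (E 8) n (E-zero 8) (unit-cancel[] (E 8) n (E-zero 8) (unit-cancel[] (E 20) n (E-zero 20)
      (≈[]-trans (≈[]-trans
        (≈⇒≈[] (solve 9 (λ e₂ e₈ e₂₀ e₄ e₁₀ e₄₀ i₂ i₈ i₂₀ → e₂₀ :* (e₈ :* (e₈ :* (e₂ :* (e₄ :* (e₄ :* (e₄ :* (e₄ :* e₄))) :* e₁₀ :* (e₄₀ :* e₄₀) :* i₂ :* (i₈ :* i₈) :* i₂₀)))) :=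
           e₄ :* (e₄ :* (e₄ :* (e₄ :* e₄))) :* e₁₀ :* (e₄₀ :* e₄₀) :* (i₂ :* e₂ :* (i₈ :* e₈ :* (i₈ :* e₈)) :* (i₂₀ :* e₂₀))) ≈-refl
           (E 2) (E 8) (E 20) (E 4) (E 10) (E 40) i₂ i₈ i₂₀))
        (*-cong[] (≈⇒≈[] ≈-refl) (*-cong[] (*-cong[] (Einv-E 2 n) (*-cong[] (Einv-E 8 n) (Einv-E 8 n))) (Einv-E 20 n))))
      (≈⇒≈[] (comb₂ (solve 8 (λ e₂ e₈ e₂₀ e₄ e₁₀ e₄₀ b f → e₄ :* (e₄ :* (e₄ :* (e₄ :* e₄))) :* e₁₀ :* (e₄₀ :* e₄₀) :* (con (+ 1) :* (con (+ 1) :* con (+ 1)) :* con (+ 1)) :=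
           e₂₀ :* (e₈ :* (e₈ :* (e₂ :* (b :* (e₂ :* e₁₀) :* f))))
           :+ (:- (e₁₀ :* f :* e₂₀)) :* (b :* (e₂ :* e₂) :* (e₈ :* e₈) :- e₄ :* e₄ :* (e₄ :* e₄) :* e₄)
           :+ (:- (e₄ :* e₄ :* (e₄ :* e₄) :* e₄ :* e₁₀)) :* (f :* e₂₀ :- e₄₀ :* e₄₀)) ≈-refl
           (E 2) (E 8) (E 20) (E 4) (E 10) (E 40) b (F 60 20)) F₂₂-eta F₆₀₂₀-eta))))))))
  where
  i₂ i₈ i₂₀ : PS
  i₂  = Einv 2 n
  i₈  = Einv 8 n
  i₂₀ = Einv 20 n

-- Representation numbers

sumOver-++ : {X : Set} (f : X → ℤ) (xs ys : List X) → sumOver f (xs ++ ys) ≡ sumOver f xs ℤ.+ sumOver f ys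
sumOver-++ f []       ys = sym (ℤP.+-identityˡ _)
sumOver-++ f (x ∷ xs) ys = trans (cong (ℤ._+_ (f x)) (sumOver-++ f xs ys)) (sym (ℤP.+-assoc (f x) _ _))

sumOver-concatMap : {X Y : Set} (f : Y → ℤ) (g : X → List Y) (xs : List X) → sumOver f (concatMap g xs) ≡ sumOver (sumOver f ∘ g) xs
sumOver-concatMap f g []       = refl
sumOver-concatMap f g (x ∷ xs) = trans (sumOver-++ f (g x) (concatMap g xs)) (cong (ℤ._+_ (sumOver f (g x))) (sumOver-concatMap f g xs))

sumOver-map : {X Y : Set} (f : Y → ℤ) (g : X → Y) (xs : List X) → sumOver f (map g xs) ≡ sumOver (f ∘ g) xs
sumOver-map f g []       = refl
sumOver-map f g (x ∷ xs) = cong (ℤ._+_ (f (g x))) (sumOver-map f g xs)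

sumOver-cong : {X : Set} {f g : X → ℤ} (xs : List X) → (∀ x → f x ≡ g x) → sumOver f xs ≡ sumOver g xs
sumOver-cong []       p = refl
sumOver-cong (x ∷ xs) p = cong₂ ℤ._+_ (p x) (sumOver-cong xs p)

length-filter : {X : Set} {P : X → Set} (P? : ∀ x → Dec (P x)) (f : X → ℤ) → (∀ x → P x → f x ≡ + 1) → (∀ x → ¬ P x → f x ≡ + 0) →
                ∀ xs → + length (filter P? xs) ≡ sumOver f xs
length-filter P? f y n []       = refl
length-filter P? f y n (x ∷ xs) with P? x
... | yes p = cong₂ ℤ._+_ (sym (y x p)) (length-filter P? f y n xs)
... | no ¬p = trans (length-filter P? f y n xs) (sym (trans (cong (ℤ._+ sumOver f xs) (n x ¬p)) (ℤP.+-identityˡ _)))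

-- For r = s the exponent is k x², so the extra 1 of the general bound disappears and the box
-- [-n, n] of `N` contains every index that matters.
∣x∣≤ex : ∀ k .{{_ : NonZero k}} x → ℤ.∣ x ∣ ≤ ex k k x
∣x∣≤ex (suc k) x = ℕP.≤-trans (∣x∣≤tri x) (ℕP.+-mono-≤ (ℕP.m≤m+n (tri x) (k ℕ.* tri x)) (ℕP.m≤m+n (tri (ℤ.- x)) (k ℕ.* tri (ℤ.- x))))
  where
  ∣x∣≤tri : ∀ x → ℤ.∣ x ∣ ≤ tri x ℕ.+ tri (ℤ.- x)
  ∣x∣≤tri (+ n)    = ℕP.≤-trans (n≤triangle n) (ℕP.m≤m+n _ _)
  ∣x∣≤tri -[1+ n ] = ℕP.≤-trans (n≤triangle (suc n)) (ℕP.m≤n+m _ _)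

φ-truncated : ∀ k .{{_ : NonZero k}} n → F k k ≈[ n ] sumˢ (θ-term plain k k) (intsUpTo n)
φ-truncated k@(suc _) n = coeffs≤ λ i i≤n → trans (coeff≤ (sums S n) i i≤n) (trans (sumˢ-coeff _ (support S n) i)
  (trans (sumOver-unique (λ x → θ-term plain k k x i) (unique S n) (intsUpTo-unique n) (λ x → covers S n x i i≤n) (cover i i≤n))
  (sym (sumˢ-coeff _ (intsUpTo n) i))))
  where
  S = θ-sum plain k k
  cover : ∀ i → i ≤ n → ∀ x → θ-term plain k k x i ≢ + 0 → x ∈ intsUpTo n
  cover i i≤n x nz with i ℕ.≟ ex k k x
  ... | yes refl = ∈-intsUpTo n x (ℕP.≤-trans (∣x∣≤ex k x) i≤n)
  ... | no  i≢e  = contradiction (tm-off _ (ex k k x) i i≢e) nz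

ex-square : ∀ k x → + ex k k x ≡ + k ℤ.* (x ℤ.* x)
ex-square k x = ℤP.*-cancelˡ-≡ (+ 2) _ _ (trans (2*ex k k x) (lemma (+ k) x))
  where
  lemma : ∀ k x → k ℤ.* (x ℤ.* x ℤ.+ x) ℤ.+ k ℤ.* (x ℤ.* x ℤ.- x) ≡ + 2 ℤ.* (k ℤ.* (x ℤ.* x))
  lemma = solve-∀

sumOver-box : ∀ (f : ℤ × ℤ × ℤ × ℤ → ℤ) (xs : List ℤ) →
  sumOver f (concatMap (λ x₁ → concatMap (λ x₂ → concatMap (λ x₃ → map (λ x₄ → (x₁ , x₂ , x₃ , x₄)) xs) xs) xs) xs) ≡
  sumOver (λ x₁ → sumOver (λ x₂ → sumOver (λ x₃ → sumOver (λ x₄ → f (x₁ , x₂ , x₃ , x₄)) xs) xs) xs) xs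
sumOver-box f xs =
  trans (sumOver-concatMap f (λ x₁ → concatMap (λ x₂ → concatMap (λ x₃ → map (λ x₄ → (x₁ , x₂ , x₃ , x₄)) xs) xs) xs) xs) (sumOver-cong xs λ x₁ →
  trans (sumOver-concatMap f (λ x₂ → concatMap (λ x₃ → map (λ x₄ → (x₁ , x₂ , x₃ , x₄)) xs) xs) xs) (sumOver-cong xs λ x₂ →
  trans (sumOver-concatMap f (λ x₃ → map (λ x₄ → (x₁ , x₂ , x₃ , x₄)) xs) xs) (sumOver-cong xs λ x₃ →
  sumOver-map f (λ x₄ → (x₁ , x₂ , x₃ , x₄)) xs)))

-- Each lattice point of the box contributes the coefficient of qⁿ in the monomial q^form, which is
-- 1 on solutions and 0 elsewhere. Summed over the box, these monomials are the product of four
-- truncated theta series.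
N-theta : ∀ k₁ k₂ k₃ k₄ .{{_ : NonZero k₁}} .{{_ : NonZero k₂}} .{{_ : NonZero k₃}} .{{_ : NonZero k₄}} n →
          + N k₁ k₂ k₃ k₄ n ≡ (F k₁ k₁ *ˢ (F k₂ k₂ *ˢ (F k₃ k₃ *ˢ F k₄ k₄))) n
N-theta k₁ k₂ k₃ k₄ n = trans
  (length-filter (λ v → form v ℤ.≟ + n) indicator one-if zero-if
    (concatMap (λ x₁ → concatMap (λ x₂ → concatMap (λ x₃ → map (λ x₄ → (x₁ , x₂ , x₃ , x₄)) ints) ints) ints) ints))
  (trans (sumOver-box indicator ints)
  (trans (sym (coeff series n)) (sym (coeff≤ (*-cong[] (φ-truncated k₁ n) (*-cong[] (φ-truncated k₂ n) (*-cong[] (φ-truncated k₃ n) (φ-truncated k₄ n)))) n ℕP.≤-refl))))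
  where
  ints : List ℤ
  ints = intsUpTo n
  θ₁ θ₂ θ₃ θ₄ : ℤ → PS
  θ₁ = θ-term plain k₁ k₁
  θ₂ = θ-term plain k₂ k₂
  θ₃ = θ-term plain k₃ k₃
  θ₄ = θ-term plain k₄ k₄
  e : ℤ × ℤ × ℤ × ℤ → ℕ
  e (x₁ , x₂ , x₃ , x₄) = ex k₁ k₁ x₁ ℕ.+ (ex k₂ k₂ x₂ ℕ.+ (ex k₃ k₃ x₃ ℕ.+ ex k₄ k₄ x₄))
  indicator : ℤ × ℤ × ℤ × ℤ → ℤ
  indicator x = q^ (e x) n
  form : ℤ × ℤ × ℤ × ℤ → ℤ
  form (x₁ , x₂ , x₃ , x₄) = + k₁ ℤ.* (x₁ ℤ.* x₁) ℤ.+ + k₂ ℤ.* (x₂ ℤ.* x₂) ℤ.+ + k₃ ℤ.* (x₃ ℤ.* x₃) ℤ.+ + k₄ ℤ.* (x₄ ℤ.* x₄)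
  e-form : ∀ x → + e x ≡ form x
  e-form (x₁ , x₂ , x₃ , x₄) = trans (ℤP.pos-+ (ex k₁ k₁ x₁) _) (trans (cong₂ ℤ._+_ (ex-square k₁ x₁) (trans (ℤP.pos-+ (ex k₂ k₂ x₂) _)
    (cong₂ ℤ._+_ (ex-square k₂ x₂) (trans (ℤP.pos-+ (ex k₃ k₃ x₃) _) (cong₂ ℤ._+_ (ex-square k₃ x₃) (ex-square k₄ x₄))))))
    (lemma (+ k₁ ℤ.* (x₁ ℤ.* x₁)) (+ k₂ ℤ.* (x₂ ℤ.* x₂)) (+ k₃ ℤ.* (x₃ ℤ.* x₃)) (+ k₄ ℤ.* (x₄ ℤ.* x₄))))
    where
    lemma : ∀ w x y z → w ℤ.+ (x ℤ.+ (y ℤ.+ z)) ≡ w ℤ.+ x ℤ.+ y ℤ.+ z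
    lemma = solve-∀
  one-if : ∀ x → form x ≡ + n → indicator x ≡ + 1
  one-if x eq = trans (cong (λ m → q^ m n) (ℤP.+-injective (trans (e-form x) eq))) (tm-diag (+ 1) n)
  zero-if : ∀ x → form x ≢ + n → indicator x ≡ + 0
  zero-if x ne = tm-off (+ 1) (e x) n (λ n≡e → ne (trans (sym (e-form x)) (cong +_ (sym n≡e))))
  monomial : ∀ x₁ x₂ x₃ x₄ → θ₁ x₁ *ˢ (θ₂ x₂ *ˢ (θ₃ x₃ *ˢ θ₄ x₄)) ≈ q^ (e (x₁ , x₂ , x₃ , x₄))
  monomial x₁ x₂ x₃ x₄ = ≈-trans (*-cong ≈-refl (≈-trans (*-cong ≈-refl (q^-+ (ex k₃ k₃ x₃) (ex k₄ k₄ x₄))) (q^-+ (ex k₂ k₂ x₂) _))) (q^-+ (ex k₁ k₁ x₁) _)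
  distribute : ∀ (f g : PS) (G : ℤ → PS) → f *ˢ (g *ˢ sumˢ G ints) ≈ sumˢ (λ x → f *ˢ (g *ˢ G x)) ints
  distribute f g G = ≈-sym (≈-trans (sumˢ-scale f _ ints) (*-cong ≈-refl (sumˢ-scale g G ints)))
  sum-left : ∀ (G : ℤ → PS) f → sumˢ G ints *ˢ f ≈ sumˢ (λ x → G x *ˢ f) ints
  sum-left G f = ≈-trans (*-comm _ _) (≈-trans (≈-sym (sumˢ-scale f G ints)) (sumˢ-cong ints (λ x → *-comm f (G x))))
  series : sumˢ θ₁ ints *ˢ (sumˢ θ₂ ints *ˢ (sumˢ θ₃ ints *ˢ sumˢ θ₄ ints)) ≈
           (λ m → sumOver (λ x₁ → sumOver (λ x₂ → sumOver (λ x₃ → sumOver (λ x₄ → q^ (e (x₁ , x₂ , x₃ , x₄)) m) ints) ints) ints) ints)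
  series = coeffs λ m → trans (coeff nested m) (trans (sumˢ-coeff _ ints m) (sumOver-cong ints λ x₁ → trans (sumˢ-coeff _ ints m) (sumOver-cong ints λ x₂ →
    trans (sumˢ-coeff _ ints m) (sumOver-cong ints λ x₃ → trans (sumˢ-coeff _ ints m) (sumOver-cong ints λ x₄ → coeff (monomial x₁ x₂ x₃ x₄) m)))))
    where
    nested : sumˢ θ₁ ints *ˢ (sumˢ θ₂ ints *ˢ (sumˢ θ₃ ints *ˢ sumˢ θ₄ ints)) ≈
             sumˢ (λ x₁ → sumˢ (λ x₂ → sumˢ (λ x₃ → sumˢ (λ x₄ → θ₁ x₁ *ˢ (θ₂ x₂ *ˢ (θ₃ x₃ *ˢ θ₄ x₄))) ints) ints) ints) ints
    nested = ≈-trans (sum-left θ₁ _) (sumˢ-cong ints λ x₁ → ≈-trans (*-cong ≈-refl (sum-left θ₂ _)) (≈-trans (≈-sym (sumˢ-scale (θ₁ x₁) _ ints))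
      (sumˢ-cong ints λ x₂ → ≈-trans (*-cong ≈-refl (*-cong ≈-refl (sum-left θ₃ _))) (≈-trans (distribute (θ₁ x₁) (θ₂ x₂) _)
      (sumˢ-cong ints λ x₃ → ≈-trans (*-cong ≈-refl (*-cong ≈-refl (≈-sym (sumˢ-scale (θ₃ x₃) θ₄ ints)))) (distribute (θ₁ x₁) (θ₂ x₂) _))))))

-- Comparison of coefficients over ℚ

ι : ℤ → ℚ
ι x = x / 1

ι-+ : ∀ x y → ι (x ℤ.+ y) ≡ ι x + ι y
ι-+ x y = ℚP.toℚᵘ-injective (ℚᵘP.≃-trans (ℚP.toℚᵘ-fromℚᵘ (ℚᵘ.mkℚᵘ (x ℤ.+ y) 0)) (ℚᵘP.≃-trans (ℚᵘ.*≡* (lemma x y))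
  (ℚᵘP.≃-trans (ℚᵘP.+-cong (ℚᵘP.≃-sym (ℚP.toℚᵘ-fromℚᵘ (ℚᵘ.mkℚᵘ x 0))) (ℚᵘP.≃-sym (ℚP.toℚᵘ-fromℚᵘ (ℚᵘ.mkℚᵘ y 0)))) (ℚᵘP.≃-sym (ℚP.toℚᵘ-homo-+ (ι x) (ι y))))))
  where
  lemma : ∀ x y → (x ℤ.+ y) ℤ.* + 1 ≡ (x ℤ.* + 1 ℤ.+ y ℤ.* + 1) ℤ.* + 1
  lemma = solve-∀

ι-* : ∀ x y → ι (x ℤ.* y) ≡ ι x * ι y
ι-* x y = ℚP.toℚᵘ-injective (ℚᵘP.≃-trans (ℚP.toℚᵘ-fromℚᵘ (ℚᵘ.mkℚᵘ (x ℤ.* y) 0)) (ℚᵘP.≃-trans (ℚᵘ.*≡* refl)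
  (ℚᵘP.≃-trans (ℚᵘP.*-cong (ℚᵘP.≃-sym (ℚP.toℚᵘ-fromℚᵘ (ℚᵘ.mkℚᵘ x 0))) (ℚᵘP.≃-sym (ℚP.toℚᵘ-fromℚᵘ (ℚᵘ.mkℚᵘ y 0)))) (ℚᵘP.≃-sym (ℚP.toℚᵘ-homo-* (ι x) (ι y))))))

open ℚS.+-*-Solver using () renaming (Polynomial to Polyℚ; solve to solveℚ; con to conℚ; _:+_ to _⊕_; _:*_ to _⊗_; _:-_ to _⊖_; _:=_ to _⊜_)

module Coefficient (n : ℕ) .{{_ : NonZero n}} where
  ν : PS → ℚ
  ν f = ι (f n)

  ν-cong : ∀ {f g} → f ≈ g → ν f ≡ ν g
  ν-cong e = cong ι (coeff e n)

  ν-+ : ∀ f g → ν (f +ˢ g) ≡ ν f + ν g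
  ν-+ f g = trans (cong ι (+ˢ-coeff f g n)) (ι-+ (f n) (g n))

  ν-scale : ∀ c f → ν (const c *ˢ f) ≡ ι c * ν f
  ν-scale c f = trans (cong ι (const-*ˢ c f n)) (ι-* c (f n))

  -- As n ≥ 1, the constant terms of the Eisenstein series leave no trace in the formulas.
  ν-const : ∀ c → ν (const c) ≡ ι (+ 0)
  ν-const c = cong ι (vanish n)
    where
    vanish : ∀ m .{{_ : NonZero m}} → const c m ≡ + 0
    vanish (suc m) = const-suc c m

  ν-combine : ∀ f₁ f₂ f₄ f₈ c₀ c₁ c₂ c₄ c₈ → ν (combine f₁ f₂ f₄ f₈ c₀ c₁ c₂ c₄ c₈) ≡
              ι (+ 0) + ι c₁ * ν f₁ + ι c₂ * ν f₂ + ι c₄ * ν f₄ + ι c₈ * ν f₈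
  ν-combine f₁ f₂ f₄ f₈ c₀ c₁ c₂ c₄ c₈ = trans (ν-+ _ _) (cong₂ _+_ (trans (ν-+ _ _) (cong₂ _+_ (trans (ν-+ _ _)
    (cong₂ _+_ (trans (ν-+ _ _) (cong₂ _+_ (ν-const c₀) (ν-scale c₁ f₁))) (ν-scale c₂ f₂))) (ν-scale c₄ f₄))) (ν-scale c₈ f₈))

  ν-minus : ∀ f c g → ν (f -ˢ const c *ˢ g) ≡ ν f + ι (ℤ.- c) * ν g
  ν-minus f c g = trans (ν-cong (+-cong ≈-refl (≈-trans (solve 2 (λ c g → :- (c :* g) := (:- c) :* g) ≈-refl (const c) g) (*-cong (≈-sym (const-homo-neg c)) ≈-refl))))
    (trans (ν-+ f _) (cong (_+_ (ν f)) (ν-scale (ℤ.- c) g)))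

  ν-dil : ∀ k .{{_ : NonZero k}} → ν (dil k sigma) ≡ ι (+ σ/ n k)
  ν-dil k = cong ι (trans (dil-coeff k sigma n) push)
    where
    push : (if does (k ∣? n) then sigma (n ℕ./ k) else + 0) ≡ + σ/ n k
    push with does (k ∣? n)
    ... | true  = refl
    ... | false = refl

  ν-lin : ∀ c₀ c₁ c₂ c₄ c₈ → ν (lin c₀ c₁ c₂ c₄ c₈) ≡
          ι (+ 0) + ι c₁ * ι (+ σ n) + ι c₂ * ι (+ σ/ n 2) + ι c₄ * ι (+ σ/ n 4) + ι c₈ * ι (+ σ/ n 8)
  ν-lin c₀ c₁ c₂ c₄ c₈ = trans (ν-combine s₁ s₂ s₄ s₈ c₀ c₁ c₂ c₄ c₈)
    (cong₂ _+_ (cong₂ _+_ (cong (_+_ (ι (+ 0) + ι c₁ * ι (+ σ n))) (cong (ι c₂ *_) (ν-dil 2))) (cong (ι c₄ *_) (ν-dil 4))) (cong (ι c₈ *_) (ν-dil 8)))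

  ν-lin₅ : ∀ c₀ c₁ c₂ c₄ c₈ → ν (lin₅ c₀ c₁ c₂ c₄ c₈) ≡
           ι (+ 0) + ι c₁ * ι (+ σ/ n 5) + ι c₂ * ι (+ σ/ n 10) + ι c₄ * ι (+ σ/ n 20) + ι c₈ * ι (+ σ/ n 40)
  ν-lin₅ c₀ c₁ c₂ c₄ c₈ = trans (ν-combine s₅ s₁₀ s₂₀ s₄₀ c₀ c₁ c₂ c₄ c₈)
    (cong₂ _+_ (cong₂ _+_ (cong₂ _+_ (cong (_+_ (ι (+ 0))) (cong (ι c₁ *_) (ν-dil 5))) (cong (ι c₂ *_) (ν-dil 10))) (cong (ι c₄ *_) (ν-dil 20))) (cong (ι c₈ *_) (ν-dil 40)))

  ν-eisenstein : ν eisenstein ≡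
    (ι (+ 0) + ι (+ 2) * ι (+ σ n) + ι -[1+ 1 ] * ι (+ σ/ n 2) + ι (+ 4) * ι (+ σ/ n 4) + ι -[1+ 15 ] * ι (+ σ/ n 8))
    + (ι (+ 0) + ι (+ 10) * ι (+ σ/ n 5) + ι -[1+ 9 ] * ι (+ σ/ n 10) + ι (+ 20) * ι (+ σ/ n 20) + ι -[1+ 79 ] * ι (+ σ/ n 40))
  ν-eisenstein = trans (ν-+ _ _) (cong₂ _+_ (ν-lin (+ 3) (+ 2) -[1+ 1 ] (+ 4) -[1+ 15 ]) (ν-lin₅ (+ 0) (+ 10) -[1+ 9 ] (+ 20) -[1+ 79 ]))

  ν-scaled : ∀ c f {x} → x ≡ f n → ν (const c *ˢ f) ≡ ι c * ι x
  ν-scaled c f e = trans (ν-scale c f) (cong (λ z → ι c * ι z) (sym e))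

  ν-subtracted : ∀ f c g {x y} → ν f ≡ y → x ≡ g n → ν (f -ˢ const c *ˢ g) ≡ y + ι (ℤ.- c) * ι x
  ν-subtracted f c g e e′ = trans (ν-minus f c g) (cong₂ (λ y z → y + ι (ℤ.- c) * ι z) e (sym e′))

  third : ∀ f {x y} → x ≡ f n → ν (const (+ 3) *ˢ f) ≡ y → ι x ≡ (+ 1 / 3) * y
  third f {x} e e′ = trans (solveℚ 1 (λ x → x ⊜ conℚ (+ 1 / 3) ⊗ (conℚ (ι (+ 3)) ⊗ x)) refl (ι x))
    (cong (_*_ (+ 1 / 3)) (trans (sym (ν-scaled (+ 3) f e)) e′))

  reassociate : ∀ {x} f₁ f₂ f₃ f₄ → x ≡ (f₁ *ˢ (f₂ *ˢ (f₃ *ˢ f₄))) n → x ≡ (f₁ *ˢ f₂ *ˢ (f₃ *ˢ f₄)) n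
  reassociate f₁ f₂ f₃ f₄ e = trans e (coeff (≈-sym (*-assoc f₁ f₂ (f₃ *ˢ f₄))) n)

linℚ : ∀ {n} → (f₁ f₂ f₄ f₈ : Polyℚ n) → ℤ → ℤ → ℤ → ℤ → Polyℚ n
linℚ f₁ f₂ f₄ f₈ c₁ c₂ c₄ c₈ = conℚ (ι (+ 0)) ⊕ conℚ (ι c₁) ⊗ f₁ ⊕ conℚ (ι c₂) ⊗ f₂ ⊕ conℚ (ι c₄) ⊗ f₄ ⊕ conℚ (ι c₈) ⊗ f₈

theorem3p1 : (n : ℕ) → .{{_ : NonZero n}} →
    ((+ N 1 1 5 5 n / 1)
      ≡ (+ 4 / 3) * (+ σ n / 1) - (+ 16 / 3) * (+ σ/ n 4 / 1) + (+ 20 / 3) * (+ σ/ n 5 / 1)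
        - (+ 80 / 3) * (+ σ/ n 20 / 1) + (+ 8 / 3) * (a₁ n / 1))
    × ((+ N 1 1 10 10 n / 1)
      ≡ (+ 2 / 3) * (+ σ n / 1) - (+ 2 / 3) * (+ σ/ n 2 / 1) + (+ 4 / 3) * (+ σ/ n 4 / 1)
        + (+ 10 / 3) * (+ σ/ n 5 / 1) - (+ 16 / 3) * (+ σ/ n 8 / 1) - (+ 10 / 3) * (+ σ/ n 10 / 1)
        + (+ 20 / 3) * (+ σ/ n 20 / 1) - (+ 80 / 3) * (+ σ/ n 40 / 1)
        + (+ 10 / 3) * (a₁ n / 1) + (+ 8 / 3) * (a₂ n / 1) + (+ 4 / 1) * (a₃ n / 1))
    × ((+ N 1 2 5 10 n / 1)
      ≡ (+ σ n / 1) - (+ σ/ n 2 / 1) - (+ 2 / 1) * (+ σ/ n 4 / 1) - (+ 5 / 1) * (+ σ/ n 5 / 1)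
        + (+ 8 / 1) * (+ σ/ n 8 / 1) + (+ 5 / 1) * (+ σ/ n 10 / 1) + (+ 10 / 1) * (+ σ/ n 20 / 1)
        - (+ 40 / 1) * (+ σ/ n 40 / 1) + (a₁ n / 1) + (+ 2 / 1) * (a₃ n / 1))
    × ((+ N 2 2 5 5 n / 1)
      ≡ (+ 2 / 3) * (+ σ n / 1) - (+ 2 / 3) * (+ σ/ n 2 / 1) + (+ 4 / 3) * (+ σ/ n 4 / 1)
        + (+ 10 / 3) * (+ σ/ n 5 / 1) - (+ 16 / 3) * (+ σ/ n 8 / 1) - (+ 10 / 3) * (+ σ/ n 10 / 1)
        + (+ 20 / 3) * (+ σ/ n 20 / 1) - (+ 80 / 3) * (+ σ/ n 40 / 1)
        - (+ 2 / 3) * (a₁ n / 1) + (+ 8 / 3) * (a₂ n / 1) - (+ 4 / 1) * (a₃ n / 1))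
theorem3p1 n =
    trans (third _ (reassociate a a c c (N-theta 1 1 5 5 n)) (trans (ν-cong theta-1155) (trans (ν-+ _ _) (cong₂ _+_
        (trans (ν-+ _ _) (cong₂ _+_ (ν-lin (+ 0) (+ 4) (+ 0) -[1+ 15 ] (+ 0)) (ν-lin₅ (+ 3) (+ 20) (+ 0) -[1+ 79 ] (+ 0)))) (ν-scaled (+ 8) α₁ (a₁≡ n))))))
      (solveℚ 9 (λ s₁ s₂ s₄ s₈ s₅ s₁₀ s₂₀ s₄₀ x →
         conℚ (+ 1 / 3) ⊗ (linℚ s₁ s₂ s₄ s₈ (+ 4) (+ 0) -[1+ 15 ] (+ 0)
           ⊕ linℚ s₅ s₁₀ s₂₀ s₄₀ (+ 20) (+ 0) -[1+ 79 ] (+ 0) ⊕ conℚ (ι (+ 8)) ⊗ x) ⊜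
         conℚ (+ 4 / 3) ⊗ s₁ ⊖ conℚ (+ 16 / 3) ⊗ s₄ ⊕ conℚ (+ 20 / 3) ⊗ s₅ ⊖ conℚ (+ 80 / 3) ⊗ s₂₀ ⊕ conℚ (+ 8 / 3) ⊗ x) refl
       σ₁ σ₂ σ₄ σ₈ σ₅ σ₁₀ σ₂₀ σ₄₀ (ι (a₁ n)))
  , trans (third _ (reassociate a a d d (N-theta 1 1 10 10 n)) (trans (ν-cong theta-1-1-10-10) (trans (ν-+ _ _) (cong₂ _+_ (trans (ν-+ _ _) (cong₂ _+_
        (trans (ν-+ _ _) (cong₂ _+_ ν-eisenstein (ν-scaled (+ 10) α₁ (a₁≡ n)))) (ν-scaled (+ 8) α₂ (a₂≡ n)))) (ν-scaled (+ 12) α₃ (a₃≡ n))))))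
      (solveℚ 11 (λ s₁ s₂ s₄ s₈ s₅ s₁₀ s₂₀ s₄₀ x y z →
         conℚ (+ 1 / 3) ⊗ ((linℚ s₁ s₂ s₄ s₈ (+ 2) -[1+ 1 ] (+ 4) -[1+ 15 ]
           ⊕ linℚ s₅ s₁₀ s₂₀ s₄₀ (+ 10) -[1+ 9 ] (+ 20) -[1+ 79 ])
           ⊕ conℚ (ι (+ 10)) ⊗ x ⊕ conℚ (ι (+ 8)) ⊗ y ⊕ conℚ (ι (+ 12)) ⊗ z) ⊜
         conℚ (+ 2 / 3) ⊗ s₁ ⊖ conℚ (+ 2 / 3) ⊗ s₂ ⊕ conℚ (+ 4 / 3) ⊗ s₄ ⊕ conℚ (+ 10 / 3) ⊗ s₅ ⊖ conℚ (+ 16 / 3) ⊗ s₈ ⊖ conℚ (+ 10 / 3) ⊗ s₁₀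
           ⊕ conℚ (+ 20 / 3) ⊗ s₂₀ ⊖ conℚ (+ 80 / 3) ⊗ s₄₀ ⊕ conℚ (+ 10 / 3) ⊗ x ⊕ conℚ (+ 8 / 3) ⊗ y ⊕ conℚ (+ 4 / 1) ⊗ z) refl
       σ₁ σ₂ σ₄ σ₈ σ₅ σ₁₀ σ₂₀ σ₄₀ (ι (a₁ n)) (ι (a₂ n)) (ι (a₃ n)))
  , trans (trans (cong ι (reassociate a b c d (N-theta 1 2 5 10 n))) (trans (ν-cong theta-1-2-5-10) (trans (ν-+ _ _) (cong₂ _+_ (trans (ν-+ _ _) (cong₂ _+_
        (trans (ν-+ _ _) (cong₂ _+_ (ν-lin (+ 0) (+ 1) -[1+ 0 ] -[1+ 1 ] (+ 8)) (ν-lin₅ (+ 1) -[1+ 4 ] (+ 5) (+ 10) -[1+ 39 ])))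
        (cong ι (sym (a₁≡ n))))) (ν-scaled (+ 2) α₃ (a₃≡ n))))))
      (solveℚ 10 (λ s₁ s₂ s₄ s₈ s₅ s₁₀ s₂₀ s₄₀ x z →
         linℚ s₁ s₂ s₄ s₈ (+ 1) -[1+ 0 ] -[1+ 1 ] (+ 8)
           ⊕ linℚ s₅ s₁₀ s₂₀ s₄₀ -[1+ 4 ] (+ 5) (+ 10) -[1+ 39 ]
           ⊕ x ⊕ conℚ (ι (+ 2)) ⊗ z ⊜
         s₁ ⊖ s₂ ⊖ conℚ (+ 2 / 1) ⊗ s₄ ⊖ conℚ (+ 5 / 1) ⊗ s₅ ⊕ conℚ (+ 8 / 1) ⊗ s₈ ⊕ conℚ (+ 5 / 1) ⊗ s₁₀ ⊕ conℚ (+ 10 / 1) ⊗ s₂₀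
           ⊖ conℚ (+ 40 / 1) ⊗ s₄₀ ⊕ x ⊕ conℚ (+ 2 / 1) ⊗ z) refl
       σ₁ σ₂ σ₄ σ₈ σ₅ σ₁₀ σ₂₀ σ₄₀ (ι (a₁ n)) (ι (a₃ n)))
  , trans (third _ (reassociate b b c c (N-theta 2 2 5 5 n)) (trans (ν-cong theta-2255)
        (ν-subtracted _ (+ 12) α₃ (trans (ν-+ _ _) (cong₂ _+_ (ν-subtracted _ (+ 2) α₁ ν-eisenstein (a₁≡ n)) (ν-scaled (+ 8) α₂ (a₂≡ n)))) (a₃≡ n))))
      (solveℚ 11 (λ s₁ s₂ s₄ s₈ s₅ s₁₀ s₂₀ s₄₀ x y z →
         conℚ (+ 1 / 3) ⊗ ((linℚ s₁ s₂ s₄ s₈ (+ 2) -[1+ 1 ] (+ 4) -[1+ 15 ]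
           ⊕ linℚ s₅ s₁₀ s₂₀ s₄₀ (+ 10) -[1+ 9 ] (+ 20) -[1+ 79 ])
           ⊕ conℚ (ι -[1+ 1 ]) ⊗ x ⊕ conℚ (ι (+ 8)) ⊗ y ⊕ conℚ (ι -[1+ 11 ]) ⊗ z) ⊜
         conℚ (+ 2 / 3) ⊗ s₁ ⊖ conℚ (+ 2 / 3) ⊗ s₂ ⊕ conℚ (+ 4 / 3) ⊗ s₄ ⊕ conℚ (+ 10 / 3) ⊗ s₅ ⊖ conℚ (+ 16 / 3) ⊗ s₈ ⊖ conℚ (+ 10 / 3) ⊗ s₁₀
           ⊕ conℚ (+ 20 / 3) ⊗ s₂₀ ⊖ conℚ (+ 80 / 3) ⊗ s₄₀ ⊖ conℚ (+ 2 / 3) ⊗ x ⊕ conℚ (+ 8 / 3) ⊗ y ⊖ conℚ (+ 4 / 1) ⊗ z) refl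
       σ₁ σ₂ σ₄ σ₈ σ₅ σ₁₀ σ₂₀ σ₄₀ (ι (a₁ n)) (ι (a₂ n)) (ι (a₃ n)))
  where
  open Coefficient n
  σ₁ σ₂ σ₄ σ₈ σ₅ σ₁₀ σ₂₀ σ₄₀ : ℚ
  σ₁  = ι (+ σ n)
  σ₂  = ι (+ σ/ n 2)
  σ₄  = ι (+ σ/ n 4)
  σ₈  = ι (+ σ/ n 8)
  σ₅  = ι (+ σ/ n 5)
  σ₁₀ = ι (+ σ/ n 10)
  σ₂₀ = ι (+ σ/ n 20)
  σ₄₀ = ι (+ σ/ n 40)
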